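{- Let $h\geq 0$ be an integer, $m=2h+1$, $q=3^m$ and $\alpha=3^{h+1}$ (so $\alpha=\sqrt{3q}$). For $a\in\mathbb{F}_q$ let $f_a(x)=x^{2\alpha+3}+(ax)^{\alpha}-a^2x\in\mathbb{F}_q[x]$. For $a\in\mathbb{F}_q^*$ put $D_a=\{f_a(x^2)\mid x\in\mathbb{F}_q^*\}$. Then for every $a\in\mathbb{F}_q^*$, $D_a$ is a skew Hadamard difference set in the additive group $(\mathbb{F}_q,+)$.
   Context: A $k$-subset $D$ of a finite group $G$ of order $v$ is a $(v,k,\lambda)$ difference set if every non-identity element of $G$ is represented exactly $\lambda$ times as $xy^{ -1}$ with $x,y\in D$, $x\neq y$. A difference set $D$ in $G$ is skew Hadamard if $G$ is the disjoint union of $D$, $D^{(-1)}=\{d^{ -1}\mid d\in D\}$ and $\{1\}$ (in the additive group $(\mathbb{F}_q,+)$: $\mathbb{F}_q$ is the disjoint union of $D$, $-D$ and $\{0\}$). -}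

module Defs where

open import Level using (0ℓ)
open import Data.Nat using (ℕ; zero; suc) renaming (_+_ to _+ℕ_)
open import Data.Fin using (Fin)
open import Data.Fin.Properties using (any?)
open import Data.Bool using (Bool; if_then_else_)
open import Data.Product using (Σ; ∃; _×_; _,_)
open import Data.Sum using (_⊎_)
open import Relation.Nullary using (¬_; Dec; does; _×-dec_; ¬?)
open import Relation.Binary.PropositionalEquality using (_≡_)
open import Algebra.Bundles using (CommutativeRing; Semiring)
import Algebra.Definitions.RawSemiring as RS

sumFin : (n : ℕ) → (Fin n → ℕ) → ℕ
sumFin zero    f = 0
sumFin (suc n) f = f Fin.zero +ℕ sumFin n (λ i → f (Fin.suc i))

countFin : (n : ℕ) → (Fin n → Bool) → ℕ
countFin n p = sumFin n (λ i → if p i then 1 else 0)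

-- A finite field of order q: a commutative ring with 1 ≉ 0 in which every
-- nonzero element is invertible, with decidable equality, together with an
-- enumeration enum : Fin q → Carrier that is a bijection (up to the ring's ≈).
-- (All finite fields of order q are isomorphic, so quantifying over every
-- such structure is the same as speaking of "the" field F_q.)
record FiniteField (q : ℕ) : Set₁ where
  field
    commRing : CommutativeRing 0ℓ 0ℓ
  open CommutativeRing commRing public
  field
    1≉0     : ¬ (1# ≈ 0#)
    inverse : ∀ x → ¬ (x ≈ 0#) → ∃ λ y → (x * y) ≈ 1#
    _≟_     : (x y : Carrier) → Dec (x ≈ y)
    enum    : Fin q → Carrier
    enum-injective  : ∀ i j → enum i ≈ enum j → i ≡ j
    enum-surjective : ∀ x → ∃ λ i → enum i ≈ x
  open RS (Semiring.rawSemiring semiring) public using () renaming (_^_ to _^ᶠ_)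

module _ {q : ℕ} (F : FiniteField q) where
  open FiniteField F

  IsDifferenceSet : (D : Carrier → Set) → (∀ x → Dec (D x)) → ℕ → ℕ → Set
  IsDifferenceSet D D? k lam =
    countFin q (λ i → does (D? (enum i))) ≡ k
    × (∀ g → ¬ (g ≈ 0#) →
         sumFin q (λ i → countFin q (λ j →
           does (D? (enum i) ×-dec D? (enum j) ×-dec ¬? (enum i ≟ enum j)
                 ×-dec ((enum i - enum j) ≟ g))))
         ≡ lam)

  -- F is the disjoint union of D, -D = {-d | d ∈ D} and {0}.
  -- (y ∈ -D  iff  -y ∈ D.)
  SkewPartition : (D : Carrier → Set) → Set
  SkewPartition D = ∀ y →
      ((y ≈ 0#) → ¬ D y × ¬ D (- y))
    × (¬ (y ≈ 0#) → (D y × ¬ D (- y)) ⊎ (¬ D y × D (- y)))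

  IsSkewHadamardDifferenceSet : (D : Carrier → Set) → (∀ x → Dec (D x)) → Set
  IsSkewHadamardDifferenceSet D D? =
    (∃ λ k → ∃ λ lam → IsDifferenceSet D D? k lam) × SkewPartition D

  fₐ : ℕ → Carrier → Carrier → Carrier
  fₐ α a x = (x ^ᶠ (α +ℕ α +ℕ 3)) + ((a * x) ^ᶠ α) - ((a ^ᶠ 2) * x)

  Dₐ : ℕ → Carrier → Carrier → Set
  Dₐ α a y = ∃ λ (i : Fin q) → ¬ (enum i ≈ 0#) × (fₐ α a (enum i ^ᶠ 2) ≈ y)

  Dₐ? : ∀ α a y → Dec (Dₐ α a y)
  Dₐ? α a y = any? (λ i → ¬? (enum i ≟ 0#) ×-dec (fₐ α a (enum i ^ᶠ 2) ≟ y))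

{-# OPTIONS --safe #-}

-- Put α = 3^(h+1) and σ x = x^α, so that σ² is the cube map, and let χ be an additive character with
-- χ ∘ σ = χ. As f_a is odd and injective, everything rests on |Σ_v χ(b f_a(v²))|² = q for b ≠ 0.
-- Replacing v by a multiple turns this sum, up to conjugation, into M(s) = Σ_v χ(c(v²) - s² v²) for some s,
-- where c(x) = x^(α+2) + x. The key identity, with the quadratic Gauss sum G = Σ_v χ(v²), is
--     2 G χ(c(x)) = Σ_y (χ(y^(α+1)) - χ(-y^(α+1))) χ(-x y²).
-- Inserted into M(s) it makes the sum over v Gaussian, and y^(α+1) (y² + s²) = σ u + s² u is additive in
-- u = y^(α+1); this yields G M(s) = q (N - 1), where N = #{w | w² + s² w^(2α) = 1} is 0 or 2.
--
-- On the right of the key identity stand two quadratic Gauss sums, for the forms ± y^(α+1) - x y². If one of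
-- them is degenerate, say x σ τ = ± (τ³ + τ) with τ ≠ 0, then the substitution y = σ τ · m turns both into
-- multiples of (σ m ± m)², and the sums are evaluated directly. A count of these τ shows χ(c(x)) = 1 for
-- all other x, and there the identity is forced by comparing sums and norms over all x.
-- The injectivity of f_a comes from an elimination using σ² x = x³.

module Submission where

open import Defs
open import Algebra.Bundles using (CommutativeRing; RawRing)
open import Algebra.Morphism.Structures using (IsRingMonomorphism)
open import Algebra.Solver.Ring.AlmostCommutativeRing using (fromCommutativeRing; _-Raw-AlmostCommutative⟶_)
open import Algebra.Structures using (IsCommutativeRing)
import Algebra.Morphism.RingMonomorphism as RingMonomorphism
import Algebra.Properties.CommutativeMonoid.Sum as MonoidSum
import Algebra.Properties.CommutativeSemiring.Exp as CommutativeExp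
import Algebra.Properties.Group as GroupProperties
import Algebra.Properties.Semiring.Exp as Exp
import Algebra.Properties.Semiring.Mult as Mult
import Algebra.Properties.Semiring.Sum as SemiringSum
import Algebra.Solver.Ring as CoefficientSolver
import Algebra.Solver.Ring.Simple as RingSolver
open import Data.Bool using (true; false; if_then_else_)
open import Data.Empty using (⊥; ⊥-elim)
open import Data.Fin as Fin using (Fin; zero; suc)
open import Data.Fin.Permutation using (Permutation; permutation)
import Data.Fin.Properties as Finₚ
open import Data.Integer as ℤ using (ℤ; 0ℤ; 1ℤ)
import Data.Integer.Properties as ℤₚ
open import Data.Integer.Solver using () renaming (module +-*-Solver to ℤ-Solver)
open import Data.Maybe using (Maybe; just; nothing)
open import Data.Nat as ℕ using (ℕ; zero; suc)
import Data.Nat.Properties as ℕₚ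
open import Data.Nat.Solver using () renaming (module +-*-Solver to ℕ-Solver)
open import Data.Product using (∃; _×_; _,_; proj₁; proj₂)
open import Data.Sum as Sum using (_⊎_; inj₁; inj₂; [_,_]′)
open import Level using (0ℓ)
open import Relation.Binary.PropositionalEquality hiding ([_])
import Relation.Binary.Reasoning.Setoid as SetoidReasoning
open import Relation.Nullary using (¬_; Dec; yes; no; does; contradiction; ¬?; _×-dec_)
open import Relation.Nullary.Decidable using (_⊎-dec_; dec-true; dec-false)

-- In characteristic 3 every additive character has values in the cube roots of unity, so all sums
-- lie in the Eisenstein integers, where norms are integers and norm 0 forces an element to vanish.
-- A single nontrivial χ suffices, since x ↦ χ(b x) then covers the others. It can be chosen trivial
-- on all σ z - z, because these form a proper subgroup: σ fixes 1. Exponents therefore matter only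
-- modulo such values. How the norm q yields a difference set: as f_a is an odd permutation, the sum
-- over v is also purely imaginary. Twice the transform of D_a at b is this sum minus 1, so its norm
-- is q + 1 for every b ≠ 0, and Fourier inversion makes the number of representations independent
-- of the nonzero difference. The obstacle is the key identity. Where both forms are nondegenerate,
-- each of the two Gauss sums is determined only up to a sign that depends on x, and a pointwise
-- evaluation would have to find it. The proof avoids these signs: a counting argument makes the
-- left side constant at such x, and then equality of the first and second moments over all x leaves
-- no room for an error term.

injective⇒surjective : ∀ {n} (f : Fin n → Fin n) → (∀ {i j} → f i ≡ f j → i ≡ j) →
                       ∀ y → ∃ λ x → f x ≡ y
injective⇒surjective {suc n} f f-injective y with Finₚ.any? (λ x → f x Fin.≟ y)
... | yes hit = hit
... | no miss = contradiction (Finₚ.injective⇒≤ avoid-injective) ℕₚ.1+n≰n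
  where
  y≢f : ∀ x → y ≢ f x
  y≢f x y≡fx = miss (x , sym y≡fx)
  avoid : Fin (suc n) → Fin n
  avoid x = Fin.punchOut (y≢f x)
  avoid-injective : ∀ {i j} → avoid i ≡ avoid j → i ≡ j
  avoid-injective {i} {j} eq = f-injective (Finₚ.punchOut-injective (y≢f i) (y≢f j) eq)

-- The Eisenstein integers

infix 5 _+ω_
data 𝔼 : Set where
  _+ω_ : ℤ → ℤ → 𝔼

infixl 6 _⊞_ _⊟_
infixl 7 _⊠_
infix 8 ⊝_

_⊞_ : 𝔼 → 𝔼 → 𝔼
(a +ω b) ⊞ (c +ω d) = (a ℤ.+ c) +ω (b ℤ.+ d)

-- The rule is ω² = - 1 - ω; conjugation sends ω to ω².
_⊠_ : 𝔼 → 𝔼 → 𝔼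
(a +ω b) ⊠ (c +ω d) = (a ℤ.* c ℤ.- b ℤ.* d) +ω (a ℤ.* d ℤ.+ b ℤ.* c ℤ.- b ℤ.* d)

⊝_ : 𝔼 → 𝔼
⊝ (a +ω b) = (ℤ.- a) +ω (ℤ.- b)

_⊟_ : 𝔼 → 𝔼 → 𝔼
x ⊟ y = x ⊞ ⊝ y

conj : 𝔼 → 𝔼
conj (a +ω b) = (a ℤ.- b) +ω (ℤ.- b)

-- The coordinate at 1 in the basis 1, ω; this is the real part only for rational integers.
re : 𝔼 → ℤ
re (a +ω _) = a

ι : ℕ → 𝔼
ι n = (ℤ.+ n) +ω 0ℤ

𝟘 𝟙 ω : 𝔼
𝟘 = ι 0
𝟙 = ι 1
ω = 0ℤ +ω 1ℤ

𝔼-isCommutativeRing : IsCommutativeRing _≡_ _⊞_ _⊠_ ⊝_ 𝟘 𝟙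
𝔼-isCommutativeRing = record
  { isRing = record
    { +-isAbelianGroup = record
      { isGroup = record
        { isMonoid = record
          { isSemigroup = record
            { isMagma = record { isEquivalence = isEquivalence ; ∙-cong = cong₂ _⊞_ }
            ; assoc = λ { (a +ω b) (c +ω d) (e +ω f) → cong₂ _+ω_ (ℤₚ.+-assoc a c e) (ℤₚ.+-assoc b d f) }
            }
          ; identity = (λ { (a +ω b) → cong₂ _+ω_ (ℤₚ.+-identityˡ a) (ℤₚ.+-identityˡ b) })
                     , (λ { (a +ω b) → cong₂ _+ω_ (ℤₚ.+-identityʳ a) (ℤₚ.+-identityʳ b) })
          }
        ; inverse = (λ { (a +ω b) → cong₂ _+ω_ (ℤₚ.+-inverseˡ a) (ℤₚ.+-inverseˡ b) })
                  , (λ { (a +ω b) → cong₂ _+ω_ (ℤₚ.+-inverseʳ a) (ℤₚ.+-inverseʳ b) })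
        ; ⁻¹-cong = cong ⊝_
        }
      ; comm = λ { (a +ω b) (c +ω d) → cong₂ _+ω_ (ℤₚ.+-comm a c) (ℤₚ.+-comm b d) }
      }
    ; *-cong = cong₂ _⊠_
    ; *-assoc = ⊠-assoc
    ; *-identity = (λ x → trans (⊠-comm 𝟙 x) (⊠-identityʳ x)) , ⊠-identityʳ
    ; distrib = ⊠-distribˡ , λ x y z → trans (⊠-comm (y ⊞ z) x)
                               (trans (⊠-distribˡ x y z) (cong₂ _⊞_ (⊠-comm x y) (⊠-comm x z)))
    }
  ; *-comm = ⊠-comm
  }
  where
  open ℤ-Solver
  ⊠-assoc : ∀ x y z → (x ⊠ y) ⊠ z ≡ x ⊠ (y ⊠ z)
  ⊠-assoc (a +ω b) (c +ω d) (e +ω f) = cong₂ _+ω_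
    (solve 6 (λ a b c d e f →
      (a :* c :- b :* d) :* e :- (a :* d :+ b :* c :- b :* d) :* f
      := a :* (c :* e :- d :* f) :- b :* (c :* f :+ d :* e :- d :* f)) refl a b c d e f)
    (solve 6 (λ a b c d e f →
      (a :* c :- b :* d) :* f :+ (a :* d :+ b :* c :- b :* d) :* e :- (a :* d :+ b :* c :- b :* d) :* f
      := a :* (c :* f :+ d :* e :- d :* f) :+ b :* (c :* e :- d :* f) :- b :* (c :* f :+ d :* e :- d :* f))
      refl a b c d e f)
  ⊠-comm : ∀ x y → x ⊠ y ≡ y ⊠ x
  ⊠-comm (a +ω b) (c +ω d) = cong₂ _+ω_
    (solve 4 (λ a b c d → a :* c :- b :* d := c :* a :- d :* b) refl a b c d)
    (solve 4 (λ a b c d → a :* d :+ b :* c :- b :* d := c :* b :+ d :* a :- d :* b) refl a b c d)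
  ⊠-identityʳ : ∀ x → x ⊠ 𝟙 ≡ x
  ⊠-identityʳ (a +ω b) = cong₂ _+ω_
    (solve 2 (λ a b → a :* con 1ℤ :- b :* con 0ℤ := a) refl a b)
    (solve 2 (λ a b → a :* con 0ℤ :+ b :* con 1ℤ :- b :* con 0ℤ := b) refl a b)
  ⊠-distribˡ : ∀ x y z → x ⊠ (y ⊞ z) ≡ (x ⊠ y) ⊞ (x ⊠ z)
  ⊠-distribˡ (a +ω b) (c +ω d) (e +ω f) = cong₂ _+ω_
    (solve 6 (λ a b c d e f → a :* (c :+ e) :- b :* (d :+ f)
      := (a :* c :- b :* d) :+ (a :* e :- b :* f)) refl a b c d e f)
    (solve 6 (λ a b c d e f → a :* (d :+ f) :+ b :* (c :+ e) :- b :* (d :+ f)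
      := (a :* d :+ b :* c :- b :* d) :+ (a :* f :+ b :* e :- b :* f)) refl a b c d e f)

𝔼-ring : CommutativeRing 0ℓ 0ℓ
𝔼-ring = record { isCommutativeRing = 𝔼-isCommutativeRing }

infix 4 _≟ᴱ_
_≟ᴱ_ : (x y : 𝔼) → Dec (x ≡ y)
(a +ω b) ≟ᴱ (c +ω d) with a ℤ.≟ c | b ℤ.≟ d
... | yes refl | yes refl = yes refl
... | no a≢c   | _        = no λ { refl → a≢c refl }
... | _        | no b≢d   = no λ { refl → b≢d refl }

module 𝔼-Solver = RingSolver (fromCommutativeRing 𝔼-ring) _≟ᴱ_

open CommutativeRing 𝔼-ring public
  using (zeroˡ; zeroʳ)
  renaming ( +-identityˡ to ⊞-identityˡ; +-identityʳ to ⊞-identityʳ; -‿inverseʳ to ⊞-inverseʳ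
           ; *-identityˡ to ⊠-identityˡ; *-identityʳ to ⊠-identityʳ; *-assoc to ⊠-assoc; *-comm to ⊠-comm )

conj-⊞ : ∀ x y → conj (x ⊞ y) ≡ conj x ⊞ conj y
conj-⊞ (a +ω b) (c +ω d) = cong₂ _+ω_
  (solve 4 (λ a b c d → (a :+ c) :- (b :+ d) := (a :- b) :+ (c :- d)) refl a b c d)
  (ℤₚ.neg-distrib-+ b d)
  where open ℤ-Solver

conj-⊠ : ∀ x y → conj (x ⊠ y) ≡ conj x ⊠ conj y
conj-⊠ (a +ω b) (c +ω d) = cong₂ _+ω_
  (solve 4 (λ a b c d → (a :* c :- b :* d) :- (a :* d :+ b :* c :- b :* d)
    := (a :- b) :* (c :- d) :- (:- b) :* (:- d)) refl a b c d)
  (solve 4 (λ a b c d → :- (a :* d :+ b :* c :- b :* d)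
    := (a :- b) :* (:- d) :+ (:- b) :* (c :- d) :- (:- b) :* (:- d)) refl a b c d)
  where open ℤ-Solver

conj-⊝ : ∀ x → conj (⊝ x) ≡ ⊝ (conj x)
conj-⊝ (a +ω b) = cong (_+ω _) (solve 2 (λ a b → (:- a) :- (:- b) := :- (a :- b)) refl a b)
  where open ℤ-Solver

conj-involutive : ∀ x → conj (conj x) ≡ x
conj-involutive (a +ω b) = cong₂ _+ω_
  (solve 2 (λ a b → (a :- b) :- (:- b) := a) refl a b) (ℤₚ.neg-involutive b)
  where open ℤ-Solver

re-⊞ : ∀ x y → re (x ⊞ y) ≡ re x ℤ.+ re y
re-⊞ (_ +ω _) (_ +ω _) = refl

conj-ι : ∀ m → conj (ι m) ≡ ι m
conj-ι m = cong (_+ω 0ℤ) (ℤₚ.+-identityʳ (ℤ.+ m))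

ι-injective : ∀ {m n} → ι m ≡ ι n → m ≡ n
ι-injective refl = refl

-- Takes the place of division: identities are proved after multiplication by 2, 3, 4 or q, so that
-- all sums stay integral.
ι-cancelˡ : ∀ n .{{_ : ℕ.NonZero n}} {x y} → ι n ⊠ x ≡ ι n ⊠ y → x ≡ y
ι-cancelˡ n {a +ω b} {c +ω d} eq = cong₂ _+ω_
  (ℤₚ.*-cancelˡ-≡ (ℤ.+ n) a c (trans (sym (fst a b)) (trans (cong re eq) (fst c d))))
  (ℤₚ.*-cancelˡ-≡ (ℤ.+ n) b d (trans (sym (snd a b)) (trans (cong im eq) (snd c d))))
  where
  open ℤ-Solver
  im : 𝔼 → ℤ
  im (_ +ω b) = b
  fst : ∀ a b → re (ι n ⊠ (a +ω b)) ≡ ℤ.+ n ℤ.* a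
  fst a b = solve 3 (λ n a b → n :* a :- con 0ℤ :* b := n :* a) refl (ℤ.+ n) a b
  snd : ∀ a b → im (ι n ⊠ (a +ω b)) ≡ ℤ.+ n ℤ.* b
  snd a b = solve 3 (λ n a b → n :* b :+ con 0ℤ :* a :- con 0ℤ :* b := n :* b) refl (ℤ.+ n) a b

private
  0≤i*i : ∀ i → 0ℤ ℤ.≤ i ℤ.* i
  0≤i*i (ℤ.+ n) = subst (0ℤ ℤ.≤_) (ℤₚ.pos-* n n) (ℤ.+≤+ ℕ.z≤n)
  0≤i*i ℤ.-[1+ n ] = ℤ.+≤+ ℕ.z≤n

  sum≡0⇒ˡ≡0 : ∀ {i j} → 0ℤ ℤ.≤ i → 0ℤ ℤ.≤ j → i ℤ.+ j ≡ 0ℤ → i ≡ 0ℤ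
  sum≡0⇒ˡ≡0 {i} {j} 0≤i 0≤j eq = ℤₚ.≤-antisym
    (subst₂ ℤ._≤_ (ℤₚ.+-identityʳ i) eq (ℤₚ.+-monoʳ-≤ i 0≤j)) 0≤i

  i*i≡0⇒i≡0 : ∀ i → i ℤ.* i ≡ 0ℤ → i ≡ 0ℤ
  i*i≡0⇒i≡0 i eq with ℤₚ.i*j≡0⇒i≡0∨j≡0 i eq
  ... | inj₁ i≡0 = i≡0
  ... | inj₂ i≡0 = i≡0

  -- Completing the square in the norm form a² - a b + b². Both nonnegativity and definiteness of
  -- the norm are read off from this.
  four-norm : ∀ a b → ℤ.+ 4 ℤ.* re ((a +ω b) ⊠ conj (a +ω b))
            ≡ ℤ.+ 3 ℤ.* (b ℤ.* b) ℤ.+ (ℤ.+ 2 ℤ.* a ℤ.- b) ℤ.* (ℤ.+ 2 ℤ.* a ℤ.- b)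
  four-norm = solve 2 (λ a b → con (ℤ.+ 4) :* (a :* (a :- b) :- b :* (:- b))
    := con (ℤ.+ 3) :* (b :* b) :+ (con (ℤ.+ 2) :* a :- b) :* (con (ℤ.+ 2) :* a :- b)) refl
    where open ℤ-Solver

  0≤3b² : ∀ b → 0ℤ ℤ.≤ ℤ.+ 3 ℤ.* (b ℤ.* b)
  0≤3b² b = ℤₚ.*-monoˡ-≤-nonNeg (ℤ.+ 3) (0≤i*i b)

norm≥0 : ∀ x → 0ℤ ℤ.≤ re (x ⊠ conj x)
norm≥0 (a +ω b) = ℤₚ.*-cancelˡ-≤-pos 0ℤ _ (ℤ.+ 4)
  (subst (0ℤ ℤ.≤_) (sym (four-norm a b)) (ℤₚ.+-mono-≤ (0≤3b² b) (0≤i*i (ℤ.+ 2 ℤ.* a ℤ.- b))))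

norm≡0⇒≡𝟘 : ∀ x → re (x ⊠ conj x) ≡ 0ℤ → x ≡ 𝟘
norm≡0⇒≡𝟘 (a +ω b) eq = cong₂ _+ω_ a≡0 b≡0
  where
  sum≡0 : ℤ.+ 3 ℤ.* (b ℤ.* b) ℤ.+ (ℤ.+ 2 ℤ.* a ℤ.- b) ℤ.* (ℤ.+ 2 ℤ.* a ℤ.- b) ≡ 0ℤ
  sum≡0 = trans (sym (four-norm a b)) (cong (ℤ.+ 4 ℤ.*_) eq)
  b≡0 : b ≡ 0ℤ
  b≡0 = i*i≡0⇒i≡0 b (ℤₚ.*-cancelˡ-≡ (ℤ.+ 3) (b ℤ.* b) 0ℤ
    (sum≡0⇒ˡ≡0 (0≤3b² b) (0≤i*i (ℤ.+ 2 ℤ.* a ℤ.- b)) sum≡0))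
  a≡0 : a ≡ 0ℤ
  a≡0 = i*i≡0⇒i≡0 a (trans (solve 1 (λ a → a :* a := a :* (a :- con 0ℤ) :- con 0ℤ :* con 0ℤ) refl a)
    (subst (λ b → a ℤ.* (a ℤ.- b) ℤ.- b ℤ.* (ℤ.- b) ≡ 0ℤ) b≡0 eq))
    where open ℤ-Solver

-- The Iverson bracket. Counts become sums in 𝔼 and can be multiplied with character values.
[_] : ∀ {p} {P : Set p} → Dec P → 𝔼
[ d ] = if does d then 𝟙 else 𝟘

[]-yes : ∀ {p} {P : Set p} (d : Dec P) → P → [ d ] ≡ 𝟙
[]-yes d p rewrite dec-true d p = refl

[]-no : ∀ {p} {P : Set p} (d : Dec P) → ¬ P → [ d ] ≡ 𝟘
[]-no d ¬p rewrite dec-false d ¬p = refl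

conj-[] : ∀ {p} {P : Set p} (d : Dec P) → conj [ d ] ≡ [ d ]
conj-[] (yes _) = refl
conj-[] (no _)  = refl

[]-× : ∀ {p r} {P : Set p} {R : Set r} (d : Dec P) (e : Dec R) → [ d ×-dec e ] ≡ [ d ] ⊠ [ e ]
[]-× (yes _) (yes _) = refl
[]-× (yes _) (no _)  = refl
[]-× (no _)  (yes _) = refl
[]-× (no _)  (no _)  = refl

[]-cong : ∀ {p r} {P : Set p} {R : Set r} (d : Dec P) (e : Dec R) → (P → R) → (R → P) → [ d ] ≡ [ e ]
[]-cong (yes p) e to from = sym ([]-yes e (to p))
[]-cong (no ¬p) e to from = sym ([]-no e λ r → ¬p (from r))

[]-⊎ : ∀ {p r s} {P : Set p} {R : Set r} {S : Set s} (d : Dec P) (e : Dec R) (f : Dec S) →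
       (P → R ⊎ S) → (R → P) → (S → P) → (R → S → ⊥) → [ d ] ≡ [ e ] ⊞ [ f ]
[]-⊎ d (yes r) (yes s) split from₁ from₂ disjoint = ⊥-elim (disjoint r s)
[]-⊎ d (yes r) (no ¬s) split from₁ from₂ disjoint = []-yes d (from₁ r)
[]-⊎ d (no ¬r) (yes s) split from₁ from₂ disjoint = []-yes d (from₂ s)
[]-⊎ d (no ¬r) (no ¬s) split from₁ from₂ disjoint = []-no d λ p → neither (split p)
  where
  neither : _ ⊎ _ → ⊥
  neither (inj₁ r) = ¬r r
  neither (inj₂ s) = ¬s s

-- Finite sums of Eisenstein integers.

private module 𝔼-Sum = SemiringSum (CommutativeRing.semiring 𝔼-ring)

-- Opaque, so that the summand can be inferred from a sum.
opaque
  sum : ∀ {n} → (Fin n → 𝔼) → 𝔼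
  sum = 𝔼-Sum.sum

  sum-cong : ∀ {n} {f g : Fin n → 𝔼} → (∀ i → f i ≡ g i) → sum f ≡ sum g
  sum-cong = 𝔼-Sum.sum-cong-≗

  sum-⊞ : ∀ {n} (f g : Fin n → 𝔼) → sum (λ i → f i ⊞ g i) ≡ sum f ⊞ sum g
  sum-⊞ = 𝔼-Sum.∑-distrib-+

  ⊠-sum : ∀ {n} x (f : Fin n → 𝔼) → x ⊠ sum f ≡ sum (λ i → x ⊠ f i)
  ⊠-sum = 𝔼-Sum.*-distribˡ-sum

  sum-swap : ∀ {m n} (f : Fin m → Fin n → 𝔼) →
             sum (λ i → sum (f i)) ≡ sum (λ j → sum (λ i → f i j))
  sum-swap = 𝔼-Sum.∑-comm

  sum-const : ∀ n (x : 𝔼) → sum {n} (λ _ → x) ≡ ι n ⊠ x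
  sum-const zero    x = sym (zeroˡ x)
  sum-const (suc n) x = trans (cong (x ⊞_) (sum-const n x))
    (solve 2 (λ x n → x :+ n :* x := (con 𝟙 :+ n) :* x) refl x (ι n))
    where open 𝔼-Solver

  sum-𝟙 : ∀ n → sum {n} (λ _ → 𝟙) ≡ ι n
  sum-𝟙 n = trans (sum-const n 𝟙) (⊠-identityʳ (ι n))

  sum-𝟘 : ∀ {n} (f : Fin n → 𝔼) → (∀ i → f i ≡ 𝟘) → sum f ≡ 𝟘
  sum-𝟘 {n} f f≡𝟘 = trans (sum-cong f≡𝟘) (trans (sum-const n 𝟘) (zeroʳ (ι n)))

  sum-⊟ : ∀ {n} (f g : Fin n → 𝔼) → sum (λ i → f i ⊟ g i) ≡ sum f ⊟ sum g
  sum-⊟ f g = trans (sum-⊞ f _) (cong (sum f ⊞_) (trans (sum-cong λ i → neg (g i))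
    (trans (sym (⊠-sum (⊝ 𝟙) g)) (sym (neg (sum g))))))
    where
    open 𝔼-Solver
    neg : ∀ x → ⊝ x ≡ ⊝ 𝟙 ⊠ x
    neg = solve 1 (λ x → :- x := con (⊝ 𝟙) :* x) refl

  sum-conj : ∀ {n} (f : Fin n → 𝔼) → conj (sum f) ≡ sum (λ i → conj (f i))
  sum-conj {zero}  f = refl
  sum-conj {suc n} f = trans (conj-⊞ (f zero) _) (cong (conj (f zero) ⊞_) (sum-conj (λ i → f (suc i))))

  sum-⊠-sum : ∀ {m n} (f : Fin m → 𝔼) (g : Fin n → 𝔼) →
              sum f ⊠ sum g ≡ sum (λ i → sum (λ j → f i ⊠ g j))
  sum-⊠-sum f g = trans (⊠-comm (sum f) (sum g)) (trans (⊠-sum (sum g) f)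
    (sum-cong λ i → trans (⊠-comm (sum g) (f i)) (⊠-sum (f i) g)))

  sum-reindex : ∀ {n} (f : Fin n → 𝔼) (β : Fin n → Fin n) → (∀ {i j} → β i ≡ β j → i ≡ j) →
                sum (λ i → f (β i)) ≡ sum f
  sum-reindex {n} f β β-injective = sym (𝔼-Sum.sum-permute f (permutation β β⁻¹ β∘β⁻¹ (λ i → β-injective (β∘β⁻¹ (β i)))))
    where
    β⁻¹ : Fin n → Fin n
    β⁻¹ y = proj₁ (injective⇒surjective β β-injective y)
    β∘β⁻¹ : ∀ y → β (β⁻¹ y) ≡ y
    β∘β⁻¹ y = proj₂ (injective⇒surjective β β-injective y)

  sum-mono : ∀ {n} (f g : Fin n → 𝔼) → (∀ i → re (f i) ℤ.≤ re (g i)) → re (sum f) ℤ.≤ re (sum g)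
  sum-mono {zero}  f g f≤g = ℤₚ.≤-refl
  sum-mono {suc n} f g f≤g = subst₂ ℤ._≤_ (sym (re-⊞ (f zero) _)) (sym (re-⊞ (g zero) _))
    (ℤₚ.+-mono-≤ (f≤g zero) (sum-mono (λ i → f (suc i)) (λ i → g (suc i)) (λ i → f≤g (suc i))))

  -- Equal totals leave no slack in any term. This turns a global count into a pointwise statement:
  -- it shows that the cosets cover the field, that kernels exist, and finally that the error in the
  -- key identity is 0.
  sum-tight : ∀ {n} (f g : Fin n → 𝔼) → (∀ i → re (f i) ℤ.≤ re (g i)) → re (sum g) ℤ.≤ re (sum f) →
              ∀ i → re (f i) ≡ re (g i)
  sum-tight {suc n} f g f≤g Σg≤Σf = tight
    where
    f′ g′ : Fin n → 𝔼
    f′ i = f (suc i)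
    g′ i = g (suc i)
    f′≤g′ : re (sum f′) ℤ.≤ re (sum g′)
    f′≤g′ = sum-mono f′ g′ (λ i → f≤g (suc i))
    sums : re (g zero) ℤ.+ re (sum g′) ℤ.≤ re (f zero) ℤ.+ re (sum f′)
    sums = subst₂ ℤ._≤_ (re-⊞ (g zero) _) (re-⊞ (f zero) _) Σg≤Σf
    tight : ∀ i → re (f i) ≡ re (g i)
    tight zero = ℤₚ.≤-antisym (f≤g zero) (ℤₚ.≮⇒≥ λ f₀<g₀ →
      ℤₚ.<⇒≱ (ℤₚ.+-mono-<-≤ f₀<g₀ f′≤g′) sums)
    tight (suc i) = sum-tight f′ g′ (λ i → f≤g (suc i)) (ℤₚ.≮⇒≥ λ f′<g′ →
      ℤₚ.<⇒≱ (ℤₚ.+-mono-≤-< (f≤g zero) f′<g′) sums) i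

  sum-select : ∀ {n} (y : Fin n) (f : Fin n → 𝔼) → sum (λ x → [ x Fin.≟ y ] ⊠ f x) ≡ f y
  sum-select zero f = trans (cong₂ _⊞_ (⊠-identityˡ (f zero)) (sum-𝟘 _ λ i → zeroˡ (f (suc i))))
    (⊞-identityʳ (f zero))
  sum-select (suc y) f = trans (cong₂ _⊞_ (zeroˡ (f zero)) (sum-select y (λ x → f (suc x))))
    (⊞-identityˡ _)

  ι-sumFin : ∀ n (f : Fin n → ℕ) → ι (sumFin n f) ≡ sum (λ i → ι (f i))
  ι-sumFin zero    f = refl
  ι-sumFin (suc n) f = cong (ι (f zero) ⊞_) (ι-sumFin n (λ i → f (suc i)))

-- Finite fields

-- With carrier `Fin q` and propositional equality, a sum over the field is a sum over `Fin q`, and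
-- functions respect equality for free. An arbitrary finite field is moved here along its
-- enumeration.
record Field (q : ℕ) : Set where
  infixl 6 _+_
  infixl 7 _*_
  infix 8 -_
  field
    _+_ _*_ : Fin q → Fin q → Fin q
    -_      : Fin q → Fin q
    0# 1#   : Fin q
    isCommutativeRing : IsCommutativeRing _≡_ _+_ _*_ -_ 0# 1#
    1≢0     : 1# ≢ 0#
    inverse : ∀ x → x ≢ 0# → ∃ λ y → x * y ≡ 1#

  HasCharacteristic3 : Set
  HasCharacteristic3 = 1# + 1# + 1# ≡ 0#

  commutativeRing : CommutativeRing 0ℓ 0ℓ
  commutativeRing = record { isCommutativeRing = isCommutativeRing }

  open CommutativeRing commutativeRing public
    using ( _-_; +-assoc; +-comm; +-identityˡ; +-identityʳ; -‿inverseˡ; -‿inverseʳ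
          ; *-assoc; *-comm; *-identityˡ; *-identityʳ; distribʳ; semiring; commutativeSemiring
          ; +-commutativeMonoid; *-commutativeMonoid; +-group )
    renaming (zeroˡ to *-zeroˡ; zeroʳ to *-zeroʳ)
  open Exp semiring public using (_^_; ^-assocʳ; ^-homo-*)
  open CommutativeExp commutativeSemiring public using (^-distrib-*)

module FieldProperties {q : ℕ} (K : Field q) where
  open Field K
  open GroupProperties +-group using () renaming
    (∙-cancelʳ to +-cancelʳ; ∙-cancelˡ to +-cancelˡ; ⁻¹-injective to -‿injective; x∙y⁻¹≈ε⇒x≈y to x-y≡0⇒x≡y;
        identityʳ-unique to +-identityʳ-unique) public

  *-cancelˡ : ∀ {x y z} → x ≢ 0# → x * y ≡ x * z → y ≡ z
  *-cancelˡ {x} {y} {z} x≢0 eq = trans (sym (undo y)) (trans (cong (x⁻¹ *_) eq) (undo z))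
    where
    x⁻¹ = proj₁ (inverse x x≢0)
    undo : ∀ w → x⁻¹ * (x * w) ≡ w
    undo w = trans (sym (*-assoc x⁻¹ x w)) (trans (cong (_* w) (trans (*-comm x⁻¹ x) (proj₂ (inverse x x≢0))))
        (*-identityˡ w))

  x*y≡0⇒x≡0∨y≡0 : ∀ {x y} → x * y ≡ 0# → x ≡ 0# ⊎ y ≡ 0#
  x*y≡0⇒x≡0∨y≡0 {x} {y} eq with x Fin.≟ 0#
  ... | yes x≡0 = inj₁ x≡0
  ... | no  x≢0 = inj₂ (*-cancelˡ x≢0 (trans eq (sym (*-zeroʳ x))))

  x*y≢0 : ∀ {x y} → x ≢ 0# → y ≢ 0# → x * y ≢ 0#
  x*y≢0 x≢0 y≢0 eq with x*y≡0⇒x≡0∨y≡0 eq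
  ... | inj₁ x≡0 = x≢0 x≡0
  ... | inj₂ y≡0 = y≢0 y≡0

  x*x≡0⇒x≡0 : ∀ {x} → x * x ≡ 0# → x ≡ 0#
  x*x≡0⇒x≡0 eq with x*y≡0⇒x≡0∨y≡0 eq
  ... | inj₁ x≡0 = x≡0
  ... | inj₂ x≡0 = x≡0

  -- The value 0 at 0 makes inversion a permutation of the whole field, so that it can serve as a
  -- change of variables in `sum-kernels`.
  inv : Fin q → Fin q
  inv x with x Fin.≟ 0#
  ... | yes _  = 0#
  ... | no x≢0 = proj₁ (inverse x x≢0)

  x*inv : ∀ {x} → x ≢ 0# → x * inv x ≡ 1#
  x*inv {x} x≢0 with x Fin.≟ 0#
  ... | yes x≡0 = contradiction x≡0 x≢0
  ... | no x≢0′ = proj₂ (inverse x x≢0′)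

  inv-0 : inv 0# ≡ 0#
  inv-0 with 0# Fin.≟ 0#
  ... | yes _  = refl
  ... | no 0≢0 = contradiction refl 0≢0

  inv≢0 : ∀ {x} → x ≢ 0# → inv x ≢ 0#
  inv≢0 {x} x≢0 eq = 1≢0 (trans (sym (x*inv x≢0)) (trans (cong (x *_) eq) (*-zeroʳ x)))

  inv-injective : ∀ {x y} → inv x ≡ inv y → x ≡ y
  inv-injective {x} {y} eq with x Fin.≟ 0# | y Fin.≟ 0#
  ... | yes x≡0 | yes y≡0 = trans x≡0 (sym y≡0)
  ... | yes _   | no y≢0  = contradiction (sym eq) (λ z → 1≢0
      (trans (sym (proj₂ (inverse y y≢0))) (trans (cong (y *_) z) (*-zeroʳ y))))
  ... | no x≢0  | yes _   = contradiction eq (λ z → 1≢0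
      (trans (sym (proj₂ (inverse x x≢0))) (trans (cong (x *_) z) (*-zeroʳ x))))
  ... | no x≢0  | no y≢0  = *-cancelˡ i≢0 (trans (*-comm i x)
      (trans xi≡1 (sym (trans (cong (_* y) eq) (trans (*-comm _ y) (proj₂ (inverse y y≢0)))))))
    where
    i = proj₁ (inverse x x≢0)
    xi≡1 : x * i ≡ 1#
    xi≡1 = proj₂ (inverse x x≢0)
    i≢0 : i ≢ 0#
    i≢0 i≡0 = 1≢0 (trans (sym xi≡1) (trans (cong (x *_) i≡0) (*-zeroʳ x)))

  module +-Sum = MonoidSum +-commutativeMonoid
  module *-Product = MonoidSum *-commutativeMonoid
  open Mult semiring using () renaming (_×_ to _·_; ×1-homo-* to ·1-homo-*) public

  -- Adding 1 permutes the field, so the sum of all elements is unchanged when q copies of 1 are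
  -- added to it.
  q·1≡0 : q · 1# ≡ 0#
  q·1≡0 = trans (sym (+-Sum.sum-replicate q)) (+-identityʳ-unique _ _ shifted)
    where
    shift-permutation : Permutation q q
    shift-permutation = permutation (_+ 1#) (_- 1#)
      (λ x → trans (+-assoc x (- 1#) 1#) (trans (cong (x +_) (-‿inverseˡ 1#)) (+-identityʳ x)))
      (λ x → trans (+-assoc x 1# (- 1#)) (trans (cong (x +_) (-‿inverseʳ 1#)) (+-identityʳ x)))
    shifted : +-Sum.sum (λ x → x) + +-Sum.sum {q} (λ _ → 1#) ≡ +-Sum.sum (λ x → x)
    shifted = trans (sym (+-Sum.∑-distrib-+ (λ x → x) (λ _ → 1#))) (sym (+-Sum.sum-permute (λ x → x) shift-permutation))

  -- Multiplication by x permutes the field, so ∏ w(x·y) = ∏ w(y), where w replaces 0 by 1.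
  fermat : ∀ x → x ^ q ≡ x
  fermat x with x Fin.≟ 0#
  ... | yes refl = 0^n q 1≢0
    where
    0^n : ∀ n {x y : Fin n} → x ≢ y → 0# ^ n ≡ 0#
    0^n (suc n) _ = *-zeroˡ _
  ... | no x≢0 = trans (sym (*-Product.sum-replicate q)) (trans
    (trans (*-Product.sum-cong-≗ (λ y → sym (k*e y))) (*-Product.∑-distrib-+ k e))
    (trans (cong₂ _*_ ∏k≡1 (∏single 0#)) (*-identityˡ x)))
    where
    open *-Product using () renaming (sum to ∏)
    -- `k` is the factor that `w` gains under multiplication by x, and `e` supplies the x that is
    -- missing at 0. Hence x^q is the product of all `k` times the product of all `e`, that is 1
    -- times x.
    w k e : Fin q → Fin q
    w y = if does (y Fin.≟ 0#) then 1# else y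
    k y = if does (y Fin.≟ 0#) then 1# else x
    e y = if does (y Fin.≟ 0#) then x else 1#
    k*e : ∀ y → k y * e y ≡ x
    k*e y with y Fin.≟ 0#
    ... | yes _ = *-identityˡ x
    ... | no _  = *-identityʳ x
    w-* : ∀ y → w (x * y) ≡ k y * w y
    w-* y with y Fin.≟ 0# | (x * y) Fin.≟ 0#
    ... | yes _   | yes _   = sym (*-identityˡ 1#)
    ... | yes y≡0 | no xy≢0 = contradiction (trans (cong (x *_) y≡0) (*-zeroʳ x)) xy≢0
    ... | no y≢0  | yes xy≡0 = contradiction xy≡0 (x*y≢0 x≢0 y≢0)
    ... | no _    | no _    = refl
    w≢0 : ∀ y → w y ≢ 0#
    w≢0 y with y Fin.≟ 0#
    ... | yes _ = 1≢0
    ... | no y≢0 = y≢0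
    ∏≢0 : ∀ {n} (f : Fin n → Fin q) → (∀ i → f i ≢ 0#) → ∏ f ≢ 0#
    ∏≢0 {zero}  f f≢0 = 1≢0
    ∏≢0 {suc n} f f≢0 = x*y≢0 (f≢0 zero) (∏≢0 (λ i → f (suc i)) (λ i → f≢0 (suc i)))
    x⁻¹ = proj₁ (inverse x x≢0)
    xx⁻¹ : ∀ y → x * (x⁻¹ * y) ≡ y
    xx⁻¹ y = trans (sym (*-assoc x x⁻¹ y)) (trans (cong (_* y) (proj₂ (inverse x x≢0))) (*-identityˡ y))
    π : Permutation q q
    π = permutation (x *_) (x⁻¹ *_) xx⁻¹ (λ y → *-cancelˡ x≢0 (xx⁻¹ (x * y)))
    ∏k≡1 : ∏ k ≡ 1#
    ∏k≡1 = *-cancelˡ (∏≢0 w w≢0) (trans (*-comm (∏ w) (∏ k)) (trans (sym (*-Product.∑-distrib-+ k w))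
      (trans (*-Product.sum-cong-≗ (λ y → sym (w-* y)))
          (trans (sym (*-Product.sum-permute w π)) (sym (*-identityʳ (∏ w)))))))
    ∏1≡1 : ∀ n → ∏ {n} (λ _ → 1#) ≡ 1#
    ∏1≡1 zero    = refl
    ∏1≡1 (suc n) = trans (*-identityˡ _) (∏1≡1 n)
    ∏single : ∀ {n} (z : Fin n) → ∏ (λ y → if does (y Fin.≟ z) then x else 1#) ≡ x
    ∏single {suc n} zero    = trans (cong (x *_) (∏1≡1 n)) (*-identityʳ x)
    ∏single {suc n} (suc z) = trans (*-identityˡ _) (∏single z)

-- Fields of characteristic 3

-- Used as the coefficients of the ring solver, as labels of the three cosets behind the character,
-- and as exponents of ω.
data 𝔽₃ : Set where
  o p n : 𝔽₃

-₃_ : 𝔽₃ → 𝔽₃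
-₃ o = o
-₃ p = n
-₃ n = p

_+₃_ : 𝔽₃ → 𝔽₃ → 𝔽₃
o +₃ j = j
p +₃ o = p
p +₃ p = n
p +₃ n = o
n +₃ o = n
n +₃ p = o
n +₃ n = p

_*₃_ : 𝔽₃ → 𝔽₃ → 𝔽₃
o *₃ j = o
p *₃ j = j
n *₃ j = -₃ j

module Characteristic3 {q : ℕ} (K : Field q) (1+1+1≡0 : Field.HasCharacteristic3 K) where
  open Field K
  open FieldProperties K public
  private R = fromCommutativeRing commutativeRing

  embed : 𝔽₃ → Fin q
  embed o = 0#
  embed p = 1#
  embed n = - 1#

  private
    1+1≡-1 : 1# + 1# ≡ - 1#
    1+1≡-1 = +-cancelʳ 1# _ _ (trans 1+1+1≡0 (sym (-‿inverseˡ 1#)))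
    import Algebra.Properties.Ring (CommutativeRing.ring commutativeRing) as Ringₚ

  embed-+ : ∀ i j → embed (i +₃ j) ≡ embed i + embed j
  embed-+ o j = sym (+-identityˡ _)
  embed-+ p o = sym (+-identityʳ _)
  embed-+ p p = sym 1+1≡-1
  embed-+ p n = sym (-‿inverseʳ 1#)
  embed-+ n o = sym (+-identityʳ _)
  embed-+ n p = sym (-‿inverseˡ 1#)
  embed-+ n n = sym (trans (Ringₚ.-‿+-comm 1# 1#) (trans (cong -_ 1+1≡-1) (Ringₚ.-‿involutive 1#)))

  embed-neg : ∀ i → embed (-₃ i) ≡ - embed i
  embed-neg o = sym Ringₚ.-0#≈0#
  embed-neg p = refl
  embed-neg n = sym (Ringₚ.-‿involutive 1#)

  private
    embed-* : ∀ i j → embed (i *₃ j) ≡ embed i * embed j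
    embed-* o j = sym (*-zeroˡ _)
    embed-* p j = sym (*-identityˡ _)
    embed-* n j = trans (embed-neg j) (trans (cong -_ (sym (*-identityˡ _))) (Ringₚ.-‿distribˡ-* 1# (embed j)))

    𝔽₃-raw : RawRing 0ℓ 0ℓ
    𝔽₃-raw = record { Carrier = 𝔽₃ ; _≈_ = _≡_ ; _+_ = _+₃_ ; _*_ = _*₃_ ; -_ = -₃_ ; 0# = o ; 1# = p }

    morphism : 𝔽₃-raw -Raw-AlmostCommutative⟶ R
    morphism = record { ⟦_⟧ = embed ; +-homo = embed-+ ; *-homo = embed-* ; -‿homo = embed-neg
                      ; 0-homo = refl ; 1-homo = refl }

    embed-≟ : (i j : 𝔽₃) → Maybe (embed i ≡ embed j)
    embed-≟ o o = just refl
    embed-≟ p p = just refl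
    embed-≟ n n = just refl
    embed-≟ _ _ = nothing

  -- Coefficients in 𝔽₃ let the solver use 3 = 0.
  module Solver₃ = CoefficientSolver 𝔽₃-raw R morphism embed-≟

  open Solver₃

  -- A certificate format: a - b is exhibited as a combination of the hypotheses l = r with explicit
  -- cofactors k, and the solver checks the resulting polynomial identity. The variants below take
  -- two and three hypotheses.
  linear₁ : ∀ {a b} k {l r} → l ≡ r → a - b ≡ k * (l - r) → a ≡ b
  linear₁ {a} {b} k {l} refl eq = x-y≡0⇒x≡y a b (trans eq (trans (cong (k *_) (-‿inverseʳ l)) (*-zeroʳ k)))

  linear₂ : ∀ {a b} k {l r} k′ {l′ r′} → l ≡ r → l′ ≡ r′ → a - b ≡ k * (l - r) + k′ * (l′ - r′) → a ≡ b
  linear₂ {a} {b} k {l} k′ {l′} refl refl eq = x-y≡0⇒x≡y a b (trans eq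
    (solve 4 (λ k l k′ l′ → k :* (l :- l) :+ k′ :* (l′ :- l′) := con o) refl k l k′ l′))

  linear₃ : ∀ {a b} k {l r} k′ {l′ r′} k″ {l″ r″} → l ≡ r → l′ ≡ r′ → l″ ≡ r″ →
            a - b ≡ k * (l - r) + k′ * (l′ - r′) + k″ * (l″ - r″) → a ≡ b
  linear₃ {a} {b} k {l} k′ {l′} k″ {l″} refl refl refl eq = x-y≡0⇒x≡y a b (trans eq
    (solve 6 (λ k l k′ l′ k″ l″ → k :* (l :- l) :+ k′ :* (l′ :- l′) :+ k″ :* (l″ :- l″) := con o) refl k l k′ l′ k″ l″))

  x≡-x⇒x≡0 : ∀ {x} → x ≡ - x → x ≡ 0#
  x≡-x⇒x≡0 {x} eq = linear₁ (- 1#) eq (solve 1 (λ x → x :- con o := con n :* (x :- (:- x))) refl x)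

  cube≡0⇒x≡0 : ∀ {x} → x * x * x ≡ 0# → x ≡ 0#
  cube≡0⇒x≡0 eq with x*y≡0⇒x≡0∨y≡0 eq
  ... | inj₁ xx≡0 = x*x≡0⇒x≡0 xx≡0
  ... | inj₂ x≡0 = x≡0

  neg-involutive : ∀ x → - (- x) ≡ x
  neg-involutive = solve 1 (λ x → :- (:- x) := x) refl

  neg-0 : - 0# ≡ 0#
  neg-0 = solve 0 (:- con o := con o) refl

  neg≢0 : ∀ {x} → x ≢ 0# → - x ≢ 0#
  neg≢0 {x} x≢0 eq = x≢0 (trans (sym (neg-involutive x)) (trans (cong -_ eq) neg-0))

  square≡⇒ : ∀ {x y} → x * x ≡ y * y → x ≡ y ⊎ x ≡ - y
  square≡⇒ {x} {y} eq with x*y≡0⇒x≡0∨y≡0 {x - y} {x + y}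
    (linear₁ 1# eq (solve 2 (λ x y → (x :- y) :* (x :+ y) :- con o := con p :* (x :* x :- y :* y)) refl x y))
  ... | inj₁ x-y≡0 = inj₁ (x-y≡0⇒x≡y x y x-y≡0)
  ... | inj₂ x+y≡0 = inj₂ (linear₁ 1# x+y≡0 (solve 2 (λ x y → x :- (:- y) := con p :* (x :+ y :- con o)) refl x y))

  -- Maps inducing a bijection from the nonzero elements modulo ±1 onto a half H of the nonzero
  -- elements, with -H the other half.
  record Folding (φ : Fin q → Fin q) : Set where
    field
      same     : ∀ {y z} → φ y ≡ φ z → y ≡ z ⊎ y ≡ - z
      opposite : ∀ {y z} → φ y ≡ - φ z → y ≡ 0#

    private
      -- The numbering of `Fin q` is used only to choose one element from each pair y, - y. Giving φ
      -- the sign of this choice yields `unfold`, which is injective and hence a permutation.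
      positive? : ∀ y → Dec (y Fin.< - y)
      positive? y = y Finₚ.<? - y

      unfold : Fin q → Fin q
      unfold y with positive? y
      ... | yes _ = φ y
      ... | no _  = - φ y

      opposite-signs : ∀ {y} → (y Fin.< - y → - y Fin.< - (- y) → ⊥) × (¬ (y Fin.< - y) → ¬ (- y Fin.< - (- y)) → y ≡ 0#)
      opposite-signs {y} rewrite neg-involutive y =
        (λ y<-y -y<y → Finₚ.<-asym {x = y} {y = - y} y<-y -y<y) ,
        (λ y≮-y -y≮y → x≡-x⇒x≡0 (Finₚ.toℕ-injective (ℕₚ.≤-antisym (ℕₚ.≮⇒≥ -y≮y) (ℕₚ.≮⇒≥ y≮-y))))

      both-zero : ∀ {y z} → φ y ≡ - φ z → y ≡ z
      both-zero {y} {z} eq = trans (opposite eq) (sym (opposite (trans (sym (neg-involutive (φ z))) (cong -_ (sym eq)))))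

      unfold-injective : ∀ {y z} → unfold y ≡ unfold z → y ≡ z
      unfold-injective {y} {z} eq with positive? y | positive? z
      ... | yes _ | no _ = both-zero eq
      ... | no _ | yes _ = sym (both-zero (sym eq))
      ... | yes pos-y | yes pos-z with same eq
      ...   | inj₁ y≡z  = y≡z
      ...   | inj₂ refl = ⊥-elim (proj₁ opposite-signs pos-z pos-y)
      unfold-injective {y} {z} eq | no neg-y | no neg-z with same (-‿injective eq)
      ...   | inj₁ y≡z  = y≡z
      ...   | inj₂ refl = trans (cong -_ z≡0) (trans neg-0 (sym z≡0))
        where z≡0 = proj₂ opposite-signs neg-z neg-y

    surjective : ∀ u → ∃ λ y → u ≡ φ y ⊎ u ≡ - φ y
    surjective u with injective⇒surjective unfold unfold-injective u
    ... | y , eq with positive? y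
    ...   | yes _ = y , inj₁ (sym eq)
    ...   | no _  = y , inj₂ (sym eq)

    -- As unordered pairs, φ y and - φ y are `unfold y` and its negative, and both of these maps
    -- permute the field.
    sum-fold : ∀ f → sum (λ y → f (φ y) ⊞ f (- φ y)) ≡ ι 2 ⊠ sum f
    sum-fold f = begin
      sum (λ y → f (φ y) ⊞ f (- φ y))                        ≡⟨ sum-cong swap ⟩
      sum (λ y → f (unfold y) ⊞ f (- unfold y))               ≡⟨ sum-⊞ _ _ ⟩
      sum (λ y → f (unfold y)) ⊞ sum (λ y → f (- unfold y))   ≡⟨ cong₂ _⊞_ (sum-reindex f unfold unfold-injective)
                                                                   (sum-reindex f (λ y → - unfold y)
                                                                       (λ eq → unfold-injective (-‿injective eq))) ⟩
      sum f ⊞ sum f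
          ≡⟨ S.solve 1 (λ s → s S.:+ s S.:= S.con (ι 2) S.:* s) refl (sum f) ⟩
      ι 2 ⊠ sum f                                             ∎
      where
      module S = 𝔼-Solver
      open ≡-Reasoning
      swap : ∀ y → f (φ y) ⊞ f (- φ y) ≡ f (unfold y) ⊞ f (- unfold y)
      swap y with positive? y
      ... | yes _ = refl
      ... | no _  = trans (S.solve 2 (λ s t → s S.:+ t S.:= t S.:+ s) refl (f (φ y)) (f (- φ y)))
                          (cong (f (- φ y) ⊞_) (cong f (sym (neg-involutive (φ y)))))

-- σ stands for x ↦ x^α, where α² = 3 q.
record Twist {q : ℕ} (K : Field q) : Set where
  open Field K
  field
    1+1+1≡0 : HasCharacteristic3
    σ    : Fin q → Fin q
    σ-+  : ∀ x y → σ (x + y) ≡ σ x + σ y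
    σ-*  : ∀ x y → σ (x * y) ≡ σ x * σ y
    σσ   : ∀ x → σ (σ x) ≡ x * x * x

-- Arithmetic of the twist σ, and injectivity of f.

module TwistProperties {q : ℕ} {K : Field q} (twist : Twist K) where
  open Field K
  open Twist twist
  open Characteristic3 K 1+1+1≡0
  open Solver₃

  σ-0 : σ 0# ≡ 0#
  σ-0 = +-identityʳ-unique (σ 0#) (σ 0#) (trans (sym (σ-+ 0# 0#)) (cong σ (+-identityʳ 0#)))

  σ-neg : ∀ x → σ (- x) ≡ - σ x
  σ-neg x = linear₁ 1# (trans (sym (σ-+ x (- x))) (trans (cong σ (-‿inverseʳ x)) σ-0))
    (solve 2 (λ s t → s :- (:- t) := con p :* ((t :+ s) :- con o)) refl (σ (- x)) (σ x))

  σ-sub : ∀ x y → σ (x - y) ≡ σ x - σ y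
  σ-sub x y = trans (σ-+ x (- y)) (cong (σ x +_) (σ-neg y))

  σx≡0⇒x≡0 : ∀ {x} → σ x ≡ 0# → x ≡ 0#
  σx≡0⇒x≡0 {x} eq = cube≡0⇒x≡0 (trans (sym (σσ x)) (trans (cong σ eq) σ-0))

  σ≢0 : ∀ {x} → x ≢ 0# → σ x ≢ 0#
  σ≢0 x≢0 eq = x≢0 (σx≡0⇒x≡0 eq)

  σ-injective : ∀ {x y} → σ x ≡ σ y → x ≡ y
  σ-injective {x} {y} eq = x-y≡0⇒x≡y x y (σx≡0⇒x≡0 (trans (σ-sub x y)
    (trans (cong (_- σ y) eq) (-‿inverseʳ (σ y)))))

  σ-1 : σ 1# ≡ 1#
  σ-1 = *-cancelˡ (σ≢0 1≢0) (trans (sym (σ-* 1# 1#)) (trans (cong σ (*-identityʳ 1#)) (sym (*-identityʳ (σ 1#)))))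

  σ-inverse : ∀ {x y} → x * y ≡ 1# → σ x * σ y ≡ 1#
  σ-inverse {x} {y} eq = trans (sym (σ-* x y)) (trans (cong σ eq) σ-1)

  cube≡x⇒ : ∀ {x} → x * x * x ≡ x → x ≡ 0# ⊎ x ≡ 1# ⊎ x ≡ - 1#
  cube≡x⇒ {x} eq = [ inj₁
    , (λ eq′ → inj₂ ([ (λ x-1≡0 → inj₁ (x-y≡0⇒x≡y x 1# x-1≡0))
                     , (λ x+1≡0 → inj₂ (linear₁ 1# x+1≡0
                         (solve 1 (λ x → x :- con n := con p :* (x :+ con p :- con o)) refl x))) ]′
                     (x*y≡0⇒x≡0∨y≡0 eq′))) ]′
    (x*y≡0⇒x≡0∨y≡0 (linear₁ 1# eq
      (solve 1 (λ x → x :* ((x :- con p) :* (x :+ con p)) :- con o := con p :* (x :* x :* x :- x)) refl x)))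

  σ-fixed : ∀ {x} → σ x ≡ x → x ≡ 0# ⊎ x ≡ 1# ⊎ x ≡ - 1#
  σ-fixed {x} eq = cube≡x⇒ (trans (sym (σσ x)) (trans (cong σ eq) eq))

  σ-antifixed : ∀ {x} → σ x ≡ - x → x ≡ 0#
  σ-antifixed {x} eq = [ (λ x≡0 → x≡0)
    , [ (λ x≡1 → contradiction (x≡-x⇒x≡0 (trans (sym σ-1) (trans (cong σ (sym x≡1)) (trans eq (cong -_ x≡1))))) 1≢0)
      , (λ x≡-1 → contradiction (x≡-x⇒x≡0 (trans (sym (trans (σ-neg 1#) (cong -_ σ-1)))
          (trans (cong σ (sym x≡-1)) (trans eq (cong -_ x≡-1))))) (neg≢0 1≢0)) ]′ ]′
    (cube≡x⇒ (trans (sym (σσ x)) (trans (cong σ eq) (trans (σ-neg x) (trans (cong -_ eq) (neg-involutive x))))))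

  -- A square root j of - 1 would have σ j = ± j and thus σ² j = j, whereas σ² j = j³ = - j. The odd
  -- degree of the field enters here, through the existence of σ.
  j*j≢-1 : ∀ {j} → j * j ≢ - 1#
  j*j≢-1 {j} eq = 1≢0 (linear₂ 1# (- j) eq j≡0 (solve 1
      (λ j → con p :- con o := con p :* (j :* j :- con n) :+ (:- j) :* (j :- con o)) refl j))
    where
    σσj≡j : σ (σ j) ≡ j
    σσj≡j = [ (λ σj≡j → trans (cong σ σj≡j) σj≡j)
            , (λ σj≡-j → trans (cong σ σj≡-j) (trans (σ-neg j) (trans (cong -_ σj≡-j) (neg-involutive j)))) ]′
      (square≡⇒ (trans (sym (σ-* j j)) (trans (cong σ eq) (trans (σ-neg 1#) (trans (cong -_ σ-1) (sym eq))))))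
    j≡0 : j ≡ 0#
    j≡0 = x≡-x⇒x≡0 (linear₂ j (- 1#) eq (trans (sym (σσ j)) σσj≡j)
      (solve 1 (λ j → j :- (:- j) := j :* (j :* j :- con n) :+ con n :* (j :* j :* j :- j)) refl j))

  -- The three foldings are v ↦ v², v ↦ v^(α+1) and v ↦ v^(2α+4).

  square-folding : Folding (λ y → y * y)
  square-folding = record { same = square≡⇒ ; opposite = opposite }
    where
    opposite : ∀ {y z} → y * y ≡ - (z * z) → y ≡ 0#
    opposite {y} {z} eq with y Fin.≟ 0#
    ... | yes y≡0 = y≡0
    ... | no  y≢0 = contradiction
      (linear₂ (inv y * inv y) (- (y * inv y + 1#)) eq (x*inv y≢0)
        (solve 3 (λ y z i → z :* i :* (z :* i) :- con n := i :* i :* (y :* y :- (:- (z :* z))) :+ (:- (y :* i :+ con p))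
            :* (y :* i :- con p)) refl y z (inv y)))
      j*j≢-1

  quotient : ∀ {y z e} → z ≢ 0# → y * inv z ≡ e → y ≡ e * z
  quotient {y} {z} {e} z≢0 eq = linear₂ z (- y) eq (x*inv z≢0)
    (solve 4 (λ y z i e → y :- e :* z := z :* (y :* i :- e) :+ (:- y) :* (z :* i :- con p)) refl y z (inv z) e)

  private
    ±1 : Fin q → Set
    ±1 e = e ≡ 1# ⊎ e ≡ - 1#

    σ-±1 : ∀ {e} → ±1 e → σ e ≡ e
    σ-±1 (inj₁ refl) = σ-1
    σ-±1 (inj₂ refl) = trans (σ-neg 1#) (cong -_ σ-1)

    ±1≢0 : ∀ {e} → ±1 e → e ≢ 0#
    ±1≢0 (inj₁ refl) = 1≢0
    ±1≢0 (inj₂ refl) = neg≢0 1≢0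

    -- Applying σ gives σ k · k³ = e; comparison with k · σ k = e leaves k² = 1.
    kσk≡±1⇒k≡±1 : ∀ {k e} → ±1 e → k * σ k ≡ e → ±1 k
    kσk≡±1⇒k≡±1 {k} {e} e±1 eq = square≡⇒ {k} {1#} (*-cancelˡ (±1≢0 e±1) (linear₂ (- (k * k)) 1# eq σeq
       (solve 3 (λ k s e → e :* (k :* k) :- e :* (con p :* con p)
         := (:- (k :* k)) :* (k :* s :- e) :+ con p :* (s :* (k :* k :* k) :- e)) refl k (σ k) e)))
      where
      σeq : σ k * (k * k * k) ≡ e
      σeq = trans (cong (σ k *_) (sym (σσ k))) (trans (sym (σ-* k (σ k))) (trans (cong σ eq) (σ-±1 e±1)))

    quotient-±1 : ∀ {y z} → z ≢ 0# → ±1 (y * inv z) → y ≡ z ⊎ y ≡ - z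
    quotient-±1 {y} {z} z≢0 (inj₁ eq) = inj₁ (trans (quotient z≢0 eq) (*-identityˡ z))
    quotient-±1 {y} {z} z≢0 (inj₂ eq) = inj₂ (trans (quotient z≢0 eq) (solve 1 (λ z → con n :* z := :- z) refl z))

  twisted-square-folding : Folding (λ y → y * σ y)
  twisted-square-folding = record { same = same ; opposite = opposite }
    where
    yσy≡0⇒y≡0 : ∀ {y} → y * σ y ≡ 0# → y ≡ 0#
    yσy≡0⇒y≡0 eq with x*y≡0⇒x≡0∨y≡0 eq
    ... | inj₁ y≡0 = y≡0
    ... | inj₂ σy≡0 = σx≡0⇒x≡0 σy≡0
    quotients : ∀ {y z e} → z ≢ 0# → y * σ y ≡ e * (z * σ z) → y * inv z * σ (y * inv z) ≡ e
    quotients {y} {z} {e} z≢0 eq = trans (cong (y * inv z *_) (σ-* y (inv z)))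
        (linear₃ (i * σ i) e (e * (z * i)) eq (x*inv z≢0) (σ-inverse (x*inv z≢0))
      (solve 7 (λ y z i e Y Z I → y :* i :* (Y :* I) :- e := i :* I :* (y :* Y :- e :* (z :* Z)) :+ e :*
          (z :* i :- con p) :+ e :* (z :* i) :* (Z :* I :- con p))
        refl y z i e (σ y) (σ z) (σ i)))
      where i = inv z
    same : ∀ {y z} → y * σ y ≡ z * σ z → y ≡ z ⊎ y ≡ - z
    same {y} {z} eq with z Fin.≟ 0#
    ... | yes refl = inj₁ (yσy≡0⇒y≡0 (trans eq (*-zeroˡ _)))
    ... | no z≢0 = quotient-±1 z≢0 (kσk≡±1⇒k≡±1 (inj₁ refl) (quotients z≢0 (trans eq (sym (*-identityˡ _)))))
    opposite : ∀ {y z} → y * σ y ≡ - (z * σ z) → y ≡ 0#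
    opposite {y} {z} eq with z Fin.≟ 0#
    ... | yes refl = yσy≡0⇒y≡0 (trans eq (trans (cong -_ (*-zeroˡ _)) neg-0))
    ... | no z≢0 = contradiction (x≡-x⇒x≡0 (trans (sym (case k±1)) kσk≡-1)) 1≢0
      where
      k = y * inv z
      kσk≡-1 : k * σ k ≡ - 1#
      kσk≡-1 = quotients z≢0 (trans eq (solve 1 (λ u → :- u := con n :* u) refl _))
      k±1 : ±1 k
      k±1 = kσk≡±1⇒k≡±1 (inj₂ refl) kσk≡-1
      case : ∀ {k} → ±1 k → k * σ k ≡ 1#
      case {k} k±1 = trans (cong (k *_) (σ-±1 k±1)) (kk k±1)
        where
        kk : ∀ {k} → ±1 k → k * k ≡ 1#
        kk (inj₁ refl) = *-identityʳ 1#
        kk (inj₂ refl) = solve 0 (con n :* con n := con p) refl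

  quartic-folding : Folding (λ w → w * w * (w * w) * σ (w * w))
  quartic-folding = record { same = same ; opposite = opposite }
    where
    open Folding square-folding renaming (same to square-same; opposite to square-opposite)
    -- The square of the equation is k⁴ (σ k)² = 1 and its image under σ is k³ (σ k)² = 1; their
    -- quotient is k.
    unit : ∀ {k} → k * k * σ k ≡ 1# → k ≡ 1#
    unit {k} eq = linear₂ (k * k * σ k + 1#) (- k) eq σeq
      (solve 2 (λ k s → k :- con p
        := (k :* k :* s :+ con p) :* (k :* k :* s :- con p) :+ (:- k) :* (s :* s :* (k :* k :* k) :- con p)) refl k (σ k))
      where
      σeq : σ k * σ k * (k * k * k) ≡ 1#
      σeq = trans (cong₂ _*_ (sym (σ-* k k)) (sym (σσ k))) (trans (sym (σ-* (k * k) (σ k))) (trans (cong σ eq) σ-1))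
    zero-case : ∀ {Y} → Y * Y * σ Y ≡ 0# → Y ≡ 0#
    zero-case eq with x*y≡0⇒x≡0∨y≡0 eq
    ... | inj₁ YY≡0 = x*x≡0⇒x≡0 YY≡0
    ... | inj₂ σY≡0 = σx≡0⇒x≡0 σY≡0
    quotients : ∀ {y z e} → z ≢ 0# → y * y * σ y ≡ e * (z * z * σ z) →
                y * inv z * (y * inv z) * σ (y * inv z) ≡ e
    quotients {y} {z} {e} z≢0 eq = trans (cong (y * i * (y * i) *_) (σ-* y i))
      (linear₃ (i * i * σ i) (e * ((z * i + 1#) * (σ z * σ i))) e eq (x*inv z≢0) (σ-inverse (x*inv z≢0))
        (solve 7 (λ y z i e Y Z I → y :* i :* (y :* i) :* (Y :* I) :- e
          := i :* i :* I :* (y :* y :* Y :- e :* (z :* z :* Z))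
             :+ e :* ((z :* i :+ con p) :* (Z :* I)) :* (z :* i :- con p) :+ e :* (Z :* I :- con p))
          refl y z i e (σ y) (σ z) (σ i)))
      where i = inv z
    same : ∀ {y z} → y * y * (y * y) * σ (y * y) ≡ z * z * (z * z) * σ (z * z) → y ≡ z ⊎ y ≡ - z
    same {y} {z} eq with z * z Fin.≟ 0#
    ... | yes zz≡0 = inj₁ (trans (x*x≡0⇒x≡0 (zero-case (trans eq (trans (cong (_* σ (z * z)) (cong₂ _*_ zz≡0 zz≡0))
                       (solve 1 (λ u → con o :* con o :* u := con o) refl (σ (z * z))))))) (sym (x*x≡0⇒x≡0 zz≡0)))
    ... | no zz≢0 = square-same (trans (quotient zz≢0 (unit (quotients zz≢0 (trans eq (sym (*-identityˡ _))))))
        (*-identityˡ _))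
    opposite : ∀ {y z} → y * y * (y * y) * σ (y * y) ≡ - (z * z * (z * z) * σ (z * z)) → y ≡ 0#
    opposite {y} {z} eq with z * z Fin.≟ 0#
    ... | yes zz≡0 = x*x≡0⇒x≡0 (zero-case (trans eq (trans (cong (λ t → - (t * σ (z * z))) (cong₂ _*_ zz≡0 zz≡0))
                       (solve 1 (λ u → :- (con o :* con o :* u) := con o) refl (σ (z * z))))))
    ... | no zz≢0 = square-opposite {y} {z} (trans (quotient zz≢0 k≡-1) (solve 1 (λ z → con n :* z := :- z) refl (z * z)))
      where
      k = y * y * inv (z * z)
      kkσk≡-1 : k * k * σ k ≡ - 1#
      kkσk≡-1 = quotients zz≢0 (trans eq (solve 1 (λ u → :- u := con n :* u) refl _))
      k≡-1 : k ≡ - 1#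
      k≡-1 = -‿injective (trans (unit (trans (cong (- k * - k *_) (σ-neg k))
        (linear₁ (- 1#) kkσk≡-1 (solve 2 (λ k s → (:- k) :* (:- k) :* (:- s) :- con p := con n :*
            (k :* k :* s :- con n)) refl k (σ k)))))
        (sym (neg-involutive 1#)))

  -- Eliminating σ g and σ² g = g³ from the equation gives a product of two factors, interchanged by R ↦ - R.
  private
    module Elimination (g R : Fin q) (eq : g * g - σ g ≡ R * R - R * σ R + 1#)
                       (factor≡0 : (R + σ R + g) * R + g * g + g + (R + σ R) ≡ 0#) where
      T = σ R
      -- The shift by 1 brings the vanishing factor into the form ρ (τ + 1) = - δ² with τ = σ ρ.
      ρ = R + 1#
      δ = ρ - g
      τ = T + 1#

      σρ : σ ρ ≡ τ
      σρ = trans (σ-+ R 1#) (cong (T +_) σ-1)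

      ρ[τ+1] : ρ * (τ + 1#) ≡ - (δ * δ)
      ρ[τ+1] = linear₁ 1# factor≡0 (solve 3 (λ g R T →
        (R :+ con p) :* (T :+ con p :+ con p) :- (:- ((R :+ con p :- g) :* (R :+ con p :- g)))
        := con p :* ((R :+ T :+ g) :* R :+ g :* g :+ g :+ (R :+ T) :- con o)) refl g R T)

      σδ : σ δ ≡ 1# - τ - ρ * δ
      σδ = trans (trans (σ-sub ρ g) (cong (_- σ g) σρ)) (linear₂ 1# (- 1#) eq ρ[τ+1] (solve 4 (λ g R T γ →
        T :+ con p :- γ :- (con p :- (T :+ con p) :- (R :+ con p) :* (R :+ con p :- g))
        := con p :* (g :* g :- γ :- (R :* R :- R :* T :+ con p))
           :+ con n :* ((R :+ con p) :* (T :+ con p :+ con p) :- (:- ((R :+ con p :- g) :* (R :+ con p :- g))))) refl g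
               R T (σ g)))

      ρ≢0 : ρ ≢ 0#
      ρ≢0 ρ≡0 = 1≢0 (linear₃ (- 1#) 1# δ σδ₀ (trans (sym σρ) (trans (cong σ ρ≡0) σ-0)) ρ≡0
        (solve 3 (λ τ ρ δ → con p :- con o := con n :* (con o :- (con p :- τ :- ρ :* δ)) :+ con p :* (τ :- con o) :+ δ
            :* (ρ :- con o)) refl τ ρ δ))
        where
        δ≡0 : δ ≡ 0#
        δ≡0 = x*x≡0⇒x≡0 (linear₂ 1# (- (τ + 1#)) ρ[τ+1] ρ≡0 (solve 3 (λ τ ρ δ →
          δ :* δ :- con o := con p :* (ρ :* (τ :+ con p) :- (:- (δ :* δ))) :+ (:- (τ :+ con p)) :* (ρ :- con o)) refl τ ρ δ))
        σδ₀ : 0# ≡ 1# - τ - ρ * δ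
        σδ₀ = trans (sym (trans (cong σ δ≡0) σ-0)) σδ

      -- In terms of the ratio κ the relation becomes τ + 1 = - ρ κ². Together with its image under
      -- σ and the expression for σ δ this gives three equations in ρ, τ, κ and ƛ = σ κ.
      κ = δ * inv ρ
      ƛ = σ κ

      δ≡ρκ : δ ≡ ρ * κ
      δ≡ρκ = trans (quotient ρ≢0 refl) (*-comm κ ρ)

      τ+1 : τ + 1# ≡ - (ρ * (κ * κ))
      τ+1 = *-cancelˡ ρ≢0 (trans ρ[τ+1] (trans (cong (λ d → - (d * d)) δ≡ρκ)
        (solve 2 (λ ρ κ → :- (ρ :* κ :* (ρ :* κ)) := ρ :* (:- (ρ :* (κ :* κ)))) refl ρ κ)))

      τƛ : τ * ƛ ≡ 1# - τ - ρ * ρ * κ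
      τƛ = trans (trans (cong (_* ƛ) (sym σρ)) (trans (sym (σ-* ρ κ)) (cong σ (sym δ≡ρκ))))
        (trans σδ (cong (λ u → 1# - τ - u) (trans (cong (ρ *_) δ≡ρκ) (sym (*-assoc ρ ρ κ)))))

      ρ³+1 : ρ * ρ * ρ + 1# ≡ - (τ * (ƛ * ƛ))
      ρ³+1 = trans (cong₂ _+_ (trans (sym (σσ ρ)) (cong σ σρ)) (sym σ-1)) (trans (sym (σ-+ τ 1#))
        (trans (cong σ τ+1) (trans (σ-neg _) (cong -_ (trans (σ-* ρ (κ * κ)) (cong₂ _*_ σρ (σ-* κ κ)))))))

      -- Start from τ (ρ³ + 1) = - (τ ƛ)². Both τ and τ ƛ are polynomials in ρ and κ by the two
      -- other relations; after substitution the polynomial splits, since κ³ - 1 = (κ - 1)³.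
      product≡0 : ρ * ρ * ((κ - 1#) * (κ - 1#) * (κ - 1#) * (κ + ρ)) ≡ 0#
      product≡0 = linear₃ (- (ρ * ρ * ρ + 1# + (1# - ρ * ρ * κ) + τ - 1# - ρ * (κ * κ)))
                          (- (τ * ƛ + (1# - τ - ρ * ρ * κ))) τ τ+1 τƛ ρ³+1
        (solve 4 (λ ρ κ τ l → ρ :* ρ :* ((κ :- con p) :* (κ :- con p) :* (κ :- con p) :* (κ :+ ρ)) :- con o
          := (:- (ρ :* ρ :* ρ :+ con p :+ (con p :- ρ :* ρ :* κ) :+ τ :- con p :- ρ :* (κ :* κ))) :*
              (τ :+ con p :- (:- (ρ :* (κ :* κ))))
             :+ (:- (τ :* l :+ (con p :- τ :- ρ :* ρ :* κ))) :* (τ :* l :- (con p :- τ :- ρ :* ρ :* κ))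
             :+ τ :* (ρ :* ρ :* ρ :+ con p :- (:- (τ :* (l :* l))))) refl ρ κ τ ƛ)

      κ≢1 : κ ≢ 1#
      κ≢1 κ≡1 = 1≢0 (linear₃ (- 1#) 1# 1# τ+1≡-ρ ρ≡-1 τ≡-1
        (solve 2 (λ ρ τ → con p :- con o := con n :* (τ :+ con p :- (:- ρ)) :+ con p :* (ρ :- con n) :+ con p :*
            (τ :- con n)) refl ρ τ))
        where
        τ+1≡-ρ : τ + 1# ≡ - ρ
        τ+1≡-ρ = trans τ+1 (cong -_ (trans (cong (λ k → ρ * (k * k)) κ≡1)
            (solve 1 (λ ρ → ρ :* (con p :* con p) := ρ) refl ρ)))
        τ≡ : τ * 1# ≡ 1# - τ - ρ * ρ * 1#
        τ≡ = trans (cong (τ *_) (sym (trans (cong σ κ≡1) σ-1))) (trans τƛ (cong (λ k → 1# - τ - ρ * ρ * k) κ≡1))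
        ρ≡-1 : ρ ≡ - 1#
        ρ≡-1 = [ (λ ρ≡0 → contradiction ρ≡0 ρ≢0)
               , (λ ρ+1≡0 → linear₁ 1# ρ+1≡0 (solve 1 (λ ρ → ρ :- con n := con p :* (ρ :+ con p :- con o)) refl ρ)) ]′
          (x*y≡0⇒x≡0∨y≡0 {ρ} {ρ + 1#} (linear₂ 1# 1# τ≡ τ+1≡-ρ (solve 2 (λ ρ τ → ρ :* (ρ :+ con p) :- con o
            := con p :* (τ :* con p :- (con p :- τ :- ρ :* ρ :* con p)) :+ con p :* (τ :+ con p :- (:- ρ))) refl ρ τ)))
        τ≡-1 : τ ≡ - 1#
        τ≡-1 = trans (sym σρ) (trans (cong σ ρ≡-1) (trans (σ-neg 1#) (cong -_ σ-1)))

      ρ≢-κ : ρ ≢ - κ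
      ρ≢-κ ρ≡-κ =
        [ (λ ƛ≡0 → ρ≢0 (trans ρ≡-κ (trans (cong -_ (σx≡0⇒x≡0 ƛ≡0)) neg-0)))
        , (λ ƛ-1≡0 → κ≢1 (σ-injective (trans (x-y≡0⇒x≡y ƛ 1# ƛ-1≡0) (sym σ-1)))) ]′
        (x*y≡0⇒x≡0∨y≡0 {ƛ} {ƛ - 1#} (linear₃ (ƛ - 1#) (- 1#) (- 1#) (trans (sym σρ) (trans (cong σ ρ≡-κ) (σ-neg κ)))
          (trans τ+1 (cong (λ r → - (r * (κ * κ))) ρ≡-κ)) (trans τƛ (cong (λ r → 1# - τ - r * r * κ) ρ≡-κ))
          (solve 3 (λ κ τ l → l :* (l :- con p) :- con o
            := (l :- con p) :* (τ :- (:- l)) :+ con n :* (τ :+ con p :- (:- ((:- κ) :* (κ :* κ))))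
               :+ con n :* (τ :* l :- (con p :- τ :- (:- κ) :* (:- κ) :* κ))) refl κ τ ƛ)))

      absurd : ⊥
      absurd =
        [ (λ ρρ≡0 → ρ≢0 (x*x≡0⇒x≡0 ρρ≡0))
        , (λ eq → [ (λ cube≡0 → κ≢1 (x-y≡0⇒x≡y κ 1# (cube≡0⇒x≡0 cube≡0)))
                  , (λ κ+ρ≡0 → ρ≢-κ (linear₁ 1# κ+ρ≡0
                      (solve 2 (λ κ ρ → ρ :- (:- κ) := con p :* (κ :+ ρ :- con o)) refl κ ρ))) ]′
                  (x*y≡0⇒x≡0∨y≡0 eq)) ]′
        (x*y≡0⇒x≡0∨y≡0 product≡0)

  no-solution : ∀ g R → g * g - σ g ≢ R * R - R * σ R + 1#
  no-solution g R eq =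
    [ Elimination.absurd g R eq
    , (λ factor≡0 → Elimination.absurd g (- R)
        (trans eq (trans (solve 2 (λ R T → R :* R :- R :* T :+ con p := (:- R) :* (:- R) :- (:- R) :* (:- T) :+ con p)
            refl R (σ R))
          (cong (λ t → - R * - R - - R * t + 1#) (sym (σ-neg R)))))
        (trans (cong (λ t → (- R + t + g) * - R + g * g + g + (- R + t)) (σ-neg R)) factor≡0)) ]′
    (x*y≡0⇒x≡0∨y≡0 factors≡0)
    where
    σeq : σ g * σ g - g * g * g ≡ σ R * σ R - σ R * (R * R * R) + 1#
    σeq = trans (cong₂ _-_ (sym (σ-* g g)) (sym (σσ g))) (trans (sym (σ-sub (g * g) (σ g))) (trans (cong σ eq)
      (trans (σ-+ (R * R - R * σ R) 1#) (cong₂ _+_ (trans (σ-sub (R * R) (R * σ R))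
        (cong₂ _-_ (σ-* R R) (trans (σ-* R (σ R)) (cong (σ R *_) (σσ R))))) σ-1))))
    factors≡0 : ((R + σ R + g) * R + g * g + g + (R + σ R)) * ((- R + - σ R + g) * - R + g * g + g + (- R + - σ R)) ≡ 0#
    factors≡0 = linear₂ (σ g + (g * g - R * R + R * σ R - 1#)) 1# eq σeq
      (solve 4 (λ g R T γ → ((R :+ T :+ g) :* R :+ g :* g :+ g :+ (R :+ T)) :*
          (((:- R) :+ (:- T) :+ g) :* (:- R) :+ g :* g :+ g :+ ((:- R) :+ (:- T))) :- con o
        := (γ :+ (g :* g :- R :* R :+ R :* T :- con p)) :* (g :* g :- γ :- (R :* R :- R :* T :+ con p))
           :+ con p :* (γ :* γ :- g :* g :* g :- (T :* T :- T :* (R :* R :* R) :+ con p))) refl g R (σ R) (σ g))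

  -- f a x = x^(2α+3) + (a x)^α - a² x
  f : Fin q → Fin q → Fin q
  f a x = σ x * σ x * (x * x * x) + σ a * σ x - a * a * x

  f-neg : ∀ a x → f a (- x) ≡ - f a x
  f-neg a x = trans (cong (λ X → X * X * (- x * - x * - x) + σ a * X - a * a * - x) (σ-neg x))
    (solve 4 (λ x X a A → (:- X) :* (:- X) :* ((:- x) :* (:- x) :* (:- x)) :+ A :* (:- X) :- a :* a :* (:- x)
      := :- (X :* X :* (x :* x :* x) :+ A :* X :- a :* a :* x)) refl x (σ x) a (σ a))

  f-0 : ∀ a → f a 0# ≡ 0#
  f-0 a = trans (cong (λ X → X * X * (0# * 0# * 0#) + σ a * X - a * a * 0#) σ-0)
    (solve 2 (λ a A → con o :* con o :* (con o :* con o :* con o) :+ A :* con o :- a :* a :* con o := con o) refl a (σ a))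

  -- Write x, y = c ± z; then R = σ (c / z) and g = a / (z σ z) solve the excluded equation.
  f-injective : ∀ a {x y} → f a x ≡ f a y → x ≡ y
  f-injective a {x} {y} fx≡fy with x Fin.≟ y
  ... | yes x≡y = x≡y
  ... | no  x≢y = contradiction solution (no-solution g R)
    where
    -- One half is - 1 in characteristic 3, so c is the midpoint of x and y, and z is half of x - y.
    z = y - x
    c = - (x + y)
    Z = σ z
    z³ = z * z * z
    c³ = c * c * c
    z≢0 : z ≢ 0#
    z≢0 z≡0 = x≢y (sym (x-y≡0⇒x≡y y x z≡0))
    -- Giving c the weight z and a the weight z · σ z makes every term of the equation a multiple of
    -- (σ z)² z³. Only σ r and r³ = σ (σ r) occur, which is why R is σ r and not r.
    r = c * inv z
    R = σ r
    g = a * inv (z * Z)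
    c≡ : c ≡ r * z
    c≡ = quotient z≢0 refl
    a≡ : a ≡ g * (z * Z)
    a≡ = quotient (x*y≢0 z≢0 (σ≢0 z≢0)) refl
    σa≡ : σ a ≡ σ g * (Z * z³)
    σa≡ = trans (cong σ a≡) (trans (σ-* g (z * Z)) (cong (σ g *_) (trans (σ-* z Z) (cong (Z *_) (σσ z)))))
    C≡ : σ c ≡ R * Z
    C≡ = trans (cong σ c≡) (σ-* r z)
    c³≡ : c³ ≡ σ R * z³
    c³≡ = trans (cong (λ c → c * c * c) c≡) (trans (solve 2
        (λ r z → r :* z :* (r :* z) :* (r :* z) := r :* r :* r :* (z :* z :* z)) refl r z)
      (cong (_* z³) (sym (σσ r))))

    at-x : f a x ≡ (σ c + Z) * (σ c + Z) * (c³ + z³) + σ a * (σ c + Z) - a * a * (c + z)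
    at-x = trans (cong (f a) x≡) (cong₂ (λ X w → X * X * w + σ a * X - a * a * (c + z)) (σ-+ c z)
      (solve 2 (λ c z → (c :+ z) :* (c :+ z) :* (c :+ z) := c :* c :* c :+ z :* z :* z) refl c z))
      where
      x≡ : x ≡ c + z
      x≡ = solve 2 (λ x y → x := :- (x :+ y) :+ (y :- x)) refl x y

    at-y : f a y ≡ (σ c - Z) * (σ c - Z) * (c³ - z³) + σ a * (σ c - Z) - a * a * (c - z)
    at-y = trans (cong (f a) y≡) (cong₂ (λ X w → X * X * w + σ a * X - a * a * (c - z)) (σ-sub c z)
      (solve 2 (λ c z → (c :- z) :* (c :- z) :* (c :- z) := c :* c :* c :- z :* z :* z) refl c z))
      where
      y≡ : y ≡ c - z
      y≡ = solve 2 (λ x y → y := :- (x :+ y) :- (y :- x)) refl x y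

    -- In f (c + z) - f (c - z) only the terms odd in z survive.
    difference : σ c * Z * c³ + a * a * z ≡ σ c * σ c * z³ + Z * Z * z³ + σ a * Z
    difference = linear₁ 1# (trans (sym at-x) (trans fx≡fy at-y))
      (solve 8 (λ C Z c³ z³ A a c z → C :* Z :* c³ :+ a :* a :* z :- (C :* C :* z³ :+ Z :* Z :* z³ :+ A :* Z)
        := con p :* ((C :+ Z) :* (C :+ Z) :* (c³ :+ z³) :+ A :* (C :+ Z) :- a :* a :* (c :+ z)
          :- ((C :- Z) :* (C :- Z) :* (c³ :- z³) :+ A :* (C :- Z) :- a :* a :* (c :- z)))) refl (σ c) Z c³ z³ (σ a) a c z)

    substituted : R * Z * Z * (σ R * z³) + g * (z * Z) * (g * (z * Z)) * z
                ≡ R * Z * (R * Z) * z³ + Z * Z * z³ + σ g * (Z * z³) * Z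
    substituted = trans (sym (cong₂ _+_ (cong₂ (λ C c³ → C * Z * c³) C≡ c³≡) (cong (λ a → a * a * z) a≡)))
      (trans difference (cong₂ (λ C A → C * C * z³ + Z * Z * z³ + A * Z) C≡ σa≡))

    solution : g * g - σ g ≡ R * R - R * σ R + 1#
    solution = *-cancelˡ (x*y≢0 (x*y≢0 (σ≢0 z≢0) (σ≢0 z≢0)) (x*y≢0 (x*y≢0 z≢0 z≢0) z≢0))
      (linear₁ 1# substituted (solve 6 (λ g γ R T z Z →
        Z :* Z :* (z :* z :* z) :* (g :* g :- γ) :- Z :* Z :* (z :* z :* z) :* (R :* R :- R :* T :+ con p)
        := con p :* (R :* Z :* Z :* (T :* (z :* z :* z)) :+ g :* (z :* Z) :* (g :* (z :* Z)) :* z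
          :- (R :* Z :* (R :* Z) :* (z :* z :* z) :+ Z :* Z :* (z :* z :* z) :+ γ :* (Z :* (z :* z :* z)) :* Z))) refl g
              (σ g) R (σ R) z Z))

-- A σ-invariant additive character.

ω^_ : 𝔽₃ → 𝔼
ω^ o = 𝟙
ω^ p = ω
ω^ n = conj ω

ω^-+ : ∀ i j → ω^ (i +₃ j) ≡ ω^ i ⊠ ω^ j
ω^-+ o o = refl
ω^-+ o p = refl
ω^-+ o n = refl
ω^-+ p o = refl
ω^-+ p p = refl
ω^-+ p n = refl
ω^-+ n o = refl
ω^-+ n p = refl
ω^-+ n n = refl

ω^-neg : ∀ i → ω^ (-₃ i) ≡ conj (ω^ i)
ω^-neg o = refl
ω^-neg p = refl
ω^-neg n = refl

-- An additive character trivial on the subgroup {σ n - n}, which has index 3.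

module Character {q : ℕ} {K : Field q} (twist : Twist K) where
  open Field K
  open Twist twist
  open Characteristic3 K 1+1+1≡0
  open TwistProperties twist
  open Solver₃
  private module S = 𝔼-Solver

  ℘ : Fin q → Fin q
  ℘ x = σ x - x

  private
    V : Fin q → Set
    V w = ∃ λ x → ℘ x ≡ w

    V? : ∀ w → Dec (V w)
    V? w = Finₚ.any? (λ x → ℘ x Fin.≟ w)

    ℘-+ : ∀ x y → ℘ (x + y) ≡ ℘ x + ℘ y
    ℘-+ x y = trans (cong (_- (x + y)) (σ-+ x y))
      (solve 4 (λ x y X Y → X :+ Y :- (x :+ y) := (X :- x) :+ (Y :- y)) refl x y (σ x) (σ y))

    ℘-neg : ∀ x → ℘ (- x) ≡ - ℘ x
    ℘-neg x = trans (cong (_- (- x)) (σ-neg x)) (solve 2 (λ x X → (:- X) :- (:- x) := :- (X :- x)) refl x (σ x))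

    ℘-sub : ∀ x y → ℘ (x - y) ≡ ℘ x - ℘ y
    ℘-sub x y = trans (℘-+ x (- y)) (cong (℘ x +_) (℘-neg y))

    V-+ : ∀ {x y} → V x → V y → V (x + y)
    V-+ (x , refl) (y , refl) = x + y , ℘-+ x y

    V-neg : ∀ {x} → V x → V (- x)
    V-neg (x , refl) = - x , ℘-neg x

    σx≡x⇒℘x≡0 : ∀ {x} → σ x ≡ x → ℘ x ≡ 0#
    σx≡x⇒℘x≡0 {x} eq = trans (cong (_- x) eq) (-‿inverseʳ x)

    V-0 : V 0#
    V-0 = 0# , σx≡x⇒℘x≡0 σ-0

    -- A section of ℘ would be injective, hence bijective, with ℘ as its inverse; but ℘ takes the
    -- value 0 at both 0 and 1.
    ¬∀V : ¬ (∀ w → V w)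
    ¬∀V section = 1≢0 (begin
      1#                  ≡⟨ sym (proj₂ (s-surjective 1#)) ⟩
      s (s⁻¹ 1#)          ≡⟨ cong s s⁻¹1≡s⁻¹0 ⟩
      s (s⁻¹ 0#)          ≡⟨ proj₂ (s-surjective 0#) ⟩
      0#                  ∎)
      where
      open ≡-Reasoning
      s : Fin q → Fin q
      s w = proj₁ (section w)
      ℘s : ∀ w → ℘ (s w) ≡ w
      ℘s w = proj₂ (section w)
      s-surjective : ∀ y → ∃ λ w → s w ≡ y
      s-surjective = injective⇒surjective s (λ {i} {j} eq → trans (sym (℘s i)) (trans (cong ℘ eq) (℘s j)))
      s⁻¹ : Fin q → Fin q
      s⁻¹ y = proj₁ (s-surjective y)
      s⁻¹≡℘ : ∀ y → s⁻¹ y ≡ ℘ y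
      s⁻¹≡℘ y = trans (sym (℘s (s⁻¹ y))) (cong ℘ (proj₂ (s-surjective y)))
      s⁻¹1≡s⁻¹0 : s⁻¹ 1# ≡ s⁻¹ 0#
      s⁻¹1≡s⁻¹0 = trans (s⁻¹≡℘ 1#) (trans (σx≡x⇒℘x≡0 σ-1) (sym (trans (s⁻¹≡℘ 0#) (σx≡x⇒℘x≡0 σ-0))))

    opaque
      c : Fin q
      c = proj₁ (Finₚ.¬∀⟶∃¬ q V V? ¬∀V)

      c∉V : ¬ V c
      c∉V = proj₂ (Finₚ.¬∀⟶∃¬ q V V? ¬∀V)

    Coset : 𝔽₃ → Fin q → Set
    Coset j w = V (w - embed j * c)

    coset-+ : ∀ i j {x y} → Coset i x → Coset j y → Coset (i +₃ j) (x + y)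
    coset-+ i j {x} {y} x∈ y∈ = subst V (trans (solve 5
        (λ x y i j c → x :- i :* c :+ (y :- j :* c) := x :+ y :- (i :+ j) :* c) refl x y (embed i) (embed j) c)
      (cong (λ e → x + y - e * c) (sym (embed-+ i j)))) (V-+ x∈ y∈)

    coset-neg : ∀ i {x} → Coset i x → Coset (-₃ i) (- x)
    coset-neg i {x} x∈ = subst V (trans (solve 3 (λ x i c → :- (x :- i :* c) := (:- x) :- (:- i) :* c) refl x (embed i) c)
      (cong (λ e → - x - e * c) (sym (embed-neg i)))) (V-neg x∈)

    coset-0 : ∀ {j} → Coset j 0# → j ≡ o
    coset-0 {o} _ = refl
    coset-0 {p} v = ⊥-elim (c∉V (subst V (solve 1 (λ c → :- (con o :- con p :* c) := c) refl c) (V-neg v)))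
    coset-0 {n} v = ⊥-elim (c∉V (subst V (solve 1 (λ c → con o :- con n :* c := c) refl c) v))

    coset-unique : ∀ {i j w} → Coset i w → Coset j w → i ≡ j
    coset-unique {i} {j} {w} w∈i w∈j = difference i j
        (coset-0 (subst (Coset (i +₃ (-₃ j))) (-‿inverseʳ w) (coset-+ i (-₃ j) w∈i (coset-neg j w∈j))))
      where
      difference : ∀ i j → i +₃ (-₃ j) ≡ o → i ≡ j
      difference o o _ = refl
      difference p p _ = refl
      difference n n _ = refl

    coset? : ∀ j w → Dec (Coset j w)
    coset? j w = V? (w - embed j * c)

    -- A nonempty fibre of ℘ is a coset of 𝔽₃.
    fibre : ∀ w → sum (λ x → [ ℘ x Fin.≟ w ]) ≡ ι 3 ⊠ [ V? w ]
    fibre w with V? w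
    ... | no w∉V = sum-𝟘 _ (λ x → []-no (℘ x Fin.≟ w) (λ eq → w∉V (x , eq)))
    ... | yes (y , refl) = begin
      sum (λ x → [ ℘ x Fin.≟ ℘ y ])                                ≡⟨ sum-cong split ⟩
      sum (λ x → [ x Fin.≟ y ] ⊠ 𝟙 ⊞ ([ x Fin.≟ y + 1# ] ⊠ 𝟙 ⊞ [ x Fin.≟ y - 1# ] ⊠ 𝟙)) ≡⟨ sum-⊞ _ _ ⟩
      sum (λ x → [ x Fin.≟ y ] ⊠ 𝟙) ⊞ sum (λ x → [ x Fin.≟ y + 1# ] ⊠ 𝟙 ⊞ [ x Fin.≟ y - 1# ] ⊠ 𝟙)
                                                                   ≡⟨ cong₂ _⊞_ (sum-select y _) (trans (sum-⊞ _ _)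
                                                                       (cong₂ _⊞_ (sum-select (y + 1#) _)
                                                                       (sum-select (y - 1#) _))) ⟩
      ι 3                                                          ∎
      where
      open ≡-Reasoning
      moved : ∀ {x z} → x - y ≡ z → x ≡ y + z
      moved {x} {z} eq = linear₁ 1# eq (solve 3 (λ x y z → x :- (y :+ z) := con p :* (x :- y :- z)) refl x y z)
      to : ∀ {x} → ℘ x ≡ ℘ y → x ≡ y ⊎ x ≡ y + 1# ⊎ x ≡ y - 1#
      to {x} eq = [ (λ eq₀ → inj₁ (x-y≡0⇒x≡y x y eq₀)) ,
          [ (λ eq₁ → inj₂ (inj₁ (moved eq₁))) , (λ eq₂ → inj₂ (inj₂ (moved eq₂))) ]′ ]′
        (σ-fixed (x-y≡0⇒x≡y _ _ (trans (℘-sub x y) (trans (cong (_- ℘ y) eq) (-‿inverseʳ (℘ y))))))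
      shift : ∀ {e} → σ e ≡ e → ℘ (y + e) ≡ ℘ y
      shift {e} eq = trans (℘-+ y e) (trans (cong (℘ y +_) (σx≡x⇒℘x≡0 eq)) (+-identityʳ (℘ y)))
      up : ∀ {x} → x ≡ y + 1# → ℘ x ≡ ℘ y
      up refl = shift σ-1
      down : ∀ {x} → x ≡ y - 1# → ℘ x ≡ ℘ y
      down refl = shift (trans (σ-neg 1#) (cong -_ σ-1))
      -1≢1 : 1# ≢ - 1#
      -1≢1 eq = 1≢0 (x≡-x⇒x≡0 eq)
      split : ∀ x → [ ℘ x Fin.≟ ℘ y ] ≡ [ x Fin.≟ y ] ⊠ 𝟙 ⊞ ([ x Fin.≟ y + 1# ] ⊠ 𝟙 ⊞ [ x Fin.≟ y - 1# ] ⊠ 𝟙)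
      split x = trans ([]-⊎ (℘ x Fin.≟ ℘ y) (x Fin.≟ y) ((x Fin.≟ y + 1#) ⊎-dec (x Fin.≟ y - 1#)) to (cong ℘)
          (λ { (inj₁ eq) → up eq ; (inj₂ eq) → down eq })
          λ { refl (inj₁ eq) → 1≢0 (+-identityʳ-unique x 1# (sym eq)) ; refl (inj₂ eq) → neg≢0 1≢0
              (+-identityʳ-unique x (- 1#) (sym eq)) })
        (cong₂ _⊞_ (sym (⊠-identityʳ _)) (trans ([]-⊎ ((x Fin.≟ y + 1#) ⊎-dec (x Fin.≟ y - 1#)) (x Fin.≟ y + 1#)
            (x Fin.≟ y - 1#) (λ s → s) inj₁ inj₂
           (λ eq₁ eq₂ → -1≢1 (+-cancelˡ y _ _ (trans (sym eq₁) eq₂))))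
          (cong₂ _⊞_ (sym (⊠-identityʳ _)) (sym (⊠-identityʳ _)))))

    cosets : Fin q → 𝔼
    cosets w = [ coset? o w ] ⊞ ([ coset? p w ] ⊞ [ coset? n w ])

    -- Every nonempty fibre of ℘ has three elements, so V has a third of the size of the field, and
    -- three translates of V have its full size. Being disjoint, they must then cover it.
    sum-cosets : sum cosets ≡ ι q
    sum-cosets = begin
      sum cosets
          ≡⟨ trans (sum-⊞ _ _) (cong (sum (λ w → [ coset? o w ]) ⊞_) (sum-⊞ _ _)) ⟩
      sum (λ w → [ coset? o w ]) ⊞ (sum (λ w → [ coset? p w ]) ⊞ sum (λ w → [ coset? n w ]))
          ≡⟨ cong₂ _⊞_ (translate o) (cong₂ _⊞_ (translate p) (translate n)) ⟩
      sum v ⊞ (sum v ⊞ sum v)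
          ≡⟨ S.solve 1 (λ s → s S.:+ (s S.:+ s) S.:= S.con (ι 3) S.:* s) refl (sum v) ⟩
      ι 3 ⊠ sum v                                              ≡⟨ trans (⊠-sum (ι 3) v) (sum-cong (λ w → sym (fibre w))) ⟩
      sum (λ w → sum (λ x → [ ℘ x Fin.≟ w ]))                  ≡⟨ sum-swap _ ⟩
      sum (λ x → sum (λ w → [ ℘ x Fin.≟ w ]))
          ≡⟨ sum-cong (λ x → trans (sum-cong (λ w → trans ([]-cong (℘ x Fin.≟ w) (w Fin.≟ ℘ x) sym sym)
          (sym (⊠-identityʳ _)))) (sum-select (℘ x) (λ _ → 𝟙))) ⟩
      sum {q} (λ x → 𝟙)                                        ≡⟨ sum-𝟙 q ⟩
      ι q                                                      ∎
      where
      open ≡-Reasoning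
      v : Fin q → 𝔼
      v w = [ V? w ]
      translate : ∀ j → sum (λ w → v (w - embed j * c)) ≡ sum v
      translate j = sum-reindex v (λ w → w - embed j * c) (+-cancelʳ _ _ _)

    cosets≤1 : ∀ w → re (cosets w) ℤ.≤ 1ℤ
    cosets≤1 w with coset? o w | coset? p w | coset? n w
    ... | yes w∈o | yes w∈p | _       = contradiction (coset-unique {o} {p} {w} w∈o w∈p) λ ()
    ... | yes w∈o | no _    | yes w∈n = contradiction (coset-unique {o} {n} {w} w∈o w∈n) λ ()
    ... | yes _   | no _    | no _    = ℤₚ.≤-refl
    ... | no _    | yes w∈p | yes w∈n = contradiction (coset-unique {p} {n} {w} w∈p w∈n) λ ()
    ... | no _    | yes _   | no _    = ℤₚ.≤-refl
    ... | no _    | no _    | yes _   = ℤₚ.≤-refl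
    ... | no _    | no _    | no _    = ℤ.+≤+ ℕ.z≤n

    find-coset : ∀ w → re (cosets w) ≡ 1ℤ → ∃ λ j → Coset j w
    find-coset w eq with coset? o w | coset? p w | coset? n w
    ... | yes w∈o | _       | _       = o , w∈o
    ... | no _    | yes w∈p | _       = p , w∈p
    ... | no _    | no _    | yes w∈n = n , w∈n
    find-coset w () | no _ | no _ | no _

    opaque
      coset : ∀ w → ∃ λ j → Coset j w
      coset w = find-coset w (sum-tight cosets (λ _ → 𝟙) cosets≤1
        (ℤₚ.≤-reflexive (cong re (trans (sum-𝟙 q) (sym sum-cosets)))) w)

  χ : Fin q → 𝔼
  χ w = ω^ (proj₁ (coset w))

  private
    χ≡ : ∀ {j w} → Coset j w → χ w ≡ ω^ j
    χ≡ {j} {w} w∈j = cong ω^_ (coset-unique {w = w} (proj₂ (coset w)) w∈j)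

  χ-+ : ∀ x y → χ (x + y) ≡ χ x ⊠ χ y
  χ-+ x y = trans (χ≡ {i +₃ j} (coset-+ i j (proj₂ (coset x)) (proj₂ (coset y)))) (ω^-+ i j)
    where
    i = proj₁ (coset x)
    j = proj₁ (coset y)

  χ-neg : ∀ x → χ (- x) ≡ conj (χ x)
  χ-neg x = trans (χ≡ { -₃ i} (coset-neg i (proj₂ (coset x)))) (ω^-neg i)
    where i = proj₁ (coset x)

  χ-℘ : ∀ x → χ (℘ x) ≡ 𝟙
  χ-℘ x = χ≡ {o} (x , solve 2 (λ y c → y := y :- con o :* c) refl (℘ x) c)

  χ-σ : ∀ x → χ (σ x) ≡ χ x
  χ-σ x = trans (cong χ (solve 2 (λ x X → X := x :+ (X :- x)) refl x (σ x)))
    (trans (χ-+ x (℘ x)) (trans (cong (χ x ⊠_) (χ-℘ x)) (⊠-identityʳ (χ x))))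

  χ-0 : χ 0# ≡ 𝟙
  χ-0 = trans (cong χ (sym (σx≡x⇒℘x≡0 σ-0))) (χ-℘ 0#)

  χ-norm : ∀ x → χ x ⊠ conj (χ x) ≡ 𝟙
  χ-norm x = trans (cong (χ x ⊠_) (sym (χ-neg x))) (trans (sym (χ-+ x (- x))) (trans (cong χ (-‿inverseʳ x)) χ-0))

  χ-value : ∀ x → ∃ λ j → χ x ≡ ω^ j
  χ-value x = proj₁ (coset x) , refl

  χ-sub : ∀ x y → χ (x - y) ≡ χ x ⊠ conj (χ y)
  χ-sub x y = trans (χ-+ x (- y)) (cong (χ x ⊠_) (χ-neg y))

  conj-χ-neg : ∀ x → conj (χ (- x)) ≡ χ x
  conj-χ-neg x = trans (cong conj (χ-neg x)) (conj-involutive (χ x))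

  -- The tool for rewriting phases: an exponent may be changed by any σ z - z. The chosen z collects
  -- the terms that are traded for their images under σ; z′ holds σ z in expanded form, ready for
  -- the solver.
  χ-mod-℘ : ∀ {x y z z′} → σ z ≡ z′ → x ≡ y + (z′ - z) → χ x ≡ χ y
  χ-mod-℘ {y = y} {z} refl refl = trans (χ-+ y (℘ z)) (trans (cong (χ y ⊠_) (χ-℘ z)) (⊠-identityʳ (χ y)))

  χ-orthogonality : ∀ b → sum (λ x → χ (b * x)) ≡ ι q ⊠ [ b Fin.≟ 0# ]
  χ-orthogonality b with b Fin.≟ 0#
  ... | yes refl = trans (sum-cong (λ x → trans (cong χ (*-zeroˡ x)) χ-0)) (sum-const q 𝟙)
  -- Shifting x by c / b multiplies the sum by ω, so 1 - ω annihilates it; multiplying by 1 - ω²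
  -- turns this factor into the integer 3, which can be cancelled.
  ... | no b≢0 = trans (ι-cancelˡ 3 (trans (S.solve 1
      (λ s → S.con (ι 3) S.:* s S.:= S.con (𝟙 ⊟ conj ω) S.:* (s S.:- S.con ω S.:* s)) refl total)
      (trans (cong (λ s → (𝟙 ⊟ conj ω) ⊠ (total ⊟ s)) (sym shifted))
          (S.solve 1 (λ s → S.con (𝟙 ⊟ conj ω) S.:* (s S.:- s) S.:= S.con (ι 3) S.:* S.con 𝟘) refl total))))
      (sym (zeroʳ (ι q)))
    where
    total = sum (λ x → χ (b * x))
    y = inv b * c
    by≡c : ∀ x → b * (x + y) ≡ c + b * x
    by≡c x = linear₁ c (x*inv b≢0) (solve 4 (λ b i c x → b :* (x :+ i :* c) :- (c :+ b :* x) := c :* (b :* i :- con p))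
        refl b (inv b) c x)
    χc≡ω : χ c ≡ ω
    χc≡ω = χ≡ {p} (subst V (solve 1 (λ c → con o := c :- con p :* c) refl c) V-0)
    shifted : total ≡ ω ⊠ total
    shifted = trans (sym (sum-reindex (λ x → χ (b * x)) (_+ y) (+-cancelʳ y _ _)))
      (trans (sum-cong (λ x → trans (cong χ (by≡c x)) (trans (χ-+ c (b * x)) (cong (_⊠ χ (b * x)) χc≡ω)))) (sym (⊠-sum ω _)))

  -- The additive form of Hilbert's Theorem 90, stated as a count of preimages.
  sum-℘ : ∀ (f : Fin q → 𝔼) → sum (λ x → f (℘ x)) ≡ sum (λ w → f w ⊠ (𝟙 ⊞ χ w ⊞ χ (- w)))
  sum-℘ f = begin
    sum (λ x → f (℘ x))                                       ≡⟨ sum-cong (λ x → sym (sum-select (℘ x) f)) ⟩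
    sum (λ x → sum (λ w → [ w Fin.≟ ℘ x ] ⊠ f w))             ≡⟨ sum-swap _ ⟩
    sum (λ w → sum (λ x → [ w Fin.≟ ℘ x ] ⊠ f w))
        ≡⟨ sum-cong (λ w → trans (sum-cong (λ x → trans (cong (_⊠ f w) ([]-cong (w Fin.≟ ℘ x) (℘ x Fin.≟ w) sym sym))
        (⊠-comm _ (f w)))) (trans (sym (⊠-sum (f w) _)) (cong (f w ⊠_) (trans (fibre w) (count w))))) ⟩
    sum (λ w → f w ⊠ (𝟙 ⊞ χ w ⊞ χ (- w)))                     ∎
    where
    open ≡-Reasoning
    count : ∀ w → ι 3 ⊠ [ V? w ] ≡ 𝟙 ⊞ χ w ⊞ χ (- w)
    count w = trans (by-coset (proj₁ (coset w)) (proj₂ (coset w))) (cong (𝟙 ⊞ χ w ⊞_) (sym (χ-neg w)))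
      where
      0-coset : ∀ {w} → V w → Coset o w
      0-coset {w} = subst V (solve 2 (λ w c → w := w :- con o :* c) refl w c)
      by-coset : ∀ j → Coset j w → ι 3 ⊠ [ V? w ] ≡ 𝟙 ⊞ ω^ j ⊞ conj (ω^ j)
      by-coset o w∈ = cong (ι 3 ⊠_) ([]-yes (V? w) (subst V (solve 2 (λ w c → w :- con o :* c := w) refl w c) w∈))
      by-coset p w∈ = cong (ι 3 ⊠_) ([]-no (V? w) (λ w∈V → contradiction (coset-unique {o} {p} {w} (0-coset w∈V) w∈) λ ()))
      by-coset n w∈ = cong (ι 3 ⊠_) ([]-no (V? w) (λ w∈V → contradiction (coset-unique {o} {n} {w} (0-coset w∈V) w∈) λ ()))

module CubicPhase {q : ℕ} {K : Field q} (twist : Twist K) where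
  open Field K
  open Twist twist
  open Characteristic3 K 1+1+1≡0
  open TwistProperties twist
  open Character twist
  open Solver₃
  open ≡-Reasoning
  private module S = 𝔼-Solver

  open Folding square-folding using () renaming (surjective to ±square; sum-fold to sum-squares)
  open Folding twisted-square-folding using () renaming (sum-fold to sum-twisted-squares)

  -- Quadratic Gauss sums

  χ-sum≡𝟘 : ∀ {b} → b ≢ 0# → sum (λ x → χ (b * x)) ≡ 𝟘
  χ-sum≡𝟘 {b} b≢0 = trans (χ-orthogonality b) (trans (cong (ι q ⊠_) ([]-no (b Fin.≟ 0#) b≢0)) (zeroʳ (ι q)))

  sum-χ≡𝟘 : sum χ ≡ 𝟘
  sum-χ≡𝟘 = trans (sum-cong (λ x → cong χ (sym (*-identityˡ x)))) (χ-sum≡𝟘 1≢0)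

  gauss : Fin q → 𝔼
  gauss b = sum (λ v → χ (b * (v * v)))

  gauss-0 : gauss 0# ≡ ι q
  gauss-0 = trans (sum-cong (λ v → trans (cong χ (*-zeroˡ (v * v))) χ-0)) (sum-𝟙 q)

  gauss-square : ∀ b {w} → w ≢ 0# → gauss (b * (w * w)) ≡ gauss b
  gauss-square b {w} w≢0 = trans
    (sum-cong (λ v → cong χ (solve 3 (λ b w v → b :* (w :* w) :* (v :* v) := b :* (w :* v :* (w :* v))) refl b w v)))
    (sum-reindex (λ v → χ (b * (v * v))) (w *_) (*-cancelˡ w≢0))

  -- The values v² and - v² together run twice through the field, so the two Gauss sums add up to
  -- twice a full character sum, which is 0.
  gauss-neg : ∀ {b} → b ≢ 0# → gauss (- b) ≡ ⊝ gauss b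
  gauss-neg {b} b≢0 = begin
    gauss (- b)                              ≡⟨ S.solve 2 (λ s t → t S.:= s S.:+ t S.:- s) refl (gauss b) (gauss (- b)) ⟩
    gauss b ⊞ gauss (- b) ⊟ gauss b          ≡⟨ cong (_⊟ gauss b) opposite ⟩
    𝟘 ⊟ gauss b                              ≡⟨ ⊞-identityˡ _ ⟩
    ⊝ gauss b                                ∎
    where
    opposite : gauss b ⊞ gauss (- b) ≡ 𝟘
    opposite = begin
      gauss b ⊞ gauss (- b)                                  ≡⟨ sym (sum-⊞ _ _) ⟩
      sum (λ v → χ (b * (v * v)) ⊞ χ (- b * (v * v)))
          ≡⟨ sum-cong (λ v → cong (χ (b * (v * v)) ⊞_)
          (cong χ (solve 2 (λ b u → (:- b) :* u := b :* (:- u)) refl b (v * v)))) ⟩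
      sum (λ v → χ (b * (v * v)) ⊞ χ (b * - (v * v)))         ≡⟨ sum-squares (λ u → χ (b * u)) ⟩
      ι 2 ⊠ sum (λ u → χ (b * u))                             ≡⟨ cong (ι 2 ⊠_) (χ-sum≡𝟘 b≢0) ⟩
      𝟘                                                       ∎

  conj-gauss : ∀ b → conj (gauss b) ≡ gauss (- b)
  conj-gauss b = trans (sum-conj _) (sum-cong (λ v → trans (sym (χ-neg _))
      (cong χ (solve 2 (λ b u → :- (b :* u) := (:- b) :* u) refl b (v * v)))))

  G : 𝔼
  G = gauss 1#

  conj-G : conj G ≡ ⊝ G
  conj-G = trans (conj-gauss 1#) (gauss-neg 1≢0)

  G-norm : G ⊠ conj G ≡ ι q
  G-norm = begin
    G ⊠ conj G                                          ≡⟨ trans (cong (G ⊠_) (conj-gauss 1#)) (sum-⊠-sum _ _) ⟩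
    sum (λ v → sum (λ w → χ (1# * (v * v)) ⊠ χ (- 1# * (w * w)))) ≡⟨ sum-swap _ ⟩
    sum (λ w → sum (λ v → χ (1# * (v * v)) ⊠ χ (- 1# * (w * w))))
        ≡⟨ sum-cong (λ w → sym (sum-reindex (λ v → χ (1# * (v * v)) ⊠ χ (- 1# * (w * w))) (_+ w) (+-cancelʳ w _ _))) ⟩
    sum (λ w → sum (λ v → χ (1# * ((v + w) * (v + w))) ⊠ χ (- 1# * (w * w))))
        ≡⟨ sum-cong (λ w → sum-cong (λ v → trans (sym (χ-+ _ _))
        (trans (cong χ (solve 2 (λ v w → con p :* ((v :+ w) :* (v :+ w)) :+ con n :* (w :* w) := v :* v :+ (:- v) :* w)
            refl v w)) (χ-+ _ _)))) ⟩
    sum (λ w → sum (λ v → χ (v * v) ⊠ χ (- v * w)))     ≡⟨ sum-swap _ ⟩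
    sum (λ v → sum (λ w → χ (v * v) ⊠ χ (- v * w)))
        ≡⟨ sum-cong (λ v → trans (sym (⊠-sum (χ (v * v)) _))
        (trans (cong (χ (v * v) ⊠_) (χ-orthogonality (- v))) (rearrange v))) ⟩
    sum (λ v → [ v Fin.≟ 0# ] ⊠ (ι q ⊠ χ (v * v)))      ≡⟨ sum-select 0# _ ⟩
    ι q ⊠ χ (0# * 0#)                                   ≡⟨ cong (ι q ⊠_) (trans (cong χ (*-zeroˡ 0#)) χ-0) ⟩
    ι q ⊠ 𝟙                                             ≡⟨ ⊠-identityʳ (ι q) ⟩
    ι q                                                 ∎
    where
    rearrange : ∀ v → χ (v * v) ⊠ (ι q ⊠ [ - v Fin.≟ 0# ]) ≡ [ v Fin.≟ 0# ] ⊠ (ι q ⊠ χ (v * v))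
    rearrange v = trans (cong (λ d → χ (v * v) ⊠ (ι q ⊠ d)) ([]-cong (- v Fin.≟ 0#) (v Fin.≟ 0#)
        (λ eq → trans (sym (neg-involutive v)) (trans (cong -_ eq) neg-0)) (λ eq → trans (cong -_ eq) neg-0)))
      (S.solve 3 (λ x q d → x S.:* (q S.:* d) S.:= d S.:* (q S.:* x)) refl (χ (v * v)) (ι q) [ v Fin.≟ 0# ])

  -- Either y or - y is a square, and the sign cancels between y and σ y.
  yσy-square : ∀ y → ∃ λ s → y * σ y ≡ s * s
  yσy-square y with ±square y
  ... | v , inj₁ refl = v * σ v , trans (cong (v * v *_) (σ-* v v))
      (solve 2 (λ v V → v :* v :* (V :* V) := v :* V :* (v :* V)) refl v (σ v))
  ... | v , inj₂ refl = v * σ v , trans (cong (- (v * v) *_) (trans (σ-neg (v * v)) (cong -_ (σ-* v v))))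
                          (solve 2 (λ v V → (:- (v :* v)) :* (:- (V :* V)) := v :* V :* (v :* V)) refl v (σ v))

  yσy≢0 : ∀ {y} → y ≢ 0# → y * σ y ≢ 0#
  yσy≢0 y≢0 = x*y≢0 y≢0 (σ≢0 y≢0)

  gauss-twisted-square : ∀ b {y} → y ≢ 0# → gauss (b * (y * σ y)) ≡ gauss b
  gauss-twisted-square b {y} y≢0 with yσy-square y
  ... | s , eq = trans (cong (λ u → gauss (b * u)) eq) (gauss-square b s≢0)
    where
    s≢0 : s ≢ 0#
    s≢0 s≡0 = yσy≢0 y≢0 (trans eq (trans (cong (_* s) s≡0) (*-zeroˡ s)))

  -- The cubic phase and its quadratic companion

  cubic : Fin q → Fin q
  cubic x = x * x * σ x + x

  cubic-neg : ∀ x → cubic (- x) ≡ - cubic x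
  cubic-neg x = trans (cong (λ X → - x * - x * X + - x) (σ-neg x))
    (solve 2 (λ x X → (:- x) :* (:- x) :* (:- X) :+ (:- x) := :- (x :* x :* X :+ x)) refl x (σ x))

  -- Modulo values of ℘ the cubic phase is `f (- 1)`, a permutation by `f-injective`. This is the
  -- link from injectivity to the key identity.
  sum-χ-cubic : sum (λ x → χ (cubic x)) ≡ 𝟘
  sum-χ-cubic = trans (sum-cong χ-cubic) (trans (sum-reindex χ (f (- 1#)) (f-injective (- 1#))) sum-χ≡𝟘)
    where
    χ-cubic : ∀ x → χ (cubic x) ≡ χ (f (- 1#) x)
    χ-cubic x = sym (χ-mod-℘ {z = x * x * σ x - x} (trans (σ-sub (x * x * σ x) x)
        (cong (_- σ x) (trans (σ-* (x * x) (σ x)) (cong₂ _*_ (σ-* x x) (σσ x)))))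
      (trans (cong (λ a → σ x * σ x * (x * x * x) + a * σ x - - 1# * - 1# * x) (trans (σ-neg 1#) (cong -_ σ-1)))
        (solve 2 (λ x X → X :* X :* (x :* x :* x) :+ con n :* X :- con n :* con n :* x
          := x :* x :* X :+ x :+ (X :* X :* (x :* x :* x) :- X :- (x :* x :* X :- x))) refl x (σ x))))

  D : Fin q → 𝔼
  D y = χ (y * σ y) ⊟ χ (- (y * σ y))

  -- The right side of the key identity, with `H` as the left. It is the Fourier transform of the
  -- function that `D` induces on squares, which makes its moments computable by orthogonality.
  A : Fin q → 𝔼
  A x = sum (λ y → D y ⊠ χ (- (x * (y * y))))

  H : Fin q → 𝔼
  H x = ι 2 ⊠ G ⊠ χ (cubic x)

  D-0 : D 0# ≡ 𝟘
  D-0 = trans (cong₂ (λ a b → χ a ⊟ χ b) (*-zeroˡ _) (trans (cong -_ (*-zeroˡ _)) neg-0)) (⊞-inverseʳ (χ 0#))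

  D-neg : ∀ y → D (- y) ≡ D y
  D-neg y = cong (λ u → χ u ⊟ χ (- u)) (trans (cong (- y *_) (σ-neg y))
      (solve 2 (λ y Y → (:- y) :* (:- Y) := y :* Y) refl y (σ y)))

  conj-D : ∀ y → conj (D y) ≡ ⊝ D y
  conj-D y = trans (conj-⊞ _ _) (trans (cong₂ _⊞_ (sym (χ-neg u)) (trans (conj-⊝ _) (cong ⊝_ (conj-χ-neg u))))
    (S.solve 2 (λ a b → b S.:- a S.:= S.:- (a S.:- b)) refl (χ u) (χ (- u))))
    where u = y * σ y

  -- `H` has the same symmetry, so the key identity passes from - x to x. It is therefore enough to
  -- evaluate A when the form with sign minus degenerates.
  A-neg : ∀ x → A (- x) ≡ ⊝ conj (A x)
  A-neg x = begin
    A (- x)                                                    ≡⟨ sum-cong term ⟩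
    sum (λ y → ⊝ 𝟙 ⊠ conj (D y ⊠ χ (- (x * (y * y)))))         ≡⟨ sym (⊠-sum (⊝ 𝟙) _) ⟩
    ⊝ 𝟙 ⊠ sum (λ y → conj (D y ⊠ χ (- (x * (y * y)))))         ≡⟨ cong (⊝ 𝟙 ⊠_) (sym (sum-conj _)) ⟩
    ⊝ 𝟙 ⊠ conj (A x)
        ≡⟨ S.solve 1 (λ s → S.con (⊝ 𝟙) S.:* s S.:= S.:- s) refl (conj (A x)) ⟩
    ⊝ conj (A x)                                               ∎
    where
    term : ∀ y → D y ⊠ χ (- (- x * (y * y))) ≡ ⊝ 𝟙 ⊠ conj (D y ⊠ χ (- (x * (y * y))))
    term y = trans (S.solve 2 (λ d e → d S.:* e S.:= S.con (⊝ 𝟙) S.:* ((S.:- d) S.:* e)) refl (D y) _)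
      (cong (⊝ 𝟙 ⊠_) (trans (cong₂ _⊠_ (sym (conj-D y))
          (trans (cong χ (solve 2 (λ x u → :- ((:- x) :* u) := :- (:- (x :* u))) refl x (y * y))) (χ-neg _)))
          (sym (conj-⊠ _ _))))

  H-neg : ∀ x → H (- x) ≡ ⊝ conj (H x)
  H-neg x = begin
    ι 2 ⊠ G ⊠ χ (cubic (- x))                  ≡⟨ cong (ι 2 ⊠ G ⊠_) (trans (cong χ (cubic-neg x)) (χ-neg (cubic x))) ⟩
    ι 2 ⊠ G ⊠ conj (χ (cubic x))               ≡⟨ S.solve 2
        (λ g e → S.con (ι 2) S.:* g S.:* e S.:= S.:- (S.con (ι 2) S.:* (S.:- g) S.:* e)) refl G (conj (χ (cubic x))) ⟩
    ⊝ (ι 2 ⊠ ⊝ G ⊠ conj (χ (cubic x)))         ≡⟨ cong (λ g → ⊝ (ι 2 ⊠ g ⊠ conj (χ (cubic x)))) (sym conj-G) ⟩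
    ⊝ (ι 2 ⊠ conj G ⊠ conj (χ (cubic x)))      ≡⟨ cong ⊝_
        (sym (trans (conj-⊠ _ _) (cong (_⊠ conj (χ (cubic x))) (conj-⊠ (ι 2) G)))) ⟩
    ⊝ conj (H x)                               ∎

  H-norm : ∀ x → H x ⊠ conj (H x) ≡ ι 4 ⊠ ι q
  H-norm x = begin
    H x ⊠ conj (H x)                           ≡⟨ cong (H x ⊠_) (trans (conj-⊠ _ _) (cong (_⊠ conj e) (conj-⊠ (ι 2) G))) ⟩
    ι 2 ⊠ G ⊠ e ⊠ (ι 2 ⊠ conj G ⊠ conj e)      ≡⟨ S.solve 4
        (λ g h e f → S.con (ι 2) S.:* g S.:* e S.:* (S.con (ι 2) S.:* h S.:* f) S.:= S.con (ι 4) S.:* (g S.:* h) S.:*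
        (e S.:* f)) refl G (conj G) e (conj e) ⟩
    ι 4 ⊠ (G ⊠ conj G) ⊠ (e ⊠ conj e)          ≡⟨ cong₂ (λ s t → ι 4 ⊠ s ⊠ t) G-norm (χ-norm (cubic x)) ⟩
    ι 4 ⊠ ι q ⊠ 𝟙                              ≡⟨ ⊠-identityʳ _ ⟩
    ι 4 ⊠ ι q                                  ∎
    where e = χ (cubic x)

  -- Kernel x τ says that σ τ lies in the radical of the quadratic form - (y σ y) - x y².
  Kernel : Fin q → Fin q → Set
  Kernel x τ = τ ≢ 0# × x * σ τ ≡ τ * τ * τ + τ

  kernel? : ∀ x τ → Dec (Kernel x τ)
  kernel? x τ = ¬? (τ Fin.≟ 0#) ×-dec (x * σ τ Fin.≟ τ * τ * τ + τ)

  module AtKernel {x τ : Fin q} (τ≢0 : τ ≢ 0#) (kernel : x * σ τ ≡ τ * τ * τ + τ) where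
    ρ = inv τ
    P = σ ρ
    U = σ τ
    τρ≡1 : τ * ρ ≡ 1#
    τρ≡1 = x*inv τ≢0
    UP≡1 : U * P ≡ 1#
    UP≡1 = σ-inverse τρ≡1

    x≡ : x ≡ (τ * τ * τ + τ) * P
    x≡ = linear₂ P (- x) kernel UP≡1 (solve 4 (λ x τ P U → x :- (τ :* τ :* τ :+ τ) :* P
      := P :* (x :* U :- (τ :* τ :* τ :+ τ)) :+ (:- x) :* (U :* P :- con p)) refl x τ P U)

    -- Solving the kernel equation for x and expanding leaves ρ · σ ρ, apart from terms that pair up
    -- as σ z - z.
    χ-cubic : χ (cubic x) ≡ χ (ρ * P)
    χ-cubic = χ-mod-℘ {z = τ * U - U * ρ}
      (trans (σ-sub (τ * U) (U * ρ)) (cong₂ _-_ (trans (σ-* τ U) (cong (U *_) (σσ τ)))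
          (trans (σ-* U ρ) (cong (_* P) (σσ τ)))))
      (begin
        cubic x                                                ≡⟨ cong₂ (λ x X → x * x * X + x) x≡ σx≡ ⟩
        (τ * τ * τ + τ) * P * ((τ * τ * τ + τ) * P) * ((U * U * U + U) * (ρ * ρ * ρ)) + (τ * τ * τ + τ) * P
          ≡⟨ cong (_+ (τ * τ * τ + τ) * P) (trans (solve 4 (λ τ ρ U P →
               (τ :* τ :* τ :+ τ) :* P :* ((τ :* τ :* τ :+ τ) :* P) :* ((U :* U :* U :+ U) :* (ρ :* ρ :* ρ))
               := ((τ :* τ :* τ :- τ) :* (τ :* ρ :* (τ :* ρ) :* (τ :* ρ)) :+ ρ :* (τ :* ρ :* (τ :* ρ))) :*
                   (U :* (U :* P :* (U :* P)) :+ P :* (U :* P))) refl τ ρ U P)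
             (cong₂ (λ u v → ((τ * τ * τ - τ) * (u * u * u) + ρ * (u * u)) * (U * (v * v) + P * v)) τρ≡1 UP≡1)) ⟩
        ((τ * τ * τ - τ) * (1# * 1# * 1#) + ρ * (1# * 1#)) * (U * (1# * 1#) + P * 1#) + (τ * τ * τ + τ) * P
          ≡⟨ solve 4 (λ τ ρ U P → ((τ :* τ :* τ :- τ) :* (con p :* con p :* con p) :+ ρ :* (con p :* con p)) :*
              (U :* (con p :* con p) :+ P :* con p) :+ (τ :* τ :* τ :+ τ) :* P
               := ρ :* P :+ (U :* (τ :* τ :* τ) :- τ :* τ :* τ :* P :- (τ :* U :- U :* ρ))) refl τ ρ U P ⟩
        ρ * P + (U * (τ * τ * τ) - τ * τ * τ * P - (τ * U - U * ρ))  ∎)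
      where
      σx≡ : σ x ≡ (U * U * U + U) * (ρ * ρ * ρ)
      σx≡ = trans (cong σ x≡) (trans (σ-* _ P) (cong₂ _*_
          (trans (σ-+ _ τ) (cong (_+ U) (trans (σ-* _ τ) (cong (_* U) (σ-* τ τ))))) (σσ ρ)))

    θ = τ * τ * τ * U

    θ≢0 : θ ≢ 0#
    θ≢0 = x*y≢0 (x*y≢0 (x*y≢0 τ≢0 τ≢0) τ≢0) (σ≢0 τ≢0)

    gauss-θ : gauss (- θ) ≡ ⊝ G
    gauss-θ = begin
      gauss (- θ)                          ≡⟨ cong gauss
          (solve 2 (λ τ U → :- (τ :* τ :* τ :* U) := con n :* (τ :* U) :* (τ :* τ)) refl τ U) ⟩
      gauss (- 1# * (τ * U) * (τ * τ))     ≡⟨ gauss-square _ τ≢0 ⟩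
      gauss (- 1# * (τ * U))               ≡⟨ gauss-twisted-square (- 1#) τ≢0 ⟩
      gauss (- 1#)                         ≡⟨ gauss-neg 1≢0 ⟩
      ⊝ G                                  ∎

    private
      scale : ∀ {y z} → U * y ≡ U * z → y ≡ z
      scale = *-cancelˡ (σ≢0 τ≢0)

      σ-scale : ∀ m → σ (U * m) ≡ τ * τ * τ * σ m
      σ-scale m = trans (σ-* U m) (cong (_* σ m) (σσ τ))

      σ-z : ∀ m → σ (τ * U * (m * m)) ≡ U * (τ * τ * τ) * (σ m * σ m)
      σ-z m = trans (σ-* (τ * U) (m * m)) (cong₂ _*_ (trans (σ-* τ U) (cong (U *_) (σσ τ))) (σ-* m m))

    -- The substitution y = σ τ · m turns the form into - θ (σ m + m)² modulo ℘. The additive map m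
    -- ↦ σ m + m is a bijection because σ m = - m only for m = 0, and a plain Gauss sum remains.
    plus : sum (λ y → χ (y * σ y - x * (y * y))) ≡ ⊝ G
    plus = begin
      sum (λ y → χ (y * σ y - x * (y * y)))                    ≡⟨ sym (sum-reindex _ (U *_) scale) ⟩
      sum (λ m → χ (U * m * σ (U * m) - x * (U * m * (U * m))))
          ≡⟨ sum-cong (λ m → χ-mod-℘ (σ-z m) (trans (cong (λ s → U * m * s - x * (U * m * (U * m))) (σ-scale m))
          (linear₁ (- (U * m * m)) kernel (solve 5 (λ x τ U m M → U :* m :* (τ :* τ :* τ :* M) :- x :* (U :* m :* (U :* m))
            :- ((:- (τ :* τ :* τ :* U)) :* ((M :+ m) :* (M :+ m)) :+ (U :* (τ :* τ :* τ) :* (M :* M) :- τ :* U :* (m :* m)))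
            := (:- (U :* m :* m)) :* (x :* U :- (τ :* τ :* τ :+ τ))) refl x τ U m (σ m))))) ⟩
      sum (λ m → χ (- θ * ((σ m + m) * (σ m + m))))
          ≡⟨ sum-reindex (λ w → χ (- θ * (w * w))) (λ m → σ m + m) plus-injective ⟩
      gauss (- θ)                                              ≡⟨ gauss-θ ⟩
      ⊝ G                                                      ∎
      where
      plus-injective : ∀ {m m′} → σ m + m ≡ σ m′ + m′ → m ≡ m′
      plus-injective {m} {m′} eq = x-y≡0⇒x≡y m m′ (σ-antifixed (trans (σ-sub m m′)
        (linear₁ 1# eq (solve 4 (λ m M m′ M′ → M :- M′ :- (:- (m :- m′)) := con p :* (M :+ m :- (M′ :+ m′))) refl m
            (σ m) m′ (σ m′)))))

    -- The same substitution now gives - θ (℘ m)², and ℘ is three-to-one onto its image. Summing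
    -- over the image weights w by 1 + χ w + χ (- w), and completing the square turns each
    -- nontrivial weight into the phase of 1 / θ = σ (ρ · σ ρ).
    minus : sum (λ y → χ (- (y * σ y) - x * (y * y))) ≡ ⊝ G ⊠ (𝟙 ⊞ χ (ρ * P) ⊞ χ (ρ * P))
    minus = begin
      sum (λ y → χ (- (y * σ y) - x * (y * y)))                ≡⟨ sym (sum-reindex _ (U *_) scale) ⟩
      sum (λ m → χ (- (U * m * σ (U * m)) - x * (U * m * (U * m))))
          ≡⟨ sum-cong (λ m → χ-mod-℘ (σ-z m) (trans (cong (λ s → - (U * m * s) - x * (U * m * (U * m))) (σ-scale m))
          (linear₁ (- (U * m * m)) kernel (solve 5 (λ x τ U m M → (:- (U :* m :* (τ :* τ :* τ :* M))) :- x :*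
              (U :* m :* (U :* m))
            :- ((:- (τ :* τ :* τ :* U)) :* ((M :- m) :* (M :- m)) :+ (U :* (τ :* τ :* τ) :* (M :* M) :- τ :* U :* (m :* m)))
            := (:- (U :* m :* m)) :* (x :* U :- (τ :* τ :* τ :+ τ))) refl x τ U m (σ m))))) ⟩
      sum (λ m → χ (- θ * (℘ m * ℘ m)))                        ≡⟨ sum-℘ (λ w → χ (- θ * (w * w))) ⟩
      sum (λ w → χ (- θ * (w * w)) ⊠ (𝟙 ⊞ χ w ⊞ χ (- w)))
          ≡⟨ sum-cong (λ w → trans (S.solve 3 (λ a b c → a S.:* (S.con 𝟙 S.:+ b S.:+ c) S.:= a S.:+ a S.:* b S.:+ a S.:*
          c) refl _ (χ w) (χ (- w)))
                                                                     (cong₂ (λ b c → χ (- θ * (w * w)) ⊞ b ⊞ c)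
                                                                         (complete w e (+-complete w)) (complete (- w)
                                                                         (- e) (neg-complete w)))) ⟩
      sum (λ w → χ (- θ * (w * w)) ⊞ χ e ⊠ χ (- θ * ((w + e) * (w + e))) ⊞ χ e ⊠ χ (- θ * ((w + - e) * (w + - e))))
                                                               ≡⟨ trans (sum-⊞ _ _) (cong₂ _⊞_
                                                                   (trans (sum-⊞ _ _) (cong (gauss (- θ) ⊞_)
                                                                   (shifted e))) (shifted (- e))) ⟩
      gauss (- θ) ⊞ χ e ⊠ gauss (- θ) ⊞ χ e ⊠ gauss (- θ)      ≡⟨ cong₂ (λ g a → g ⊞ a ⊠ g ⊞ a ⊠ g) gauss-θ χ-e ⟩
      ⊝ G ⊞ χ (ρ * P) ⊠ ⊝ G ⊞ χ (ρ * P) ⊠ ⊝ G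
          ≡⟨ S.solve 2 (λ g a → (S.:- g) S.:+ a S.:* (S.:- g) S.:+ a S.:* (S.:- g) S.:= (S.:- g) S.:*
          (S.con 𝟙 S.:+ a S.:+ a)) refl G (χ (ρ * P)) ⟩
      ⊝ G ⊠ (𝟙 ⊞ χ (ρ * P) ⊞ χ (ρ * P))                        ∎
      where
      e = inv θ
      θe≡1 : θ * e ≡ 1#
      θe≡1 = x*inv θ≢0
      complete : ∀ u s {w} → - θ * (w * w) + u ≡ e + - θ * ((w + s) * (w + s)) →
                 χ (- θ * (w * w)) ⊠ χ u ≡ χ e ⊠ χ (- θ * ((w + s) * (w + s)))
      complete u s eq = trans (sym (χ-+ _ u)) (trans (cong χ eq) (χ-+ e _))
      -- In characteristic 3 one has 4 = 1 and - 2 = 1, so e = 1 / θ is both the shift and the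
      -- constant term.
      +-complete : ∀ w → - θ * (w * w) + w ≡ e + - θ * ((w + e) * (w + e))
      +-complete w = linear₁ (e - w) θe≡1 (solve 3 (λ θ e w → (:- θ) :* (w :* w) :+ w :-
          (e :+ (:- θ) :* ((w :+ e) :* (w :+ e))) := (e :- w) :* (θ :* e :- con p)) refl θ e w)
      neg-complete : ∀ w → - θ * (w * w) + - w ≡ e + - θ * ((w + - e) * (w + - e))
      neg-complete w = linear₁ (e + w) θe≡1 (solve 3
          (λ θ e w → (:- θ) :* (w :* w) :+ (:- w) :- (e :+ (:- θ) :* ((w :+ (:- e)) :* (w :+ (:- e)))) := (e :+ w) :*
          (θ :* e :- con p)) refl θ e w)
      shifted : ∀ s → sum (λ w → χ e ⊠ χ (- θ * ((w + s) * (w + s)))) ≡ χ e ⊠ gauss (- θ)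
      shifted s = trans (sym (⊠-sum (χ e) _)) (cong (χ e ⊠_)
          (sum-reindex (λ w → χ (- θ * (w * w))) (_+ s) (+-cancelʳ s _ _)))
      χ-e : χ e ≡ χ (ρ * P)
      χ-e = trans (cong χ (*-cancelˡ θ≢0 (trans θe≡1 (sym θσ≡1)))) (χ-σ (ρ * P))
        where
        θσ≡1 : θ * σ (ρ * P) ≡ 1#
        θσ≡1 = trans (cong (θ *_) (trans (σ-* ρ P) (cong (P *_) (σσ ρ)))) (trans
          (solve 4 (λ τ U ρ P → τ :* τ :* τ :* U :* (P :* (ρ :* ρ :* ρ)) := τ :* ρ :* (τ :* ρ) :* (τ :* ρ) :* (U :* P))
              refl τ U ρ P)
          (trans (cong₂ (λ u v → u * u * u * v) τρ≡1 UP≡1) (solve 0 (con p :* con p :* con p :* con p := con p) refl)))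

    A≡H : A x ≡ H x
    A≡H = begin
      A x
          ≡⟨ sum-cong (λ y → trans (S.solve 3 (λ a b c → (a S.:- b) S.:* c S.:= a S.:* c S.:- b S.:* c) refl _ _ _)
          (cong₂ _⊟_ (sym (χ-+ _ _)) (sym (χ-+ _ _)))) ⟩
      sum (λ y → χ (y * σ y - x * (y * y)) ⊟ χ (- (y * σ y) - x * (y * y))) ≡⟨ trans (sum-⊟ _ _) (cong₂ _⊟_ plus minus) ⟩
      ⊝ G ⊟ ⊝ G ⊠ (𝟙 ⊞ χ (ρ * P) ⊞ χ (ρ * P))
          ≡⟨ S.solve 2 (λ g a → (S.:- g) S.:- (S.:- g) S.:* (S.con 𝟙 S.:+ a S.:+ a) S.:= S.con (ι 2) S.:* g S.:* a) refl
          G (χ (ρ * P)) ⟩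
      ι 2 ⊠ G ⊠ χ (ρ * P)                                      ≡⟨ cong (ι 2 ⊠ G ⊠_) (sym χ-cubic) ⟩
      H x                                                      ∎

  kernel⇒A≡H : ∀ {x τ} → Kernel x τ → A x ≡ H x
  kernel⇒A≡H (τ≢0 , kernel) = AtKernel.A≡H τ≢0 kernel

  kernel-neg⇒A≡H : ∀ {x τ} → Kernel (- x) τ → A x ≡ H x
  kernel-neg⇒A≡H {x} k = begin
    A x                    ≡⟨ sym (twice (A x)) ⟩
    ⊝ conj (⊝ conj (A x))  ≡⟨ cong (λ s → ⊝ conj s) (trans (sym (A-neg x)) (trans (kernel⇒A≡H k) (H-neg x))) ⟩
    ⊝ conj (⊝ conj (H x))  ≡⟨ twice (H x) ⟩
    H x                    ∎
    where
    twice : ∀ s → ⊝ conj (⊝ conj s) ≡ s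
    twice s = trans (cong ⊝_ (trans (conj-⊝ (conj s)) (cong ⊝_ (conj-involutive s))))
        (S.solve 1 (λ s → S.:- (S.:- s) S.:= s) refl s)

-- The key identity: counting kernels and comparing moments.

module CubicPhaseTheorem {q : ℕ} {K : Field q} (twist : Twist K) where
  open Field K
  open Twist twist
  open Characteristic3 K 1+1+1≡0
  open TwistProperties twist
  open Character twist
  open CubicPhase twist
  open Solver₃
  open ≡-Reasoning
  open Folding twisted-square-folding using () renaming (sum-fold to sum-twisted-squares)
  private module S = 𝔼-Solver

  -- The Wronskian τ σ t - t σ τ of two kernel elements is fixed by σ.
  kernel-unique : ∀ {x τ t} → χ (cubic x) ≢ 𝟙 → Kernel x τ → Kernel x t → t ≡ τ ⊎ t ≡ - τ
  kernel-unique {x} {τ} {t} χ≢𝟙 (τ≢0 , kernel) (t≢0 , kernel′) =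
    -- For k = t / τ one has ℘ k = ρ · σ ρ · W. If W = 0, then k is fixed by σ and is 0, 1 or - 1;
    -- if W = ± 1, then ρ · σ ρ is a value of ℘ up to sign, so the phase of c(x) would be trivial.
    [ (λ W≡0 → [ (λ k≡0 → contradiction (trans (t≡ k≡0) (*-zeroˡ τ)) t≢0)
               , [ (λ k≡1 → inj₁ (trans (t≡ k≡1) (*-identityˡ τ)))
                 , (λ k≡-1 → inj₂ (trans (t≡ k≡-1) (solve 1 (λ τ → con n :* τ := :- τ) refl τ))) ]′ ]′
               (σ-fixed (x-y≡0⇒x≡y _ _ (trans ℘k (trans (cong (ρ * P *_) W≡0) (*-zeroʳ _))))))
    , [ (λ W≡1 → contradiction (trans χ-cubic (trans
        (cong χ (sym (trans ℘k (trans (cong (ρ * P *_) W≡1) (*-identityʳ _))))) (χ-℘ k))) χ≢𝟙)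
      , (λ W≡-1 → contradiction (trans χ-cubic (trans (sym (conj-χ-neg _))
          (cong conj (trans (cong χ (sym (trans ℘k (trans (cong (ρ * P *_) W≡-1)
          (solve 1 (λ u → u :* con n := :- u) refl (ρ * P)))))) (χ-℘ k))))) χ≢𝟙) ]′ ]′
    (σ-fixed σW≡W)
    where
    open AtKernel τ≢0 kernel
    W = τ * σ t - t * U
    k = t * ρ
    t≡ : ∀ {e} → k ≡ e → t ≡ e * τ
    t≡ = quotient τ≢0
    σW≡W : σ W ≡ W
    σW≡W = trans (σ-sub (τ * σ t) (t * U)) (trans (cong₂ _-_ (trans (σ-* τ (σ t)) (cong (U *_) (σσ t)))
        (trans (σ-* t U) (cong (σ t *_) (σσ τ))))
      (linear₂ (σ t) (- U) kernel kernel′ (solve 5 (λ x τ t U T → U :* (t :* t :* t) :- T :* (τ :* τ :* τ) :-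
          (τ :* T :- t :* U)
        := T :* (x :* U :- (τ :* τ :* τ :+ τ)) :+ (:- U) :* (x :* T :- (t :* t :* t :+ t))) refl x τ t U (σ t))))
    ℘k : ℘ k ≡ ρ * P * W
    ℘k = trans (cong (_- k) (σ-* t ρ)) (linear₂ (- (σ t * P)) (t * ρ) τρ≡1 UP≡1
      (solve 6 (λ τ t U T ρ P → T :* P :- t :* ρ :- ρ :* P :* (τ :* T :- t :* U)
        := (:- (T :* P)) :* (τ :* ρ :- con p) :+ t :* ρ :* (U :* P :- con p)) refl τ t U (σ t) ρ P))

  -- Here the symmetric combination τ · σ t + t · σ τ is negated by σ and so vanishes; the ratio t /
  -- τ is then negated by σ too, which forces t = 0.
  kernel-exclusive : ∀ {x τ t} → Kernel x τ → ¬ Kernel (- x) t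
  kernel-exclusive {x} {τ} {t} (τ≢0 , kernel) (t≢0 , kernel′) = t≢0 (trans (quotient τ≢0 (σ-antifixed σk≡-k)) (*-zeroˡ τ))
    where
    open AtKernel τ≢0 kernel
    W = τ * σ t + t * U
    k = t * ρ
    W≡0 : W ≡ 0#
    W≡0 = σ-antifixed (trans (σ-+ (τ * σ t) (t * U))
        (trans (cong₂ _+_ (trans (σ-* τ (σ t)) (cong (U *_) (σσ t))) (trans (σ-* t U) (cong (σ t *_) (σσ τ))))
      (linear₂ (- σ t) (- U) kernel kernel′ (solve 5
          (λ x τ t U T → U :* (t :* t :* t) :+ T :* (τ :* τ :* τ) :- (:- (τ :* T :+ t :* U))
        := (:- T) :* (x :* U :- (τ :* τ :* τ :+ τ)) :+ (:- U) :* ((:- x) :* T :- (t :* t :* t :+ t))) refl x τ t U (σ t)))))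
    σk≡-k : σ k ≡ - k
    σk≡-k = trans (σ-* t ρ) (linear₃ (ρ * P) (- (σ t * P)) (- (t * ρ)) W≡0 τρ≡1 UP≡1
      (solve 6 (λ τ t U T ρ P → T :* P :- (:- (t :* ρ))
        := ρ :* P :* (τ :* T :+ t :* U :- con o) :+ (:- (T :* P)) :* (τ :* ρ :- con p) :+ (:- (t :* ρ)) :*
            (U :* P :- con p)) refl τ t U (σ t) ρ P))

  private
    kernels : Fin q → 𝔼
    kernels x = sum (λ τ → [ kernel? x τ ])

    nontrivial? : ∀ x → Dec (χ (cubic x) ≢ 𝟙)
    nontrivial? x = ¬? (χ (cubic x) ≟ᴱ 𝟙)

    ν : Fin q → 𝔼
    ν x = [ nontrivial? x ]

    -- The norm of 1 - χ w: it is 3 if χ w is nontrivial and 0 otherwise. It thus expresses three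
    -- times the indicator `ν` through characters.
    F : Fin q → 𝔼
    F w = ι 2 ⊟ (χ w ⊞ χ (- w))

    F-cong : ∀ {w w′} → χ w ≡ χ w′ → F w ≡ F w′
    F-cong {w} {w′} eq = cong (ι 2 ⊟_) (cong₂ _⊞_ eq (trans (χ-neg w) (trans (cong conj eq) (sym (χ-neg w′)))))

    3ν≡F : ∀ x → ι 3 ⊠ ν x ≡ F (cubic x)
    3ν≡F x = trans (by-value (proj₁ (χ-value (cubic x))) (proj₂ (χ-value (cubic x))))
        (cong (λ e → ι 2 ⊟ (χ (cubic x) ⊞ e)) (sym (χ-neg (cubic x))))
      where
      by-value : ∀ j {e} → e ≡ ω^ j → ι 3 ⊠ [ ¬? (e ≟ᴱ 𝟙) ] ≡ ι 2 ⊟ (e ⊞ conj e)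
      by-value o refl = refl
      by-value p refl = refl
      by-value n refl = refl

    sum-F : ∀ (φ : Fin q → Fin q) → sum (λ x → χ (φ x) ⊞ χ (- φ x)) ≡ 𝟘 → sum (λ x → F (φ x)) ≡ ι 2 ⊠ ι q
    sum-F φ eq = trans (sum-⊟ _ _) (trans (cong₂ _⊟_ (trans (sum-const q (ι 2)) (⊠-comm (ι q) (ι 2))) eq) (⊞-identityʳ _))

    sum-χ-neg-cubic : sum (λ x → χ (- cubic x)) ≡ 𝟘
    sum-χ-neg-cubic = trans (sum-cong (λ x → χ-neg (cubic x))) (trans (sym (sum-conj _)) (cong conj sum-χ-cubic))

    -- Each nonzero τ belongs to exactly one x, and there c(x) has the phase of ρ · σ ρ with ρ = 1 /
    -- τ. After exchanging the sums, the twisted squares ρ · σ ρ evaluate the total; τ = 0 fits in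
    -- because its `inv` is 0 and `F` vanishes at 0.
    sum-kernels : sum (λ x → kernels x ⊠ F (cubic x)) ≡ ι 2 ⊠ ι q
    sum-kernels = begin
      sum (λ x → kernels x ⊠ F (cubic x))
          ≡⟨ sum-cong (λ x → trans (⊠-comm _ _) (trans (⊠-sum _ _) (sum-cong (λ τ → ⊠-comm _ _)))) ⟩
      sum (λ x → sum (λ τ → [ kernel? x τ ] ⊠ F (cubic x)))      ≡⟨ sum-swap _ ⟩
      sum (λ τ → sum (λ x → [ kernel? x τ ] ⊠ F (cubic x)))      ≡⟨ sum-cong at ⟩
      sum (λ τ → F (inv τ * σ (inv τ)))                          ≡⟨ sum-reindex (λ ρ → F (ρ * σ ρ)) inv inv-injective ⟩
      sum (λ ρ → F (ρ * σ ρ))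
          ≡⟨ sum-F (λ ρ → ρ * σ ρ) (trans (sum-twisted-squares χ) (cong (ι 2 ⊠_) sum-χ≡𝟘)) ⟩
      ι 2 ⊠ ι q                                                  ∎
      where
      at : ∀ τ → sum (λ x → [ kernel? x τ ] ⊠ F (cubic x)) ≡ F (inv τ * σ (inv τ))
      at τ = by-cases (τ Fin.≟ 0#)
       where
       by-cases : Dec (τ ≡ 0#) → sum (λ x → [ kernel? x τ ] ⊠ F (cubic x)) ≡ F (inv τ * σ (inv τ))
       by-cases (yes refl) = trans (sum-𝟘 _ (λ x → trans
           (cong (_⊠ F (cubic x)) ([]-no (kernel? x 0#) (λ k → proj₁ k refl))) (zeroˡ _)))
                         (sym (trans (cong (λ ρ → F (ρ * σ (inv 0#))) inv-0)
                             (trans (cong F (*-zeroˡ _)) (trans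
                             (cong₂ (λ a b → ι 2 ⊟ (a ⊞ b)) χ-0 (trans (cong χ neg-0) χ-0)) refl))))
       by-cases (no τ≢0) = begin
        sum (λ x → [ kernel? x τ ] ⊠ F (cubic x))
            ≡⟨ sum-cong (λ x → cong (_⊠ F (cubic x))
            ([]-cong (kernel? x τ) (x Fin.≟ xτ) (λ k → AtKernel.x≡ τ≢0 (proj₂ k)) (λ { refl → τ≢0 , kernel }))) ⟩
        sum (λ x → [ x Fin.≟ xτ ] ⊠ F (cubic x))                 ≡⟨ sum-select xτ _ ⟩
        F (cubic xτ)                                             ≡⟨ F-cong (AtKernel.χ-cubic τ≢0 kernel) ⟩
        F (inv τ * σ (inv τ))                                    ∎
        where
        xτ = (τ * τ * τ + τ) * σ (inv τ)
        kernel : xτ * σ τ ≡ τ * τ * τ + τ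
        kernel = linear₁ (τ * τ * τ + τ) (σ-inverse (x*inv τ≢0))
            (solve 3 (λ τ U P → (τ :* τ :* τ :+ τ) :* P :* U :- (τ :* τ :* τ :+ τ)
          := (τ :* τ :* τ :+ τ) :* (U :* P :- con p)) refl τ (σ τ) (σ (inv τ)))

    ν-neg : ∀ x → ν (- x) ≡ ν x
    ν-neg x = []-cong (nontrivial? (- x)) (nontrivial? x)
      (λ χ≢𝟙 eq → χ≢𝟙 (trans (cong χ (cubic-neg x)) (trans (χ-neg _) (cong conj eq))))
      (λ χ≢𝟙 eq → χ≢𝟙 (trans (sym (conj-χ-neg _)) (cong conj (trans (cong χ (sym (cubic-neg x))) eq))))

    -- Among the x at which the phase of c(x) is nontrivial, there is on average one kernel element
    -- per x.
    sum-kernels-ν : sum (λ x → kernels x ⊠ ν x) ≡ sum ν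
    sum-kernels-ν = ι-cancelˡ 3 (begin
      ι 3 ⊠ sum (λ x → kernels x ⊠ ν x)       ≡⟨ ⊠-sum (ι 3) _ ⟩
      sum (λ x → ι 3 ⊠ (kernels x ⊠ ν x))     ≡⟨ sum-cong
          (λ x → trans (S.solve 2 (λ r v → S.con (ι 3) S.:* (r S.:* v) S.:= r S.:* (S.con (ι 3) S.:* v)) refl
          (kernels x) (ν x)) (cong (kernels x ⊠_) (3ν≡F x))) ⟩
      sum (λ x → kernels x ⊠ F (cubic x))     ≡⟨ sum-kernels ⟩
      ι 2 ⊠ ι q                               ≡⟨ sym
          (sum-F cubic (trans (sum-⊞ _ _) (cong₂ _⊞_ sum-χ-cubic sum-χ-neg-cubic))) ⟩
      sum (λ x → F (cubic x))                 ≡⟨ sum-cong (λ x → sym (3ν≡F x)) ⟩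
      sum (λ x → ι 3 ⊠ ν x)                   ≡⟨ sym (⊠-sum (ι 3) ν) ⟩
      ι 3 ⊠ sum ν                             ∎)

    sum-both-kernels : sum (λ x → (kernels x ⊞ kernels (- x)) ⊠ ν x) ≡ sum (λ x → ν x ⊞ ν x)
    sum-both-kernels = begin
      sum (λ x → (kernels x ⊞ kernels (- x)) ⊠ ν x)
          ≡⟨ sum-cong (λ x → trans (S.solve 3 (λ a b c → (a S.:+ b) S.:* c S.:= a S.:* c S.:+ b S.:* c) refl (kernels x)
          (kernels (- x)) (ν x))
                                                                     (cong (λ v → kernels x ⊠ ν x ⊞ kernels (- x) ⊠ v)
                                                                         (sym (ν-neg x)))) ⟩
      sum (λ x → kernels x ⊠ ν x ⊞ kernels (- x) ⊠ ν (- x))   ≡⟨ sum-⊞ _ _ ⟩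
      sum (λ x → kernels x ⊠ ν x) ⊞ sum (λ x → kernels (- x) ⊠ ν (- x))
          ≡⟨ cong₂ _⊞_ sum-kernels-ν (trans (sum-reindex (λ x → kernels x ⊠ ν x) -_ -‿injective) sum-kernels-ν) ⟩
      sum ν ⊞ sum ν                                           ≡⟨ sym (sum-⊞ ν ν) ⟩
      sum (λ x → ν x ⊞ ν x)                                   ∎

    no-kernels : ∀ x → (∀ τ → ¬ Kernel x τ) → kernels x ≡ 𝟘
    no-kernels x none = sum-𝟘 _ (λ τ → []-no (kernel? x τ) (none τ))

    bound : ∀ {x τ} → χ (cubic x) ≢ 𝟙 → Kernel x τ → re (kernels x ⊞ kernels (- x)) ℤ.≤ ℤ.+ 2
    bound {x} {τ} χ≢𝟙 k = subst (λ s → re s ℤ.≤ ℤ.+ 2)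
        (sym (trans (cong (kernels x ⊞_) (no-kernels (- x) (λ t → kernel-exclusive k))) (⊞-identityʳ _)))
      (subst (λ s → re (kernels x) ℤ.≤ re s) two (sum-mono _ _ term))
      where
      pair : Fin q → 𝔼
      pair t = [ t Fin.≟ τ ] ⊠ 𝟙 ⊞ [ t Fin.≟ - τ ] ⊠ 𝟙
      two : sum pair ≡ ι 2
      two = trans (sum-⊞ _ _) (cong₂ _⊞_ (sum-select τ (λ _ → 𝟙)) (sum-select (- τ) (λ _ → 𝟙)))
      indicator≤ : ∀ {P Q R : Set} (d : Dec P) (e : Dec Q) (f : Dec R) → (P → Q ⊎ R) → re [ d ] ℤ.≤ re
          ([ e ] ⊠ 𝟙 ⊞ [ f ] ⊠ 𝟙)
      indicator≤ (no _)  (yes _) (yes _) _ = ℤ.+≤+ ℕ.z≤n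
      indicator≤ (no _)  (yes _) (no _)  _ = ℤ.+≤+ ℕ.z≤n
      indicator≤ (no _)  (no _)  (yes _) _ = ℤ.+≤+ ℕ.z≤n
      indicator≤ (no _)  (no _)  (no _)  _ = ℤ.+≤+ ℕ.z≤n
      indicator≤ (yes _) (yes _) (yes _) _ = ℤ.+≤+ (ℕ.s≤s ℕ.z≤n)
      indicator≤ (yes _) (yes _) (no _)  _ = ℤₚ.≤-refl
      indicator≤ (yes _) (no _)  (yes _) _ = ℤₚ.≤-refl
      indicator≤ (yes x) (no ¬y) (no ¬z) f = contradiction (f x) [ ¬y , ¬z ]′
      term : ∀ t → re [ kernel? x t ] ℤ.≤ re (pair t)
      term t = indicator≤ (kernel? x t) (t Fin.≟ τ) (t Fin.≟ - τ) (kernel-unique χ≢𝟙 k)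

    search : ∀ x → (∃ λ τ → Kernel x τ) ⊎ (∃ λ τ → Kernel (- x) τ) ⊎ ((∀ τ → ¬ Kernel x τ) × (∀ τ → ¬ Kernel (- x) τ))
    search x with Finₚ.any? (kernel? x) | Finₚ.any? (kernel? (- x))
    ... | yes found | _         = inj₁ found
    ... | no _      | yes found = inj₂ (inj₁ found)
    ... | no none   | no none′  = inj₂ (inj₂ ((λ τ k → none (τ , k)) , (λ τ k → none′ (τ , k))))

    kernels≤2 : ∀ x → χ (cubic x) ≢ 𝟙 → re (kernels x ⊞ kernels (- x)) ℤ.≤ ℤ.+ 2
    kernels≤2 x χ≢𝟙 with search x
    ... | inj₁ (τ , k) = bound χ≢𝟙 k
    ... | inj₂ (inj₁ (τ , k)) = subst (λ s → re s ℤ.≤ ℤ.+ 2)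
        (trans (cong (λ y → kernels (- x) ⊞ kernels y) (neg-involutive x))
        (S.solve 2 (λ a b → a S.:+ b S.:= b S.:+ a) refl _ _))
        (bound (λ eq → χ≢𝟙 (trans (sym (conj-χ-neg _)) (cong conj (trans (cong χ (sym (cubic-neg x))) eq)))) k)
    ... | inj₂ (inj₂ (none , none′)) = subst (λ s → re s ℤ.≤ ℤ.+ 2)
        (sym (cong₂ _⊞_ (no-kernels x none) (no-kernels (- x) none′))) (ℤ.+≤+ ℕ.z≤n)

    weighted : ∀ x → re ((kernels x ⊞ kernels (- x)) ⊠ ν x) ℤ.≤ re (ν x ⊞ ν x)
    weighted x with χ (cubic x) ≟ᴱ 𝟙
    ... | yes _  = ℤₚ.≤-reflexive (cong re (zeroʳ (kernels x ⊞ kernels (- x))))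
    ... | no χ≢𝟙 = subst (λ s → re s ℤ.≤ ℤ.+ 2) (sym (⊠-identityʳ (kernels x ⊞ kernels (- x)))) (kernels≤2 x χ≢𝟙)

  -- Where the phase is nontrivial, x and - x together have at most two kernel elements, by
  -- `kernel-unique` and `kernel-exclusive`, and on average they have two. So they always have
  -- exactly two, and an x with none must have trivial phase.
  no-kernel⇒χ-cubic≡𝟙 : ∀ x → (∀ τ → ¬ Kernel x τ) → (∀ τ → ¬ Kernel (- x) τ) → χ (cubic x) ≡ 𝟙
  no-kernel⇒χ-cubic≡𝟙 x none none′ = conclude (χ (cubic x) ≟ᴱ 𝟙)
      (trans (cong re (sym (trans (cong (_⊠ ν x) (cong₂ _⊞_ (no-kernels x none) (no-kernels (- x) none′))) (zeroˡ (ν x)))))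
      (sum-tight _ _ weighted (ℤₚ.≤-reflexive (cong re (sym sum-both-kernels))) x))
    where
    conclude : ∀ {e} (d : Dec (e ≡ 𝟙)) → 0ℤ ≡ re ([ ¬? d ] ⊞ [ ¬? d ]) → e ≡ 𝟙
    conclude (yes e≡𝟙) _ = e≡𝟙
    conclude (no _) ()

  -- Parseval

  sum-A : sum A ≡ 𝟘
  sum-A = begin
    sum (λ x → sum (λ y → D y ⊠ χ (- (x * (y * y)))))         ≡⟨ sum-swap _ ⟩
    sum (λ y → sum (λ x → D y ⊠ χ (- (x * (y * y)))))         ≡⟨ sum-𝟘 _ (λ y → trans (sym (⊠-sum (D y) _)) (vanish y)) ⟩
    𝟘                                                         ∎
    where
    vanish : ∀ y → D y ⊠ sum (λ x → χ (- (x * (y * y)))) ≡ 𝟘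
    vanish y with y Fin.≟ 0#
    ... | yes refl = trans (cong (_⊠ sum (λ x → χ (- (x * (0# * 0#))))) D-0) (zeroˡ _)
    ... | no y≢0 = trans (cong (D y ⊠_) (trans (sum-cong
        (λ x → cong χ (solve 2 (λ x u → :- (x :* u) := (:- u) :* x) refl x (y * y))))
        (χ-sum≡𝟘 (neg≢0 (x*y≢0 y≢0 y≢0))))) (zeroʳ (D y))

  D-norm : ∀ y → D y ⊠ conj (D y) ≡ ι 2 ⊟ (χ (y * σ y) ⊞ χ (- (y * σ y)))
  D-norm y = begin
    D y ⊠ conj (D y)                                 ≡⟨ cong (D y ⊠_) (conj-D y) ⟩
    (a ⊟ b) ⊠ ⊝ (a ⊟ b)
        ≡⟨ S.solve 2 (λ a b → (a S.:- b) S.:* (S.:- (a S.:- b)) S.:= S.con (ι 2) S.:* (a S.:* b) S.:-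
        (a S.:* a S.:+ b S.:* b)) refl a b ⟩
    ι 2 ⊠ (a ⊠ b) ⊟ (a ⊠ a ⊞ b ⊠ b)
        ≡⟨ cong₂ (λ s t → ι 2 ⊠ s ⊟ t) (trans (sym (χ-+ u (- u))) (trans (cong χ (-‿inverseʳ u)) χ-0))
                                                         (cong₂ _⊞_ (trans (sym (χ-+ u u))
                                                             (cong χ (solve 1 (λ u → u :+ u := :- u) refl u)))
                                                             (trans (sym (χ-+ (- u) (- u))) (cong χ
                                                             (solve 1 (λ u → (:- u) :+ (:- u) := u) refl u)))) ⟩
    ι 2 ⊟ (b ⊞ a)
        ≡⟨ S.solve 2 (λ a b → S.con (ι 2) S.:- (b S.:+ a) S.:= S.con (ι 2) S.:- (a S.:+ b)) refl a b ⟩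
    ι 2 ⊟ (a ⊞ b)                                    ∎
    where
    u = y * σ y
    a = χ u
    b = χ (- u)

  sum-D-norm : sum (λ y → D y ⊠ conj (D y)) ≡ ι 2 ⊠ ι q
  sum-D-norm = trans (sum-cong D-norm) (sum-F (λ y → y * σ y) (trans (sum-twisted-squares χ) (cong (ι 2 ⊠_) sum-χ≡𝟘)))

  private
    -- The solutions are z = ± y, and `D` is even. At y = 0 the two solutions coincide, but the
    -- factor 2 survives because `D` vanishes there.
    same-square : ∀ y → sum (λ z → [ (z * z - y * y) Fin.≟ 0# ] ⊠ conj (D z)) ≡ ι 2 ⊠ conj (D y)
    same-square y with y Fin.≟ 0#
    ... | yes refl = trans (trans (sum-cong (λ z → cong (_⊠ conj (D z)) ([]-cong ((z * z - 0# * 0#) Fin.≟ 0#) (z Fin.≟ 0#)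
            (λ eq → x*x≡0⇒x≡0 (trans (solve 1 (λ z → z :* z := z :* z :- con o :* con o) refl z) eq))
            (λ { refl → solve 0 (con o :* con o :- con o :* con o := con o) refl })))) (sum-select 0# (λ z → conj (D z))))
          (trans (cong conj D-0) (sym (cong (λ d → ι 2 ⊠ conj d) D-0)))
    ... | no y≢0 = begin
      sum (λ z → [ (z * z - y * y) Fin.≟ 0# ] ⊠ conj (D z))
          ≡⟨ sum-cong (λ z → trans (cong (_⊠ conj (D z)) ([]-⊎ ((z * z - y * y) Fin.≟ 0#) (z Fin.≟ y) (z Fin.≟ - y)
            (λ eq → square≡⇒ (x-y≡0⇒x≡y _ _ eq)) (λ { refl → -‿inverseʳ _ })
                (λ { refl → solve 1 (λ y → (:- y) :* (:- y) :- y :* y := con o) refl y })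
            (λ { refl eq → y≢0 (x≡-x⇒x≡0 eq) }))) (S.solve 3 (λ a b c → (a S.:+ b) S.:* c S.:= a S.:* c S.:+ b S.:* c)
                refl [ z Fin.≟ y ] [ z Fin.≟ - y ] (conj (D z)))) ⟩
      sum (λ z → [ z Fin.≟ y ] ⊠ conj (D z) ⊞ [ z Fin.≟ - y ] ⊠ conj (D z))
          ≡⟨ trans (sum-⊞ _ _) (cong₂ _⊞_ (sum-select y _) (trans (sum-select (- y) _) (cong conj (D-neg y)))) ⟩
      conj (D y) ⊞ conj (D y)
          ≡⟨ S.solve 1 (λ d → d S.:+ d S.:= S.con (ι 2) S.:* d) refl (conj (D y)) ⟩
      ι 2 ⊠ conj (D y)                                        ∎

  sum-A-norm : sum (λ x → A x ⊠ conj (A x)) ≡ ι 4 ⊠ ι q ⊠ ι q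
  sum-A-norm = begin
    sum (λ x → A x ⊠ conj (A x))
        ≡⟨ sum-cong (λ x → trans (cong (A x ⊠_) (sum-conj _)) (sum-⊠-sum _ _)) ⟩
    sum (λ x → sum (λ y → sum (λ z → D y ⊠ χ (- (x * (y * y))) ⊠ conj (D z ⊠ χ (- (x * (z * z)))))))
        ≡⟨ sum-cong (λ x → sum-cong (λ y → sum-cong (λ z → term x y z))) ⟩
    sum (λ x → sum (λ y → sum (λ z → D y ⊠ conj (D z) ⊠ χ ((z * z - y * y) * x))))
        ≡⟨ trans (sum-swap _) (sum-cong (λ y → sum-swap _)) ⟩
    sum (λ y → sum (λ z → sum (λ x → D y ⊠ conj (D z) ⊠ χ ((z * z - y * y) * x))))
        ≡⟨ sum-cong (λ y → sum-cong (λ z → trans (sym (⊠-sum _ _))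
        (trans (cong (D y ⊠ conj (D z) ⊠_) (χ-orthogonality (z * z - y * y)))
                                                                   (S.solve 4 (λ a b q d → a S.:* b S.:* (q S.:* d) S.:=
                                                                       q S.:* a S.:* (d S.:* b)) refl (D y) (conj (D z))
                                                                       (ι q) [ (z * z - y * y) Fin.≟ 0# ])))) ⟩
    sum (λ y → sum (λ z → ι q ⊠ D y ⊠ ([ (z * z - y * y) Fin.≟ 0# ] ⊠ conj (D z))))
        ≡⟨ sum-cong (λ y → trans (sym (⊠-sum _ _)) (trans (cong (ι q ⊠ D y ⊠_) (same-square y))
                                                                   (S.solve 3 (λ q a b → q S.:* a S.:*
                                                                       (S.con (ι 2) S.:* b) S.:= S.con (ι 2) S.:* q S.:*
                                                                       (a S.:* b)) refl (ι q) (D y) (conj (D y))))) ⟩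
    sum (λ y → ι 2 ⊠ ι q ⊠ (D y ⊠ conj (D y)))                ≡⟨ trans (sym (⊠-sum _ _)) (cong (ι 2 ⊠ ι q ⊠_) sum-D-norm) ⟩
    ι 2 ⊠ ι q ⊠ (ι 2 ⊠ ι q)
        ≡⟨ S.solve 1 (λ q → S.con (ι 2) S.:* q S.:* (S.con (ι 2) S.:* q) S.:= S.con (ι 4) S.:* q S.:* q) refl (ι q) ⟩
    ι 4 ⊠ ι q ⊠ ι q                                           ∎
    where
    term : ∀ x y z → D y ⊠ χ (- (x * (y * y))) ⊠ conj (D z ⊠ χ (- (x * (z * z)))) ≡ D y ⊠ conj (D z) ⊠ χ
        ((z * z - y * y) * x)
    term x y z = trans (cong (D y ⊠ χ (- (x * (y * y))) ⊠_) (trans (conj-⊠ _ _) (cong (conj (D z) ⊠_) (conj-χ-neg _))))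
      (trans (S.solve 4 (λ a b c d → a S.:* b S.:* (c S.:* d) S.:= a S.:* c S.:* (b S.:* d)) refl (D y) _ (conj (D z)) _)
        (cong (D y ⊠ conj (D z) ⊠_) (trans (sym (χ-+ _ _))
            (cong χ (solve 3 (λ x u v → (:- (x :* u)) :+ x :* v := (v :- u) :* x) refl x (y * y) (z * z))))))

  -- A and H agree where a kernel exists, and elsewhere H is the constant 2 G; as A and H have the same
  -- sum and the same sum of norms, the norm of their difference has sum 0.
  A≡H : ∀ x → A x ≡ H x
  A≡H x = begin
    A x                    ≡⟨ S.solve 2 (λ a h → a S.:= h S.:- (h S.:- a)) refl (A x) (H x) ⟩
    H x ⊟ E x              ≡⟨ cong (H x ⊟_) (norm≡0⇒≡𝟘 (E x)
        (sym (sum-tight (λ _ → 𝟘) (λ x → E x ⊠ conj (E x)) (λ x → norm≥0 (E x))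
                                (ℤₚ.≤-reflexive (cong re (trans sum-E-norm (sym (sum-𝟘 {q} (λ _ → 𝟘) (λ _ → refl)))))) x))) ⟩
    H x ⊟ 𝟘                ≡⟨ S.solve 1 (λ h → h S.:- S.con 𝟘 S.:= h) refl (H x) ⟩
    H x                    ∎
    where
    E : Fin q → 𝔼
    E x = H x ⊟ A x
    sum-H : sum H ≡ 𝟘
    sum-H = trans (sym (⊠-sum (ι 2 ⊠ G) _)) (trans (cong (ι 2 ⊠ G ⊠_) sum-χ-cubic) (zeroʳ _))
    sum-E : sum E ≡ 𝟘
    sum-E = trans (sum-⊟ H A) (cong₂ _⊟_ sum-H sum-A)
    agree : ∀ {x} → A x ≡ H x → E x ≡ 𝟘
    agree {x} eq = trans (cong (H x ⊟_) eq) (⊞-inverseʳ (H x))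
    constant : ∀ {x} y → E x ≡ 𝟘 → y ⊠ conj (E x) ≡ ι 2 ⊠ G ⊠ conj (E x)
    constant y eq = trans (cong (λ e → y ⊠ conj e) eq)
        (trans (zeroʳ y) (sym (trans (cong (λ e → ι 2 ⊠ G ⊠ conj e) eq) (zeroʳ _))))
    -- Either a kernel exists and the error E x is 0, or the phase is trivial and H x is 2 G.
    H-on-E : ∀ x → H x ⊠ conj (E x) ≡ ι 2 ⊠ G ⊠ conj (E x)
    H-on-E x = [ (λ k → constant (H x) (agree (kernel⇒A≡H (proj₂ k))))
               , [ (λ k → constant (H x) (agree (kernel-neg⇒A≡H (proj₂ k))))
                 , (λ none → cong (_⊠ conj (E x)) (trans
                     (cong (ι 2 ⊠ G ⊠_) (no-kernel⇒χ-cubic≡𝟙 x (proj₁ none) (proj₂ none))) (⊠-identityʳ _))) ]′ ]′ (search x)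
    sum-HE : sum (λ x → H x ⊠ conj (E x)) ≡ 𝟘
    sum-HE = trans (sum-cong H-on-E) (trans (sym (⊠-sum (ι 2 ⊠ G) _))
        (trans (cong (ι 2 ⊠ G ⊠_) (trans (sym (sum-conj E)) (cong conj sum-E))) (zeroʳ _)))
    -- The cross term is written with E and H, not with A and H: where E may be nonzero H is
    -- constant, so this term sums to a multiple of the conjugate of the sum of E, which is 0.
    expand : ∀ x → E x ⊠ conj (E x) ≡ A x ⊠ conj (A x) ⊟ H x ⊠ conj (H x) ⊞ (H x ⊠ conj (E x) ⊞ conj (H x ⊠ conj (E x)))
    expand x = trans (cong (E x ⊠_) conj-E) (trans (S.solve 4 (λ h a h′ a′ → (h S.:- a) S.:* (h′ S.:- a′)
        S.:= a S.:* a′ S.:- h S.:* h′ S.:+ (h S.:* (h′ S.:- a′) S.:+ h′ S.:* (h S.:- a))) refl (H x) (A x) (conj (H x))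
            (conj (A x)))
      (cong₂ (λ s t → A x ⊠ conj (A x) ⊟ H x ⊠ conj (H x) ⊞ (s ⊞ t)) (cong (H x ⊠_) (sym conj-E))
        (sym (trans (conj-⊠ _ _) (cong (conj (H x) ⊠_) (conj-involutive (E x)))))))
      where
      conj-E : conj (E x) ≡ conj (H x) ⊟ conj (A x)
      conj-E = trans (conj-⊞ _ _) (cong (conj (H x) ⊞_) (conj-⊝ (A x)))
    sum-E-norm : sum (λ x → E x ⊠ conj (E x)) ≡ 𝟘
    sum-E-norm = begin
      sum (λ x → E x ⊠ conj (E x))        ≡⟨ trans (sum-cong expand)
          (trans (sum-⊞ _ _) (cong₂ _⊞_ (sum-⊟ _ _) (sum-⊞ _ _))) ⟩
      sum (λ x → A x ⊠ conj (A x)) ⊟ sum (λ x → H x ⊠ conj (H x)) ⊞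
          (sum (λ x → H x ⊠ conj (E x)) ⊞ sum (λ x → conj (H x ⊠ conj (E x))))
        ≡⟨ cong₂ _⊞_ (cong₂ _⊟_ sum-A-norm (trans (sum-cong H-norm)
            (trans (sum-const q (ι 4 ⊠ ι q)) (⊠-comm (ι q) (ι 4 ⊠ ι q)))))
            (cong₂ _⊞_ sum-HE (trans (sym (sum-conj _)) (cong conj sum-HE))) ⟩
      ι 4 ⊠ ι q ⊠ ι q ⊟ ι 4 ⊠ ι q ⊠ ι q ⊞ 𝟘 ≡⟨ S.solve 1 (λ s → s S.:- s S.:+ S.con 𝟘 S.:= S.con 𝟘) refl (ι 4 ⊠ ι q ⊠ ι q) ⟩
      𝟘                                   ∎

-- The sums M(s), and reduction of all image sums to them.

module CharacterSums {q : ℕ} {K : Field q} (twist : Twist K) where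
  open Field K
  open Twist twist
  open Characteristic3 K 1+1+1≡0
  open TwistProperties twist
  open Character twist
  open CubicPhase twist
  open CubicPhaseTheorem twist using (A≡H)
  open Solver₃
  open ≡-Reasoning
  open Folding square-folding using () renaming (opposite to square-opposite)
  open Folding twisted-square-folding using () renaming (sum-fold to sum-twisted-squares)
  open Folding quartic-folding using () renaming (surjective to ±quartic)
  private module S = 𝔼-Solver

  instance
    q-nonZero : ℕ.NonZero q
    q-nonZero = Finₚ.nonZeroIndex 0#

  module _ (s : Fin q) where
    M : 𝔼
    M = sum (λ v → χ (cubic (v * v) - s * s * (v * v)))

    private
      Φ : Fin q → 𝔼
      Φ u = χ u ⊠ gauss (- (σ u + s * s * u))

      L : Fin q → Fin q
      L w = 1# - w * w - s * s * (σ w * σ w)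

      N : 𝔼
      N = sum (λ w → [ L w Fin.≟ 0# ])

      2GM : ι 2 ⊠ G ⊠ M ≡ sum (λ y → D y ⊠ gauss (- (y * y + s * s)))
      2GM = begin
        ι 2 ⊠ G ⊠ M                                                  ≡⟨ ⊠-sum _ _ ⟩
        sum (λ v → ι 2 ⊠ G ⊠ χ (cubic (v * v) - s * s * (v * v)))
            ≡⟨ sum-cong (λ v → trans (cong (ι 2 ⊠ G ⊠_) (χ-+ _ _)) (trans (sym (⊠-assoc (ι 2 ⊠ G) _ _))
                                                                           (trans (cong (_⊠ χ (- (s * s * (v * v))))
                                                                               (sym (A≡H (v * v)))) (⊠-comm _ _)))) ⟩
        sum (λ v → χ (- (s * s * (v * v))) ⊠ A (v * v))              ≡⟨ sum-cong (λ v → ⊠-sum _ _) ⟩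
        sum (λ v → sum (λ y → χ (- (s * s * (v * v))) ⊠ (D y ⊠ χ (- (v * v * (y * y))))))  ≡⟨ sum-swap _ ⟩
        sum (λ y → sum (λ v → χ (- (s * s * (v * v))) ⊠ (D y ⊠ χ (- (v * v * (y * y))))))
            ≡⟨ sum-cong (λ y → trans (sum-cong (λ v → term y v)) (sym (⊠-sum (D y) _))) ⟩
        sum (λ y → D y ⊠ gauss (- (y * y + s * s)))                  ∎
        where
        term : ∀ y v → χ (- (s * s * (v * v))) ⊠ (D y ⊠ χ (- (v * v * (y * y)))) ≡ D y ⊠ χ (- (y * y + s * s) * (v * v))
        term y v = trans (S.solve 3 (λ a b c → a S.:* (b S.:* c) S.:= b S.:* (a S.:* c)) refl _ (D y) _)
            (cong (D y ⊠_) (trans (sym (χ-+ _ _))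
          (cong χ (solve 3 (λ s y v → (:- (s :* s :* (v :* v))) :+ (:- (v :* v :* (y :* y))) := (:- (y :* y :+ s :* s))
              :* (v :* v)) refl s y v))))

      -- For y ≠ 0 the factor y² + s² is nonzero, as - 1 is not a square, and multiplying it by the
      -- square y · σ y = u leaves the Gauss sum unchanged while the argument becomes σ u + s² u. At
      -- y = 0 the left side is 0 but the two values of Φ give 2 q, whence the correction.
      Φ-pair : ∀ y → Dec (y ≡ 0#) → D y ⊠ gauss (- (y * y + s * s)) ≡ Φ (y * σ y) ⊞ Φ (- (y * σ y)) ⊟ [ y Fin.≟ 0# ] ⊠
          (ι 2 ⊠ ι q)
      Φ-pair y (yes y≡0) = trans (trans (cong (_⊠ gauss (- (y * y + s * s))) (trans (cong D y≡0) D-0)) (zeroˡ _))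
        (sym (trans (cong₂ (λ a b → a ⊟ b ⊠ (ι 2 ⊠ ι q)) (cong₂ _⊞_ (Φ≡q yσy≡0) (Φ≡q (trans (cong -_ yσy≡0) neg-0)))
            ([]-yes (y Fin.≟ 0#) y≡0))
          (S.solve 1 (λ q → q S.:+ q S.:- S.con 𝟙 S.:* (S.con (ι 2) S.:* q) S.:= S.con 𝟘) refl (ι q))))
        where
        yσy≡0 : y * σ y ≡ 0#
        yσy≡0 = trans (cong (_* σ y) y≡0) (*-zeroˡ _)
        Φ≡q : ∀ {u} → u ≡ 0# → Φ u ≡ ι q
        Φ≡q {u} u≡0 = trans (cong₂ _⊠_ (trans (cong χ u≡0) χ-0)
            (trans (cong gauss (trans (cong (λ u → - (σ u + s * s * u)) u≡0)
          (trans (cong (λ z → - (z + s * s * 0#)) σ-0)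
              (solve 1 (λ s → :- (con o :+ s :* s :* con o) := con o) refl s)))) gauss-0)) (⊠-identityˡ (ι q))
      Φ-pair y (no y≢0) = sym (begin
        Φ u ⊞ Φ (- u) ⊟ [ y Fin.≟ 0# ] ⊠ (ι 2 ⊠ ι q)
            ≡⟨ cong₂ _⊟_ (cong₂ _⊞_ (cong (χ u ⊠_) gauss-plus) (cong (χ (- u) ⊠_) gauss-minus))
            (trans (cong (_⊠ (ι 2 ⊠ ι q)) ([]-no (y Fin.≟ 0#) y≢0)) (zeroˡ (ι 2 ⊠ ι q))) ⟩
        χ u ⊠ g ⊞ χ (- u) ⊠ ⊝ g ⊟ 𝟘
            ≡⟨ S.solve 3 (λ a b g → a S.:* g S.:+ b S.:* (S.:- g) S.:- S.con 𝟘 S.:= (a S.:- b) S.:* g) refl (χ u)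
            (χ (- u)) g ⟩
        D y ⊠ g                                             ∎)
        where
        u = y * σ y
        m = y * y + s * s
        g = gauss (- m)
        m≢0 : m ≢ 0#
        m≢0 m≡0 = y≢0 (square-opposite {y} {s} (linear₁ 1# m≡0
            (solve 2 (λ y s → y :* y :- (:- (s :* s)) := con p :* (y :* y :+ s :* s :- con o)) refl y s)))
        σu : σ u ≡ σ y * (y * y * y)
        σu = trans (σ-* y (σ y)) (cong (σ y *_) (σσ y))
        gauss-plus : gauss (- (σ u + s * s * u)) ≡ g
        gauss-plus = trans (cong gauss (trans (cong (λ z → - (z + s * s * u)) σu)
          (solve 3 (λ y Y s → :- (Y :* (y :* y :* y) :+ s :* s :* (y :* Y)) := (:- (y :* y :+ s :* s)) :* (y :* Y)) refl
              y (σ y) s))) (gauss-twisted-square (- m) y≢0)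
        gauss-minus : gauss (- (σ (- u) + s * s * - u)) ≡ ⊝ g
        gauss-minus = begin
          gauss (- (σ (- u) + s * s * - u))   ≡⟨ cong gauss
              (trans (cong (λ z → - (z + s * s * - u)) (trans (σ-neg u) (cong -_ σu)))
                                                   (solve 3 (λ y Y s → :- ((:- (Y :* (y :* y :* y))) :+ s :* s :*
                                                       (:- (y :* Y))) := (y :* y :+ s :* s) :* (y :* Y)) refl y (σ y) s)) ⟩
          gauss (m * u)                       ≡⟨ gauss-twisted-square m y≢0 ⟩
          gauss m                             ≡⟨ S.solve 1 (λ g → g S.:= S.:- (S.:- g)) refl (gauss m) ⟩
          ⊝ ⊝ gauss m                         ≡⟨ cong ⊝_ (sym (gauss-neg m≢0)) ⟩
          ⊝ g                                 ∎

      -- With v = σ w the term σ u · v² is σ (u w²) and has the phase of u w². The exponent becomes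
      -- L w · u, and orthogonality in u counts the zeros of L.
      sum-Φ : sum Φ ≡ ι q ⊠ N
      sum-Φ = begin
        sum (λ u → χ u ⊠ gauss (- (σ u + s * s * u)))
            ≡⟨ sum-cong (λ u → trans (⊠-sum _ _) (sum-cong (λ v → sym (χ-+ _ _)))) ⟩
        sum (λ u → sum (λ v → χ (u + - (σ u + s * s * u) * (v * v))))               ≡⟨ sum-swap _ ⟩
        sum (λ v → sum (λ u → χ (u + - (σ u + s * s * u) * (v * v))))               ≡⟨ sym (sum-reindex _ σ σ-injective) ⟩
        sum (λ w → sum (λ u → χ (u + - (σ u + s * s * u) * (σ w * σ w))))
            ≡⟨ sum-cong (λ w → trans (sum-cong (λ u → adjoint w u)) (χ-orthogonality (L w))) ⟩
        sum (λ w → ι q ⊠ [ L w Fin.≟ 0# ])                                          ≡⟨ sym (⊠-sum (ι q) _) ⟩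
        ι q ⊠ N                                                                     ∎
        where
        adjoint : ∀ w u → χ (u + - (σ u + s * s * u) * (σ w * σ w)) ≡ χ (L w * u)
        adjoint w u = χ-mod-℘ {z = - (u * (w * w))}
            (trans (σ-neg _) (cong -_ (trans (σ-* u (w * w)) (cong (σ u *_) (σ-* w w)))))
          (solve 5 (λ s u U w W → u :+ (:- (U :+ s :* s :* u)) :* (W :* W) := (con p :- w :* w :- s :* s :* (W :* W)) :*
              u :+ ((:- (U :* (W :* W))) :- (:- (u :* (w :* w))))) refl s u (σ u) w (σ w))

      GM : G ⊠ M ≡ ι q ⊠ (N ⊟ 𝟙)
      GM = ι-cancelˡ 2 (begin
        ι 2 ⊠ (G ⊠ M)                                               ≡⟨ trans (sym (⊠-assoc (ι 2) G M)) 2GM ⟩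
        sum (λ y → D y ⊠ gauss (- (y * y + s * s)))                 ≡⟨ sum-cong (λ y → Φ-pair y (y Fin.≟ 0#)) ⟩
        sum (λ y → Φ (y * σ y) ⊞ Φ (- (y * σ y)) ⊟ [ y Fin.≟ 0# ] ⊠ (ι 2 ⊠ ι q))
            ≡⟨ trans (sum-⊟ _ _) (cong₂ _⊟_ (trans (sum-twisted-squares Φ) (cong (ι 2 ⊠_) sum-Φ))
            (sum-select 0# (λ _ → ι 2 ⊠ ι q))) ⟩
        ι 2 ⊠ (ι q ⊠ N) ⊟ ι 2 ⊠ ι q
            ≡⟨ S.solve 2 (λ q n → S.con (ι 2) S.:* (q S.:* n) S.:- S.con (ι 2) S.:* q S.:= S.con (ι 2) S.:*
            (q S.:* (n S.:- S.con 𝟙))) refl (ι q) N ⟩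
        ι 2 ⊠ (ι q ⊠ (N ⊟ 𝟙))                                       ∎)

      -- The difference δ of the two squares satisfies δ = - s² σ δ. Then δ · σ δ is minus a square,
      -- while it is also a square by `yσy-square`; as - 1 is not a square, it is 0.
      L-unique : ∀ {w w′} → L w ≡ 0# → L w′ ≡ 0# → w′ * w′ ≡ w * w
      L-unique {w} {w′} eq eq′ = x-y≡0⇒x≡y _ _ ([ (λ δ≡0 → δ≡0) , σx≡0⇒x≡0 ]′ (x*y≡0⇒x≡0∨y≡0 {δ} δσδ≡0))
        where
        δ = w′ * w′ - w * w
        σδ : σ δ ≡ σ w′ * σ w′ - σ w * σ w
        σδ = trans (σ-sub _ _) (cong₂ _-_ (σ-* w′ w′) (σ-* w w))
        δ≡ : δ ≡ - (s * s * σ δ)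
        δ≡ = trans (linear₂ 1# (- 1#) eq eq′ (solve 5 (λ s w W v V → v :* v :- w :* w :- (:- (s :* s :* (V :* V :- W :* W)))
            := con p :* (con p :- w :* w :- s :* s :* (W :* W) :- con o) :+ con n :*
                (con p :- v :* v :- s :* s :* (V :* V) :- con o)) refl s w (σ w) w′ (σ w′)))
          (cong (λ z → - (s * s * z)) (sym σδ))
        t = proj₁ (yσy-square δ)
        δσδ≡0 : δ * σ δ ≡ 0#
        δσδ≡0 = trans (proj₂ (yσy-square δ)) (trans (cong (_* t) t≡0) (*-zeroˡ t))
          where
          t≡0 : t ≡ 0#
          t≡0 = square-opposite {t} {s * σ δ} (trans (sym (proj₂ (yσy-square δ))) (trans (cong (_* σ δ) δ≡)
            (solve 2 (λ s d → (:- (s :* s :* d)) :* d := :- (s :* d :* (s :* d))) refl s (σ δ))))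

      N-norm : (N ⊟ 𝟙) ⊠ conj (N ⊟ 𝟙) ≡ 𝟙
      N-norm with Finₚ.any? (λ w → L w Fin.≟ 0#)
      ... | no none = cong (λ n → (n ⊟ 𝟙) ⊠ conj (n ⊟ 𝟙)) (sum-𝟘 _ (λ w → []-no (L w Fin.≟ 0#) (λ eq → none (w , eq))))
      ... | yes (w , eq) = cong (λ n → (n ⊟ 𝟙) ⊠ conj (n ⊟ 𝟙)) (begin
        N
            ≡⟨ sum-cong (λ v → trans ([]-⊎ (L v Fin.≟ 0#) (v Fin.≟ w) (v Fin.≟ - w) (λ eq′ → square≡⇒ (L-unique eq eq′))
                                                                     (λ v≡w → trans (cong L v≡w) eq)
                                                                         (λ v≡-w → trans (cong L v≡-w) (trans L-neg eq))
                                                                         (λ v≡w v≡-w → w≢0 (x≡-x⇒x≡0 (trans (sym v≡w)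
                                                                         v≡-w))))
                                                                     (cong₂ _⊞_ (sym (⊠-identityʳ _))
                                                                         (sym (⊠-identityʳ _)))) ⟩
        sum (λ v → [ v Fin.≟ w ] ⊠ 𝟙 ⊞ [ v Fin.≟ - w ] ⊠ 𝟙)
            ≡⟨ trans (sum-⊞ _ _) (cong₂ _⊞_ (sum-select w (λ _ → 𝟙)) (sum-select (- w) (λ _ → 𝟙))) ⟩
        ι 2                                                     ∎)
        where
        L-neg : L (- w) ≡ L w
        L-neg = trans (cong (λ z → 1# - - w * - w - s * s * (z * z)) (σ-neg w))
          (solve 3 (λ s w W → con p :- (:- w) :* (:- w) :- s :* s :* ((:- W) :* (:- W)) := con p :- w :* w :- s :* s :*
              (W :* W)) refl s w (σ w))
        w≢0 : w ≢ 0#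
        w≢0 w≡0 = 1≢0 (trans (sym (trans (cong (λ z → 1# - 0# * 0# - s * s * (z * z)) σ-0)
            (solve 1 (λ s → con p :- con o :* con o :- s :* s :* (con o :* con o) := con p) refl s)))
          (trans (cong L (sym w≡0)) eq))

    M-norm : M ⊠ conj M ≡ ι q
    M-norm = ι-cancelˡ q (begin
      ι q ⊠ (M ⊠ conj M)                                  ≡⟨ cong (_⊠ (M ⊠ conj M)) (sym G-norm) ⟩
      G ⊠ conj G ⊠ (M ⊠ conj M)
          ≡⟨ S.solve 4 (λ a b c d → a S.:* b S.:* (c S.:* d) S.:= a S.:* c S.:* (b S.:* d)) refl G (conj G) M (conj M) ⟩
      G ⊠ M ⊠ (conj G ⊠ conj M)                           ≡⟨ cong (G ⊠ M ⊠_) (sym (conj-⊠ G M)) ⟩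
      G ⊠ M ⊠ conj (G ⊠ M)                                ≡⟨ cong (λ z → z ⊠ conj z) GM ⟩
      ι q ⊠ (N ⊟ 𝟙) ⊠ conj (ι q ⊠ (N ⊟ 𝟙))                ≡⟨ cong (ι q ⊠ (N ⊟ 𝟙) ⊠_) (conj-⊠ (ι q) (N ⊟ 𝟙)) ⟩
      ι q ⊠ (N ⊟ 𝟙) ⊠ (conj (ι q) ⊠ conj (N ⊟ 𝟙))         ≡⟨ cong (λ c → ι q ⊠ (N ⊟ 𝟙) ⊠ (c ⊠ conj (N ⊟ 𝟙))) (conj-ι q) ⟩
      ι q ⊠ (N ⊟ 𝟙) ⊠ (ι q ⊠ conj (N ⊟ 𝟙))
          ≡⟨ S.solve 3 (λ q a b → q S.:* a S.:* (q S.:* b) S.:= q S.:* q S.:* (a S.:* b)) refl (ι q) (N ⊟ 𝟙) (conj (N ⊟ 𝟙)) ⟩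
      ι q ⊠ ι q ⊠ ((N ⊟ 𝟙) ⊠ conj (N ⊟ 𝟙))                ≡⟨ trans (cong (ι q ⊠ ι q ⊠_) N-norm) (⊠-identityʳ (ι q ⊠ ι q)) ⟩
      ι q ⊠ ι q                                           ∎)

  image-sum : Fin q → Fin q → 𝔼
  image-sum a b = sum (λ v → χ (b * f a (v * v)))

  private
    -- The coefficient of the image sum is B′ = σ B, because the condition that normalises the
    -- leading coefficient of B′ f (W x) to ε is then the image under σ of `scaled`.
    module Normalise (a B w ε : Fin q) (ε-fixed : σ ε ≡ ε) (w≢0 : w ≢ 0#)
                     (scaled : B * (w * w * (w * w) * σ (w * w)) ≡ ε) where
      W = w * w
      V = σ W
      B′ = σ B
      Y = W * V
      j = inv Y
      t = a * j
      -- Modulo ℘ the twisted term t x joins - t² x, and - t² + t = 1 - (t + 1)². The 1 belongs to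
      -- c(x), and s is the root of the square that remains.
      s = t + 1#
      Yj≡1 : Y * j ≡ 1#
      Yj≡1 = x*inv (x*y≢0 (x*y≢0 w≢0 w≢0) (σ≢0 (x*y≢0 w≢0 w≢0)))

      cubic-coefficient : B′ * (V * V * (W * W * W)) ≡ ε
      cubic-coefficient = trans (sym (trans (cong σ (sym scaled))
          (trans (σ-* B _) (cong (B′ *_) (trans (σ-* (W * W) V) (cong₂ _*_ (σ-* W W) (σσ W))))))) ε-fixed

      twisted-coefficient : B′ * V * σ a ≡ ε * σ t
      twisted-coefficient = trans (sym (trans (σ-* (B * W) a) (cong (_* σ a) (σ-* B W))))
          (trans (cong σ BWa) (trans (σ-* ε t) (cong (_* σ t) ε-fixed)))
        where
        BWa : B * W * a ≡ ε * t
        BWa = linear₂ (- (B * W * a)) (a * j) Yj≡1 scaled (solve 6 (λ B W V a j ε → B :* W :* a :- ε :* (a :* j)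
          := (:- (B :* W :* a)) :* (W :* V :* j :- con p) :+ a :* j :* (B :* (W :* W :* V) :- ε)) refl B W V a j ε)

      linear-coefficient : B′ * (a * a * W) ≡ ε * (t * t)
      linear-coefficient = linear₂ (- (B′ * (a * a * W) * (Y * j + 1#))) (a * j * (a * j)) Yj≡1 cubic-coefficient
        (solve 6 (λ B W V a j ε → B :* (a :* a :* W) :- ε :* (a :* j :* (a :* j))
          := (:- (B :* (a :* a :* W) :* (W :* V :* j :+ con p))) :* (W :* V :* j :- con p) :+ a :* j :* (a :* j) :*
              (B :* (V :* V :* (W :* W :* W)) :- ε)) refl B′ W V a j ε)

      f-scaled : ∀ x → B′ * f a (W * x) ≡ ε * (σ x * σ x * (x * x * x)) + ε * σ t * σ x - ε * (t * t) * x
      f-scaled x = trans (cong (λ z → B′ * (z * z * (W * x * (W * x) * (W * x)) + σ a * z - a * a * (W * x))) (σ-* W x))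
        (trans (solve 7 (λ B W V x X a A → B :* (V :* X :* (V :* X) :* (W :* x :* (W :* x) :* (W :* x)) :+ A :* (V :* X)
            :- a :* a :* (W :* x))
          := B :* (V :* V :* (W :* W :* W)) :* (X :* X :* (x :* x :* x)) :+ B :* V :* A :* X :- B :* (a :* a :* W) :* x)
              refl B′ W V x (σ x) a (σ a))
        (cong₂ _-_ (cong₂ _+_ (cong (_* (σ x * σ x * (x * x * x))) cubic-coefficient)
            (cong (_* σ x) twisted-coefficient)) (cong (_* x) linear-coefficient)))

      χ-scaled : ∀ x → χ (B′ * f a (W * x)) ≡ χ (ε * (cubic x - s * s * x))
      χ-scaled x = χ-mod-℘ {z = ε * (x * x * σ x + t * x)}
        (trans (σ-* ε _) (cong₂ _*_ ε-fixed (trans (σ-+ _ _)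
            (cong₂ _+_ (trans (σ-* (x * x) (σ x)) (cong₂ _*_ (σ-* x x) (σσ x))) (σ-* t x)))))
        (trans (f-scaled x) (solve 5 (λ x X ε t T → ε :* (X :* X :* (x :* x :* x)) :+ ε :* T :* X :- ε :* (t :* t) :* x
          := ε :* (x :* x :* X :+ x :- (t :+ con p) :* (t :+ con p) :* x) :+
              (ε :* (X :* X :* (x :* x :* x) :+ T :* X) :- ε :* (x :* x :* X :+ t :* x))) refl x (σ x) ε t (σ t)))

      sum-scaled : image-sum a B′ ≡ sum (λ v → χ (ε * (cubic (v * v) - s * s * (v * v))))
      sum-scaled = trans (sym (sum-reindex (λ v → χ (B′ * f a (v * v))) (w *_) (*-cancelˡ w≢0)))
        (sum-cong (λ v → trans (cong (λ x → χ (B′ * f a x))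
            (solve 2 (λ w v → w :* v :* (w :* v) := w :* w :* (v :* v)) refl w v)) (χ-scaled (v * v))))

  -- Write b = σ B and 1 / B = ± w^(2α+4), which the quartic folding allows. The sign becomes ε, and
  -- ε = - 1 replaces M(s) by its conjugate.
  image-sum-norm : ∀ a {b} → b ≢ 0# → image-sum a b ⊠ conj (image-sum a b) ≡ ι q
  image-sum-norm a {b} b≢0 = subst (λ b → image-sum a b ⊠ conj (image-sum a b) ≡ ι q) σB≡b
      ([ positive , negative ]′ (proj₂ (±quartic (inv B))))
    where
    B = proj₁ (injective⇒surjective σ σ-injective b)
    σB≡b : σ B ≡ b
    σB≡b = proj₂ (injective⇒surjective σ σ-injective b)
    B≢0 : B ≢ 0#
    B≢0 B≡0 = b≢0 (trans (sym σB≡b) (trans (cong σ B≡0) σ-0))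
    w = proj₁ (±quartic (inv B))
    φ = w * w * (w * w) * σ (w * w)
    φ-0 : w ≡ 0# → φ ≡ 0#
    φ-0 w≡0 = trans (cong (λ w → w * w * (w * w) * σ (w * w)) w≡0)
        (solve 1 (λ z → con o :* con o :* (con o :* con o) :* z := con o) refl (σ (0# * 0#)))
    positive : inv B ≡ φ → _
    positive eq = trans (cong (λ z → z ⊠ conj z) (trans sum-scaled (sum-cong (λ v → cong χ (*-identityˡ _))))) (M-norm s)
      where
      open Normalise a B w 1# σ-1 (λ w≡0 → inv≢0 B≢0 (trans eq (φ-0 w≡0))) (trans (cong (B *_) (sym eq)) (x*inv B≢0))
    negative : inv B ≡ - φ → _
    negative eq = trans (cong (λ z → z ⊠ conj z) (trans sum-scaled
        (trans (sum-cong (λ v → trans (cong χ (solve 1 (λ z → con n :* z := :- z) refl _)) (χ-neg _))) (sym (sum-conj _)))))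
      (trans (cong (conj (M s) ⊠_) (conj-involutive (M s))) (trans (⊠-comm _ _) (M-norm s)))
      where
      open Normalise a B w (- 1#) (trans (σ-neg 1#) (cong -_ σ-1))
          (λ w≡0 → inv≢0 B≢0 (trans eq (trans (cong -_ (φ-0 w≡0)) neg-0)))
        (linear₂ (- 1#) B (x*inv B≢0) eq (solve 3 (λ B i φ → B :* φ :- con n := con n :* (B :* i :- con p) :+ B :*
            (i :- (:- φ))) refl B (inv B) φ))

-- The difference property from the character sums.

module ImageOfSquares {q : ℕ} {K : Field q} (twist : Twist K) (a : Fin q) where
  open Field K
  open Twist twist
  open Characteristic3 K 1+1+1≡0
  open TwistProperties twist
  open Character twist
  open CubicPhase twist
  open CharacterSums twist
  open Solver₃
  open ≡-Reasoning
  open Folding square-folding using () renaming (opposite to square-opposite; surjective to ±square; sum-fold to sum-squares)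
  private module S = 𝔼-Solver

  Image : Fin q → Set
  Image y = ∃ λ v → v ≢ 0# × f a (v * v) ≡ y

  image? : ∀ y → Dec (Image y)
  image? y = Finₚ.any? (λ v → ¬? (v Fin.≟ 0#) ×-dec (f a (v * v) Fin.≟ y))

  ¬image-neg : ∀ v → ¬ Image (f a (- (v * v)))
  ¬image-neg v (w , w≢0 , eq) = w≢0 (square-opposite (f-injective a eq))

  ¬image-0 : ¬ Image 0#
  ¬image-0 (w , w≢0 , eq) = w≢0 (x*x≡0⇒x≡0 (f-injective a (trans eq (sym (f-0 a)))))

  skew : ∀ {y} → y ≢ 0# → (Image y × ¬ Image (- y)) ⊎ (¬ Image y × Image (- y))
  skew {y} y≢0 with injective⇒surjective (f a) (f-injective a) y
  ... | u , refl with ±square u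
  ...   | v , inj₁ refl = inj₁ ((v , v≢0 , refl) , subst (λ z → ¬ Image z) (f-neg a (v * v)) (¬image-neg v))
    where
    v≢0 : v ≢ 0#
    v≢0 refl = y≢0 (trans (cong (f a) (*-zeroˡ 0#)) (f-0 a))
  ...   | v , inj₂ refl = inj₂ (¬image-neg v , (v , v≢0 , trans (sym (neg-involutive _)) (cong -_ (sym (f-neg a (v * v))))))
    where
    v≢0 : v ≢ 0#
    v≢0 refl = y≢0 (trans (cong (λ z → f a (- z)) (*-zeroˡ 0#)) (trans (cong (f a) neg-0) (f-0 a)))

  differences : Fin q → 𝔼
  differences g = sum (λ x → sum (λ y → [ image? x ] ⊠ ([ image? y ] ⊠ [ (x - y) Fin.≟ g ])))

  private
    d : Fin q → 𝔼
    d y = [ image? y ]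

    transform : Fin q → 𝔼
    transform b = sum (λ y → d y ⊠ χ (b * y))

    -- Each element of the image comes from exactly two v, namely a pair ± v; the subtracted 1 is
    -- the term v = 0, whose value 0 is outside the image.
    transform≡ : ∀ b → ι 2 ⊠ transform b ≡ image-sum a b ⊟ 𝟙
    transform≡ b = begin
      ι 2 ⊠ transform b
          ≡⟨ cong (ι 2 ⊠_) (sym (sum-reindex (λ y → d y ⊠ χ (b * y)) (f a) (f-injective a))) ⟩
      ι 2 ⊠ sum (λ u → d (f a u) ⊠ χ (b * f a u))      ≡⟨ sym (sum-squares (λ u → d (f a u) ⊠ χ (b * f a u))) ⟩
      sum (λ v → d (f a (v * v)) ⊠ χ (b * f a (v * v)) ⊞ d (f a (- (v * v))) ⊠ χ (b * f a (- (v * v))))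
          ≡⟨ sum-cong (λ v → term v (v Fin.≟ 0#)) ⟩
      sum (λ v → χ (b * f a (v * v)) ⊟ [ v Fin.≟ 0# ] ⊠ 𝟙)
          ≡⟨ trans (sum-⊟ _ _) (cong (image-sum a b ⊟_) (sum-select 0# (λ _ → 𝟙))) ⟩
      image-sum a b ⊟ 𝟙                                ∎
      where
      term : ∀ v → Dec (v ≡ 0#) → d (f a (v * v)) ⊠ χ (b * f a (v * v)) ⊞ d (f a (- (v * v))) ⊠ χ (b * f a (- (v * v)))
          ≡ χ (b * f a (v * v)) ⊟ [ v Fin.≟ 0# ] ⊠ 𝟙
      term v dec = trans (cong (d (f a (v * v)) ⊠ χ (b * f a (v * v)) ⊞_)
          (trans (cong (_⊠ χ (b * f a (- (v * v)))) ([]-no (image? _) (¬image-neg v))) (zeroˡ _)))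
        (trans (⊞-identityʳ _) (first dec))
        where
        first : Dec (v ≡ 0#) → d (f a (v * v)) ⊠ χ (b * f a (v * v)) ≡ χ (b * f a (v * v)) ⊟ [ v Fin.≟ 0# ] ⊠ 𝟙
        first (no v≢0) = trans (cong (_⊠ χ (b * f a (v * v))) ([]-yes (image? _) (v , v≢0 , refl)))
            (sym (trans (cong (λ i → χ (b * f a (v * v)) ⊟ i ⊠ 𝟙) ([]-no (v Fin.≟ 0#) v≢0))
          (S.solve 1 (λ x → x S.:- S.con 𝟘 S.:* S.con 𝟙 S.:= S.con 𝟙 S.:* x) refl _)))
        first (yes v≡0) = trans (cong (_⊠ χ (b * f a (v * v)))
            ([]-no (image? _) (subst (λ z → ¬ Image z) (sym f≡0) ¬image-0))) (trans (zeroˡ _)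
          (sym (cong₂ (λ x i → x ⊟ i ⊠ 𝟙) (trans (cong χ (trans (cong (b *_) f≡0) (*-zeroʳ b))) χ-0)
              ([]-yes (v Fin.≟ 0#) v≡0))))
          where
          f≡0 : f a (v * v) ≡ 0#
          f≡0 = trans (cong (f a) (trans (cong (_* v) v≡0) (*-zeroˡ v))) (f-0 a)

    -- Since f is odd, conjugation replaces v² by - v², and the squares together with their
    -- negatives give a full character sum twice.
    image-sum-skew : ∀ {b} → b ≢ 0# → image-sum a b ⊞ conj (image-sum a b) ≡ 𝟘
    image-sum-skew {b} b≢0 = begin
      image-sum a b ⊞ conj (image-sum a b)
          ≡⟨ cong (image-sum a b ⊞_) (trans (sum-conj _) (sum-cong (λ v → trans (sym (χ-neg _))
                                                                                  (cong χ (trans (solve 2 (λ b y → :-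
                                                                                      (b :* y) := b :* (:- y)) refl b _)
                                                                                      (cong (b *_) (sym (f-neg a (v *
                                                                                      v))))))))) ⟩
      image-sum a b ⊞ sum (λ v → χ (b * f a (- (v * v))))                   ≡⟨ sym (sum-⊞ _ _) ⟩
      sum (λ v → χ (b * f a (v * v)) ⊞ χ (b * f a (- (v * v))))             ≡⟨ sum-squares (λ u → χ (b * f a u)) ⟩
      ι 2 ⊠ sum (λ u → χ (b * f a u))
          ≡⟨ cong (ι 2 ⊠_) (trans (sum-reindex (λ y → χ (b * y)) (f a) (f-injective a)) (χ-sum≡𝟘 b≢0)) ⟩
      𝟘                                                                     ∎

    T : Fin q → 𝔼
    T b = ι 2 ⊠ transform b ⊠ conj (ι 2 ⊠ transform b)

    -- A purely imaginary m of norm q lies at squared distance q + 1 from 1.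
    T≡ : ∀ {b} → b ≢ 0# → T b ≡ ι q ⊞ 𝟙
    T≡ {b} b≢0 = begin
      T b                                                   ≡⟨ cong (λ z → z ⊠ conj z) (transform≡ b) ⟩
      (m ⊟ 𝟙) ⊠ conj (m ⊟ 𝟙)                                ≡⟨ cong ((m ⊟ 𝟙) ⊠_) (conj-⊞ m (⊝ 𝟙)) ⟩
      (m ⊟ 𝟙) ⊠ (conj m ⊟ 𝟙)
          ≡⟨ S.solve 2 (λ m m′ → (m S.:- S.con 𝟙) S.:* (m′ S.:- S.con 𝟙) S.:= m S.:* m′ S.:+ S.con 𝟙 S.:- (m S.:+ m′))
          refl m (conj m) ⟩
      m ⊠ conj m ⊞ 𝟙 ⊟ (m ⊞ conj m)
          ≡⟨ cong₂ (λ x y → x ⊞ 𝟙 ⊟ y) (image-sum-norm a b≢0) (image-sum-skew b≢0) ⟩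
      ι q ⊞ 𝟙 ⊟ 𝟘
          ≡⟨ S.solve 1 (λ x → x S.:+ S.con 𝟙 S.:- S.con 𝟘 S.:= x S.:+ S.con 𝟙) refl (ι q) ⟩
      ι q ⊞ 𝟙                                               ∎
      where m = image-sum a b

    -- Fourier inversion of an autocorrelation. The factor q comes from orthogonality, and 4 from
    -- the doubled transform in `T`.
    inversion : ∀ g → ι 4 ⊠ (ι q ⊠ differences g) ≡ sum (λ b → χ (- g * b) ⊠ T b)
    inversion g = begin
      ι 4 ⊠ (ι q ⊠ differences g)
          ≡⟨ cong (ι 4 ⊠_) (trans (⊠-sum (ι q) _) (sum-cong (λ x → trans (⊠-sum (ι q) _) (sum-cong (λ y → delta x y))))) ⟩
      ι 4 ⊠ sum (λ x → sum (λ y → sum (λ b → d x ⊠ d y ⊠ χ ((x - y - g) * b))))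
          ≡⟨ cong (ι 4 ⊠_) (trans (sum-cong (λ x → sum-swap _)) (sum-swap _)) ⟩
      ι 4 ⊠ sum (λ b → sum (λ x → sum (λ y → d x ⊠ d y ⊠ χ ((x - y - g) * b))))
          ≡⟨ cong (ι 4 ⊠_) (sum-cong (λ b → trans (sum-cong (λ x → sum-cong (λ y → split b x y))) (factor b))) ⟩
      ι 4 ⊠ sum (λ b → χ (- g * b) ⊠ (transform b ⊠ conj (transform b)))
          ≡⟨ trans (⊠-sum (ι 4) _) (sum-cong (λ b → scale b)) ⟩
      sum (λ b → χ (- g * b) ⊠ T b)                                                   ∎
      where
      delta : ∀ x y → ι q ⊠ (d x ⊠ (d y ⊠ [ (x - y) Fin.≟ g ])) ≡ sum (λ b → d x ⊠ d y ⊠ χ ((x - y - g) * b))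
      delta x y = trans (cong (λ i → ι q ⊠ (d x ⊠ (d y ⊠ i)))
          ([]-cong ((x - y) Fin.≟ g) ((x - y - g) Fin.≟ 0#) (λ { refl → -‿inverseʳ _ }) (x-y≡0⇒x≡y _ _)))
        (trans (S.solve 4 (λ q a b i → q S.:* (a S.:* (b S.:* i)) S.:= a S.:* b S.:* (q S.:* i)) refl (ι q) (d x) (d y)
            [ (x - y - g) Fin.≟ 0# ])
          (trans (cong (d x ⊠ d y ⊠_) (sym (χ-orthogonality (x - y - g)))) (⊠-sum _ _)))
      split : ∀ b x y → d x ⊠ d y ⊠ χ ((x - y - g) * b) ≡ χ (- g * b) ⊠ (d x ⊠ χ (b * x) ⊠ conj (d y ⊠ χ (b * y)))
      split b x y = trans (cong (d x ⊠ d y ⊠_) (trans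
          (cong χ (solve 4 (λ x y g b → (x :- y :- g) :* b := b :* x :- b :* y :+ (:- g) :* b) refl x y g b))
          (trans (χ-+ _ _) (cong (_⊠ χ (- g * b)) (χ-sub (b * x) (b * y))))))
        (trans (S.solve 5 (λ a b c e h → a S.:* b S.:* (c S.:* e S.:* h) S.:= h S.:* (a S.:* c S.:* (b S.:* e))) refl
            (d x) (d y) (χ (b * x)) (conj (χ (b * y))) (χ (- g * b)))
          (cong (λ z → χ (- g * b) ⊠ (d x ⊠ χ (b * x) ⊠ z))
              (sym (trans (conj-⊠ _ _) (cong (_⊠ conj (χ (b * y))) (conj-[] (image? y)))))))
      factor : ∀ b → sum (λ x → sum (λ y → χ (- g * b) ⊠ (d x ⊠ χ (b * x) ⊠ conj (d y ⊠ χ (b * y))))) ≡ χ (- g * b) ⊠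
          (transform b ⊠ conj (transform b))
      factor b = sym (trans (cong (χ (- g * b) ⊠_) (trans (cong (transform b ⊠_) (sum-conj _)) (sum-⊠-sum _ _)))
          (trans (⊠-sum _ _) (sum-cong (λ x → ⊠-sum _ _))))
      scale : ∀ b → ι 4 ⊠ (χ (- g * b) ⊠ (transform b ⊠ conj (transform b))) ≡ χ (- g * b) ⊠ T b
      scale b = trans (S.solve 3 (λ e t t′ → S.con (ι 4) S.:* (e S.:* (t S.:* t′)) S.:= e S.:*
          (S.con (ι 2) S.:* t S.:* (S.con (ι 2) S.:* t′))) refl (χ (- g * b)) (transform b) (conj (transform b)))
        (cong (λ z → χ (- g * b) ⊠ (ι 2 ⊠ transform b ⊠ z)) (sym (conj-⊠ (ι 2) (transform b))))

    -- `T` is the constant q + 1 plus this multiple of the point mass at 0. The constant contributes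
    -- nothing at g ≠ 0, so the sum there does not depend on g.
    excess : 𝔼
    excess = T 0# ⊟ (ι q ⊞ 𝟙)

    total : ∀ {g} → g ≢ 0# → sum (λ b → χ (- g * b) ⊠ T b) ≡ excess
    total {g} g≢0 = begin
      sum (λ b → χ (- g * b) ⊠ T b)                                              ≡⟨ sum-cong (λ b → term b (b Fin.≟ 0#)) ⟩
      sum (λ b → (ι q ⊞ 𝟙) ⊠ χ (- g * b) ⊞ [ b Fin.≟ 0# ] ⊠ excess)
          ≡⟨ trans (sum-⊞ _ _) (cong₂ _⊞_ (sym (⊠-sum _ _)) (sum-select 0# (λ _ → excess))) ⟩
      (ι q ⊞ 𝟙) ⊠ sum (λ b → χ (- g * b)) ⊞ excess
          ≡⟨ cong (λ z → (ι q ⊞ 𝟙) ⊠ z ⊞ excess) (χ-sum≡𝟘 (neg≢0 g≢0)) ⟩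
      (ι q ⊞ 𝟙) ⊠ 𝟘 ⊞ excess
          ≡⟨ trans (cong (_⊞ excess) (zeroʳ (ι q ⊞ 𝟙))) (⊞-identityˡ excess) ⟩
      excess                                                                     ∎
      where
      term : ∀ b → Dec (b ≡ 0#) → χ (- g * b) ⊠ T b ≡ (ι q ⊞ 𝟙) ⊠ χ (- g * b) ⊞ [ b Fin.≟ 0# ] ⊠ excess
      term b (no b≢0) = trans (cong (χ (- g * b) ⊠_) (T≡ b≢0))
          (sym (trans (cong (λ i → (ι q ⊞ 𝟙) ⊠ χ (- g * b) ⊞ i ⊠ excess) ([]-no (b Fin.≟ 0#) b≢0))
        (S.solve 3 (λ x e y → x S.:* e S.:+ S.con 𝟘 S.:* y S.:= e S.:* x) refl (ι q ⊞ 𝟙) (χ (- g * b)) excess)))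
      term b (yes b≡0) = trans (cong₂ _⊠_ χ≡𝟙 (cong T b≡0))
          (sym (trans (cong₂ (λ e i → (ι q ⊞ 𝟙) ⊠ e ⊞ i ⊠ excess) χ≡𝟙 ([]-yes (b Fin.≟ 0#) b≡0))
        (S.solve 2 (λ x t → x S.:* S.con 𝟙 S.:+ S.con 𝟙 S.:* (t S.:- x) S.:= S.con 𝟙 S.:* t) refl (ι q ⊞ 𝟙) (T 0#))))
        where
        χ≡𝟙 : χ (- g * b) ≡ 𝟙
        χ≡𝟙 = trans (cong χ (trans (cong (- g *_) b≡0) (*-zeroʳ (- g)))) χ-0

  differences-constant : ∀ {g g′} → g ≢ 0# → g′ ≢ 0# → differences g ≡ differences g′
  differences-constant {g} {g′} g≢0 g′≢0 = ι-cancelˡ q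
      (ι-cancelˡ 4 (trans (trans (inversion g) (total g≢0)) (sym (trans (inversion g′) (total g′≢0)))))

-- The twist x ↦ x^α of a field of order 3^(2h+1), where α = 3^(h+1)

module _ (h : ℕ) (K : Field (3 ℕ.^ (2 ℕ.* h ℕ.+ 1))) where
  open Field K
  open FieldProperties K

  private
    3·1≡0 : 3 · 1# ≡ 0#
    3·1≡0 = descend (2 ℕ.* h ℕ.+ 1) q·1≡0
      where
      descend : ∀ m → (3 ℕ.^ m) · 1# ≡ 0# → 3 · 1# ≡ 0#
      descend zero    eq = contradiction (trans (sym (+-identityʳ 1#)) eq) 1≢0
      descend (suc m) eq = [ (λ eq₃ → eq₃) , descend m ]′ (x*y≡0⇒x≡0∨y≡0 (trans (sym (·1-homo-* 3 (3 ℕ.^ m))) eq))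

    1+1+1≡0 : HasCharacteristic3
    1+1+1≡0 = trans (+-assoc 1# 1# 1#) (trans (cong (λ z → 1# + (1# + z)) (sym (+-identityʳ 1#))) 3·1≡0)

    open Characteristic3 K 1+1+1≡0 using (module Solver₃)
    open Solver₃

    cube : ∀ x → x ^ 3 ≡ x * x * x
    cube = solve 1 (λ x → x :* (x :* (x :* con p)) := x :* x :* x) refl

    cube-+ : ∀ x y → (x + y) ^ 3 ≡ x ^ 3 + y ^ 3
    cube-+ = solve 2 (λ x y → (x :+ y) :* ((x :+ y) :* ((x :+ y) :* con p)) := x :* (x :* (x :* con p)) :+ y :*
        (y :* (y :* con p))) refl

    frobenius-+ : ∀ m x y → (x + y) ^ (3 ℕ.^ m) ≡ x ^ (3 ℕ.^ m) + y ^ (3 ℕ.^ m)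
    frobenius-+ zero    x y = distribʳ 1# x y
    frobenius-+ (suc m) x y = begin
      (x + y) ^ (3 ℕ.* 3 ℕ.^ m)                     ≡⟨ sym (^-assocʳ (x + y) 3 (3 ℕ.^ m)) ⟩
      ((x + y) ^ 3) ^ (3 ℕ.^ m)                     ≡⟨ cong (_^ (3 ℕ.^ m)) (cube-+ x y) ⟩
      (x ^ 3 + y ^ 3) ^ (3 ℕ.^ m)                   ≡⟨ frobenius-+ m (x ^ 3) (y ^ 3) ⟩
      (x ^ 3) ^ (3 ℕ.^ m) + (y ^ 3) ^ (3 ℕ.^ m)     ≡⟨ cong₂ _+_ (^-assocʳ x 3 (3 ℕ.^ m)) (^-assocʳ y 3 (3 ℕ.^ m)) ⟩
      x ^ (3 ℕ.* 3 ℕ.^ m) + y ^ (3 ℕ.* 3 ℕ.^ m)     ∎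
      where open ≡-Reasoning

    α = 3 ℕ.^ (h ℕ.+ 1)

    α*α : α ℕ.* α ≡ 3 ℕ.^ (2 ℕ.* h ℕ.+ 1) ℕ.* 3
    α*α = trans (sym (ℕₚ.^-distribˡ-+-* 3 (h ℕ.+ 1) (h ℕ.+ 1))) (trans (cong (3 ℕ.^_)
      (ℕ-Solver.solve 1 (λ h → h ℕ-Solver.:+ ℕ-Solver.con 1 ℕ-Solver.:+ (h ℕ-Solver.:+ ℕ-Solver.con 1)
        ℕ-Solver.:= ℕ-Solver.con 2 ℕ-Solver.:* h ℕ-Solver.:+ ℕ-Solver.con 1 ℕ-Solver.:+ ℕ-Solver.con 1) refl h))
      (ℕₚ.^-distribˡ-+-* 3 (2 ℕ.* h ℕ.+ 1) 1))

  power-twist : Twist K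
  power-twist = record
    { 1+1+1≡0 = 1+1+1≡0
    ; σ   = _^ α
    ; σ-+ = frobenius-+ (h ℕ.+ 1)
    ; σ-* = λ x y → ^-distrib-* x y α
    ; σσ  = λ x → trans (^-assocʳ x α α) (trans (cong (x ^_) α*α)
              (trans (sym (^-assocʳ x (3 ℕ.^ (2 ℕ.* h ℕ.+ 1)) 3)) (trans (cong (_^ 3) (fermat x)) (cube x))))
    }

  f-power : ∀ a x → x ^ (α ℕ.+ α ℕ.+ 3) + (a * x) ^ α - a ^ 2 * x ≡ TwistProperties.f power-twist a x
  f-power a x = cong₂ _-_
    (cong₂ _+_ (trans (^-homo-* x (α ℕ.+ α) 3) (cong₂ _*_ (^-homo-* x α α) (cube x))) (^-distrib-* a x α))
    (cong (λ z → a * z * x) (*-identityʳ a))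

-- The field transported to the carrier Fin q

module Transport {q : ℕ} (F : FiniteField q) where
  private
    module F = FiniteField F
    open F using (Carrier; _≈_; enum; enum-injective; enum-surjective)

  index : Carrier → Fin q
  index x = proj₁ (enum-surjective x)

  enum-index : ∀ x → enum (index x) ≈ x
  enum-index x = proj₂ (enum-surjective x)

  index-cong : ∀ {x y} → x ≈ y → index x ≡ index y
  index-cong {x} {y} x≈y = enum-injective _ _ (F.trans (enum-index x) (F.trans x≈y (F.sym (enum-index y))))

  private
    raw : RawRing 0ℓ 0ℓ
    raw = record
      { Carrier = Fin q
      ; _≈_ = _≡_
      ; _+_ = λ i j → index (enum i F.+ enum j)
      ; _*_ = λ i j → index (enum i F.* enum j)
      ; -_  = λ i → index (F.- enum i)
      ; 0#  = index F.0#
      ; 1#  = index F.1#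
      }

    -- The operations on indices are those of F followed by `index`, so `enum` is an injective
    -- homomorphism, and the ring laws can be pulled back along it.
    isRingMonomorphism : IsRingMonomorphism raw (CommutativeRing.rawRing F.commRing) enum
    isRingMonomorphism = record
      { isRingHomomorphism = record
        { isSemiringHomomorphism = record
          { isNearSemiringHomomorphism = record
            { +-isMonoidHomomorphism = record
              { isMagmaHomomorphism = record
                { isRelHomomorphism = record { cong = λ { refl → F.refl } }
                ; homo = λ i j → enum-index _
                }
              ; ε-homo = enum-index _
              }
            ; *-homo = λ i j → enum-index _
            }
          ; 1#-homo = enum-index _
          }
        ; -‿homo = λ i → enum-index _
        }
      ; injective = enum-injective _ _
      }

  transported : Field q
  transported = record
    { isCommutativeRing = RingMonomorphism.isCommutativeRing isRingMonomorphism F.isCommutativeRing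
    ; 1≢0 = λ eq → F.1≉0 (F.trans (F.sym (enum-index F.1#)) (F.trans (F.reflexive (cong enum eq)) (enum-index F.0#)))
    ; inverse = λ i i≢0 →
        let y , xy≈1 = F.inverse (enum i) (λ eq → i≢0 (enum-injective _ _ (F.trans eq (F.sym (enum-index F.0#)))))
        in index y , index-cong (F.trans (F.*-congˡ (enum-index y)) xy≈1)
    }

  open Field transported

  enum-^ : ∀ i m → enum (i ^ m) ≈ enum i F.^ᶠ m
  enum-^ i zero    = enum-index _
  enum-^ i (suc m) = F.trans (enum-index _) (F.*-congˡ (enum-^ i m))

  enum≈0⇒ : ∀ {i} → enum i ≈ F.0# → i ≡ 0#
  enum≈0⇒ eq = enum-injective _ _ (F.trans eq (F.sym (enum-index F.0#)))

  ≡0⇒enum≈0 : ∀ {i} → i ≡ 0# → enum i ≈ F.0#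
  ≡0⇒enum≈0 refl = enum-index F.0#

  index≢0 : ∀ {x} → ¬ (x ≈ F.0#) → index x ≢ 0#
  index≢0 x≉0 eq = x≉0 (F.trans (F.sym (enum-index _)) (≡0⇒enum≈0 eq))

  enum-sub : ∀ i j → enum (i - j) ≈ enum i F.- enum j
  enum-sub i j = F.trans (enum-index _) (F.+-congˡ (enum-index _))

-- Return to the given field.

module Conclusion (h : ℕ) (F : FiniteField (3 ℕ.^ (2 ℕ.* h ℕ.+ 1))) (a : FiniteField.Carrier F) where
  private
    module F = FiniteField F
    open F using (Carrier; _≈_; enum; enum-injective)
    open Transport F
    open Field transported
    q = 3 ℕ.^ (2 ℕ.* h ℕ.+ 1)
    α = 3 ℕ.^ (h ℕ.+ 1)
    twist : Twist transported
    twist = power-twist h transported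
    open TwistProperties twist using (f)
    open ImageOfSquares twist (index a)
    open Exp F.semiring using () renaming (^-congˡ to F-^-cong)
    D = Dₐ F α a
    D? = Dₐ? F α a

    enum-f : ∀ v → enum (f (index a) (v * v)) ≈ fₐ F α a (enum v F.^ᶠ 2)
    enum-f v = begin
      enum (f (index a) x)
          ≡⟨ cong enum (sym (f-power h transported (index a) x)) ⟩
      enum (x ^ (α ℕ.+ α ℕ.+ 3) + (index a * x) ^ α - index a ^ 2 * x)
          ≈⟨ F.trans (enum-sub _ _) (F.+-cong (enum-index _) (F.-‿cong (enum-index _))) ⟩
      enum (x ^ (α ℕ.+ α ℕ.+ 3)) F.+ enum ((index a * x) ^ α) F.- enum (index a ^ 2) F.* enum x
        ≈⟨ F.+-cong (F.+-cong (F.trans (enum-^ x (α ℕ.+ α ℕ.+ 3)) (F-^-cong (α ℕ.+ α ℕ.+ 3) x≈))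
             (F.trans (enum-^ _ α) (F-^-cong α (F.trans (enum-index _) (F.*-cong (enum-index a) x≈)))))
             (F.-‿cong (F.*-cong (F.trans (enum-^ (index a) 2) (F-^-cong 2 (enum-index a))) x≈)) ⟩
      fₐ F α a (enum v F.^ᶠ 2)                                          ∎
      where
      open SetoidReasoning F.setoid
      x = v * v
      x≈ : enum x ≈ enum v F.^ᶠ 2
      x≈ = F.trans (enum-index _) (F.*-congˡ (F.sym (F.*-identityʳ _)))

    D⇒Image : ∀ {y} → D y → Image (index y)
    D⇒Image (v , v≉0 , eq) = v , (λ v≡0 → v≉0 (≡0⇒enum≈0 v≡0)) , enum-injective _ _
        (F.trans (enum-f v) (F.trans eq (F.sym (enum-index _))))

    Image⇒D : ∀ {y} → Image (index y) → D y
    Image⇒D (v , v≢0 , eq) = v , (λ v≈0 → v≢0 (enum≈0⇒ v≈0)) , F.trans (F.sym (enum-f v))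
        (F.trans (F.reflexive (cong enum eq)) (enum-index _))

    index-enum : ∀ i → index (enum i) ≡ i
    index-enum i = enum-injective _ _ (enum-index (enum i))

    index-neg : ∀ y → index (F.- y) ≡ - index y
    index-neg y = index-cong (F.-‿cong (F.sym (enum-index y)))

    D-neg⇒Image : ∀ {y} → D (F.- y) → Image (- index y)
    D-neg⇒Image {y} dy = subst Image (index-neg y) (D⇒Image dy)

    Image-neg⇒D : ∀ {y} → Image (- index y) → D (F.- y)
    Image-neg⇒D {y} iy = Image⇒D (subst Image (sym (index-neg y)) iy)

    skew-partition : SkewPartition F D
    skew-partition y =
      (λ y≈0 → (λ dy → ¬image-0 (subst Image (index-cong y≈0) (D⇒Image dy)))
             , (λ dy → ¬image-0 (subst Image (trans (index-cong (F.-‿cong y≈0)) (index-cong -0≈0)) (D⇒Image dy))))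
      , (λ y≉0 → Sum.map (λ { (iy , ¬iy) → Image⇒D iy , (λ dy → ¬iy (D-neg⇒Image dy)) })
                         (λ { (¬iy , iy) → (λ dy → ¬iy (D⇒Image dy)) , Image-neg⇒D iy })
                         (skew (index≢0 y≉0)))
      where
      -0≈0 : F.- F.0# ≈ F.0#
      -0≈0 = F.trans (F.sym (F.+-identityˡ _)) (F.-‿inverseʳ F.0#)

    pairs : Carrier → ℕ
    pairs g = sumFin q (λ i → countFin q (λ j → does
        (D? (enum i) ×-dec D? (enum j) ×-dec ¬? (enum i F.≟ enum j) ×-dec ((enum i F.- enum j) F.≟ g))))

    -- For g ≠ 0 the condition that the two elements differ follows from their difference being g,
    -- so both sides count the same pairs.
    ι-pairs : ∀ {g} → ¬ (g ≈ F.0#) → ι (pairs g) ≡ differences (index g)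
    ι-pairs {g} g≉0 = trans (ι-sumFin q _) (sum-cong (λ i → trans (ι-sumFin q _) (sum-cong (λ j → term i j))))
      where
      ι-if : ∀ b → ι (if b then 1 else 0) ≡ (if b then 𝟙 else 𝟘)
      ι-if true  = refl
      ι-if false = refl
      term : ∀ i j → ι (if does (D? (enum i) ×-dec D? (enum j) ×-dec ¬? (enum i F.≟ enum j) ×-dec
          ((enum i F.- enum j) F.≟ g)) then 1 else 0)
                   ≡ [ image? i ] ⊠ ([ image? j ] ⊠ [ (i - j) Fin.≟ index g ])
      term i j = trans (ι-if (does d)) (trans ([]-cong d (image? i ×-dec (image? j ×-dec ((i - j) Fin.≟ index g)))
          (λ { (di , dj , _ , eq) → subst Image (index-enum i) (D⇒Image di) , subst Image (index-enum j) (D⇒Image dj)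
             , enum-injective _ _ (F.trans (enum-sub i j) (F.trans eq (F.sym (enum-index g)))) })
          (λ { (ii , ij , eq) → Image⇒D (subst Image (sym (index-enum i)) ii) , Image⇒D (subst Image (sym (index-enum j)) ij)
             , (λ i≈j → g≉0 (F.trans (F.sym (difference eq)) (F.trans (F.+-congʳ i≈j) (F.-‿inverseʳ (enum j))))) ,
                 difference eq }))
          (trans ([]-× (image? i) (image? j ×-dec ((i - j) Fin.≟ index g)))
              (cong ([ image? i ] ⊠_) ([]-× (image? j) ((i - j) Fin.≟ index g)))))
        where
        d = D? (enum i) ×-dec D? (enum j) ×-dec ¬? (enum i F.≟ enum j) ×-dec ((enum i F.- enum j) F.≟ g)
        difference : i - j ≡ index g → enum i F.- enum j ≈ g
        difference eq = F.trans (F.sym (enum-sub i j)) (F.trans (F.reflexive (cong enum eq)) (enum-index g))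

  isSkewHadamardDifferenceSet : IsSkewHadamardDifferenceSet F (Dₐ F α a) (Dₐ? F α a)
  isSkewHadamardDifferenceSet =
    -- λ is taken to be the number of representations of 1.
    (_ , pairs F.1# , refl , λ g g≉0 → ι-injective (trans (ι-pairs g≉0)
      (trans (differences-constant (index≢0 g≉0) (index≢0 F.1≉0)) (sym (ι-pairs F.1≉0)))))
    , skew-partition

open import Data.Nat using (_+_; _*_; _^_)

theorem3p3 : (h : ℕ) → (F : FiniteField (3 ^ (2 * h + 1))) →
    (a : FiniteField.Carrier F) → ¬ (FiniteField._≈_ F a (FiniteField.0# F)) →
    IsSkewHadamardDifferenceSet F (Dₐ F (3 ^ (h + 1)) a) (Dₐ? F (3 ^ (h + 1)) a)
theorem3p3 h F a _ = Conclusion.isSkewHadamardDifferenceSet h F a
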